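{- Let $n\ge 1$ and let $C$ be a circuit computing $\mathrm{XOR}_n$ or $\neg\mathrm{XOR}_n$ that is optimal with respect to the number of $\land,\lor$ gates ($\neg$ gates are free). Then there is a partition of the (binary) gates of $C$ into $n-1$ blocks, together with a multi-labelling of each wire $w$ of $C$ by tuples $\langle i,t\rangle$, where $t\in\{\mathsf{in},\mathsf{out},\mathsf{core}\}$ describes the role that $w$ plays in block $i$, such that: 1. each block is a three-gate sub-circuit computing $\mathrm{XOR}_2$ or $\neg\mathrm{XOR}_2$, with distinguished input ($\mathsf{in}$), output ($\mathsf{out}$) and $\mathsf{core}$ wires; 2. the input wires of every block are also output wires of a different block, or are wires from the input gates (variables) of $C$; 3. contracting all the $\mathsf{core}$ wires of $C$ results in a binary tree.
   Context: Circuits: single-sink directed acyclic graphs with sources labelled by input variables (or constants) and internal nodes that are fan-in-2 $\land$, fan-in-2 $\lor$ or fan-in-1 $\neg$ gates, with unbounded fan-out. The size $|C|$ is the number of binary gates ($\land$, $\lor$); $CC(h)$ is the minimum size of a circuit computing $h$. A circuit computing $h$ is optimal if its size is $CC(h)$ and it is normalized: it has no constants (unless it is a single constant), every gate has a path to the output, it contains no double negations, every non-$\neg$ node feeds at most one $\neg$ gate, and no Boolean-identity simplification rule ($0\land\gamma\to 0$, $1\land\gamma\to\gamma$, $1\lor\gamma\to 1$, $0\lor\gamma\to\gamma$, $\gamma\land\neg\gamma\to0$, $\gamma\lor\neg\gamma\to1$, $\gamma\land\gamma\to\gamma$, $\gamma\lor\gamma\to\gamma$, $\neg\neg\gamma\to\gamma$,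 $\neg 0\to 1$, $\neg 1\to 0$, and their symmetric versions) applies. $\mathrm{XOR}_n(x)=1$ iff an odd number of bits of $x\in\{0,1\}^n$ equal $1$. Convention: only binary gates are counted as gates of a block, and $\neg$ gates are regarded as parts of wires (so a "wire" from $u$ to a binary gate $v$ may pass through a $\neg$ gate). The $\mathsf{in}$ wires of a block are those entering the block from outside (from its two sources), the $\mathsf{out}$ wires are those leaving the block from its output gate, and the $\mathsf{core}$ wires are those internal to the block. In the contracted object of item 3, parallel wires between the same source and the same contracted block are identified. -}

module Defs where

open import Data.Bool using (Bool; true; false; T; not; _∧_; _∨_; _≟_)
open import Data.Fin using (Fin)
open import Data.Fin.Subset using (Subset; _∈_; _∉_)
open import Data.List using (List; []; _∷_; length; filterᵇ; allFin)
open import Data.List.Relation.Unary.Any using (here; there)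
open import Data.Maybe using (Maybe; just; nothing)
open import Data.Nat using (ℕ; _≤_; _%_; _≡ᵇ_)
open import Data.Product using (Σ; ∃; ∃-syntax; Σ-syntax; _×_; _,_; proj₁)
open import Data.Sum using (_⊎_)
open import Data.Vec using (Vec; lookup; count)
open import Function using (_∘_; _⇔_; Injective)
open import Induction.WellFounded using (Acc; acc; WellFounded)
open import Relation.Binary.Construct.Closure.Equivalence using (EqClosure)
open import Relation.Binary.Construct.Closure.ReflexiveTransitive using (Star)
open import Relation.Binary.PropositionalEquality using (_≡_; _≢_; refl)
open import Relation.Nullary using (¬_)

import Data.List.Membership.Propositional as List

------------------------------------------------------------------------
-- Circuits

infixr 6 _and_
infixr 5 _or_

data Label (n : ℕ) (A : Set) : Set where
  var   : Fin n → Label n A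
  const : Bool → Label n A
  _and_ : A → A → Label n A
  _or_  : A → A → Label n A
  neg   : A → Label n A

module _ {n : ℕ} {A : Set} where

  operands : Label n A → List A
  operands (var _)   = []
  operands (const _) = []
  operands (u and v) = u ∷ v ∷ []
  operands (u or v)  = u ∷ v ∷ []
  operands (neg u)   = u ∷ []

  isBinary : Label n A → Bool
  isBinary (var _)   = false
  isBinary (const _) = false
  isBinary (_ and _) = true
  isBinary (_ or _)  = true
  isBinary (neg _)   = false

  isNeg : Label n A → Bool
  isNeg (var _)   = false
  isNeg (const _) = false
  isNeg (_ and _) = false
  isNeg (_ or _)  = false
  isNeg (neg _)   = true

  IsVar : Label n A → Set
  IsVar l = ∃[ i ] l ≡ var i

record Circuit (n : ℕ) : Set where
  field
    order : ℕ
  Node : Set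
  Node = Fin order
  field
    label : Node → Label n Node

  infix 4 _⟶_
  _⟶_ : Node → Node → Set
  u ⟶ v = u List.∈ operands (label v)

  field
    -- On a finite set of nodes, well-foundedness of the edge relation is
    -- the absence of directed cycles.
    acyclic        : WellFounded _⟶_
    output         : Node
    outputIsSink   : ∀ v → ¬ (output ⟶ v)
    onlySink       : ∀ u → (∀ v → ¬ (u ⟶ v)) → u ≡ output
    -- A variable has a single source node, with unbounded fan-out.
    distinctInputs : ∀ {u v i} → label u ≡ var i → label v ≡ var i → u ≡ v

  Binary : Node → Set
  Binary v = T (isBinary (label v))

  Neg : Node → Set
  Neg v = T (isNeg (label v))

  NonNeg : Node → Set
  NonNeg v = T (not (isNeg (label v)))

  -- Only ∧ and ∨ gates are counted.
  size : ℕ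
  size = length (filterᵇ (isBinary ∘ label) (allFin order))

module _ {n : ℕ} where

  evalLabel : {A : Set} → Vec Bool n → (l : Label n A) →
              (∀ {u} → u List.∈ operands l → Bool) → Bool
  evalLabel x (var i)   ρ = lookup x i
  evalLabel x (const b) ρ = b
  evalLabel x (u and v) ρ = ρ (here refl) ∧ ρ (there (here refl))
  evalLabel x (u or v)  ρ = ρ (here refl) ∨ ρ (there (here refl))
  evalLabel x (neg u)   ρ = not (ρ (here refl))

  module _ (C : Circuit n) where
    open Circuit C

    evalAcc : Vec Bool n → (v : Node) → Acc _⟶_ v → Bool
    evalAcc x v (acc rs) = evalLabel x (label v) (λ u⟶v → evalAcc x _ (rs u⟶v))

    eval : Vec Bool n → Bool
    eval x = evalAcc x output (acyclic output)

BoolFun : ℕ → Set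
BoolFun n = Vec Bool n → Bool

XOR : ∀ {n} → BoolFun n
XOR x = (count (_≟ true) x % 2) ≡ᵇ 1

¬XOR : ∀ {n} → BoolFun n
¬XOR = not ∘ XOR

Computes : ∀ {n} → Circuit n → BoolFun n → Set
Computes C h = ∀ x → eval C x ≡ h x

------------------------------------------------------------------------
-- Optimal circuits

-- CC h s : the minimum size of a circuit computing h is s.
CC : ∀ {n} → BoolFun n → ℕ → Set
CC {n} h s =
  (Σ[ D ∈ Circuit n ] Computes D h × size D ≡ s) ×
  ((D : Circuit n) → Computes D h → s ≤ size D)
  where open Circuit

module _ {n : ℕ} (C : Circuit n) where
  open Circuit C

  -- The labels of the gates to which a simplification rule applies.  In a
  -- rule, γ stands for a node of the circuit, and occurrences of the same γ
  -- are occurrences of the same node.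
  data Simplifiable : Label n Node → Set where
    0∧γ  : ∀ {z γ} → label z ≡ const false → Simplifiable (z and γ)
    γ∧0  : ∀ {z γ} → label z ≡ const false → Simplifiable (γ and z)
    1∧γ  : ∀ {z γ} → label z ≡ const true  → Simplifiable (z and γ)
    γ∧1  : ∀ {z γ} → label z ≡ const true  → Simplifiable (γ and z)
    1∨γ  : ∀ {z γ} → label z ≡ const true  → Simplifiable (z or γ)
    γ∨1  : ∀ {z γ} → label z ≡ const true  → Simplifiable (γ or z)
    0∨γ  : ∀ {z γ} → label z ≡ const false → Simplifiable (z or γ)
    γ∨0  : ∀ {z γ} → label z ≡ const false → Simplifiable (γ or z)
    γ∧¬γ : ∀ {z γ} → label z ≡ neg γ → Simplifiable (γ and z)
    ¬γ∧γ : ∀ {z γ} → label z ≡ neg γ → Simplifiable (z and γ)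
    γ∨¬γ : ∀ {z γ} → label z ≡ neg γ → Simplifiable (γ or z)
    ¬γ∨γ : ∀ {z γ} → label z ≡ neg γ → Simplifiable (z or γ)
    γ∧γ  : ∀ {γ} → Simplifiable (γ and γ)
    γ∨γ  : ∀ {γ} → Simplifiable (γ or γ)
    ¬¬γ  : ∀ {z γ} → label z ≡ neg γ → Simplifiable (neg z)
    ¬0   : ∀ {z} → label z ≡ const false → Simplifiable (neg z)
    ¬1   : ∀ {z} → label z ≡ const true  → Simplifiable (neg z)

  record Normalized : Set where
    field
      noConstants  : (∀ u b → label u ≢ const b) ⊎
                     (∃[ b ] label output ≡ const b × (∀ u → u ≡ output))
      reachesOutput : ∀ v → Star _⟶_ v output
      noDoubleNeg  : ∀ {u v} → u ⟶ v → Neg v → ¬ Neg u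
      atMostOneNeg : ∀ {u v w} → NonNeg u →
                     u ⟶ v → Neg v → u ⟶ w → Neg w → v ≡ w
      noSimplification : ∀ v → ¬ Simplifiable (label v)

  Optimal : BoolFun n → Set
  Optimal h = Computes C h × CC h size × Normalized

------------------------------------------------------------------------
-- Wires

module _ {n : ℕ} (C : Circuit n) where
  open Circuit C

  -- The node at which a wire drawn from v starts: ¬ gates are parts of wires
  -- and are skipped.
  originLabel : Node → (l : Label n Node) →
                (∀ {u} → u List.∈ operands l → Node) → Node
  originLabel v (var _)   ρ = v
  originLabel v (const _) ρ = v
  originLabel v (_ and _) ρ = v
  originLabel v (_ or _)  ρ = v
  originLabel v (neg _)   ρ = ρ (here refl)

  originAcc : (v : Node) → Acc _⟶_ v → Node
  originAcc v (acc rs) =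
    originLabel v (label v) (λ u⟶v → originAcc _ (rs u⟶v))

  origin : Node → Node
  origin v = originAcc v (acyclic v)

  -- A wire enters a binary gate at one of its two operand positions (told
  -- apart by the membership proof u ⟶ v), or is the wire that carries the
  -- value of the circuit, possibly through a final ¬ gate.
  data Wire : Set where
    into    : ∀ {u v} → Binary v → u ⟶ v → Wire
    outward : Wire

  tail : Wire → Node
  tail (into {u} _ _) = origin u
  tail outward        = origin output

  head : Wire → Maybe Node
  head (into {v = v} _ _) = just v
  head outward            = nothing

  HeadIn : Subset order → Wire → Set
  HeadIn B w = ∃[ v ] head w ≡ just v × v ∈ B

------------------------------------------------------------------------
-- Blocks and multi-labellings

data Role : Set where
  in′ out core : Role

module _ {n : ℕ} (C : Circuit n) where
  open Circuit C

  HasRole : Subset order → Role → Wire C → Set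
  HasRole B in′  w = tail C w ∉ B × HeadIn C B w
  HasRole B out  w = tail C w ∈ B × ¬ HeadIn C B w
  HasRole B core w = tail C w ∈ B × HeadIn C B w

  -- Nonemptiness of the parts is part of IsXORBlock.
  record IsPartition {m : ℕ} (block : Fin m → Subset order) : Set where
    field
      binary   : ∀ i {v} → v ∈ block i → Binary v
      covers   : ∀ {v} → Binary v → ∃[ i ] v ∈ block i
      disjoint : ∀ {i j v} → v ∈ block i → v ∈ block j → i ≡ j

  MultiLabelling : ℕ → Set
  MultiLabelling m = Wire C → Fin m × Role → Bool

  Describes : ∀ {m} → MultiLabelling m → (Fin m → Subset order) → Set
  Describes lab block =
    ∀ w i t → T (lab w (i , t)) ⇔ HasRole (block i) t w

-- A source of the sub-circuit labelled by a variable may be any node of the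
-- ambient circuit; all other nodes are copied verbatim.
data Matches {k n : ℕ} {A B : Set} (f : A → B) : Label k A → Label n B → Set where
  var   : ∀ {i l} → Matches f (var i) l
  const : ∀ {b} → Matches f (const b) (const b)
  _and_ : ∀ u v → Matches f (u and v) (f u and f v)
  _or_  : ∀ u v → Matches f (u or v) (f u or f v)
  neg   : ∀ u → Matches f (neg u) (neg (f u))

record SubCircuit {k n : ℕ} (D : Circuit k) (C : Circuit n) : Set where
  private
    module D = Circuit D
    module C = Circuit C
  field
    embed     : D.Node → C.Node
    injective : Injective _≡_ _≡_ embed
    matches   : ∀ d → Matches embed (D.label d) (C.label (embed d))

module _ {n : ℕ} (C : Circuit n) where
  open Circuit C

  -- The block B is a three-gate sub-circuit computing XOR₂ or ¬XOR₂.  The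
  -- sub-circuit D also contains the two sources of the block and the ¬ gates
  -- on its wires; its binary gates are those of B.
  record IsXORBlock (B : Subset order) (label⟨_⟩ : Role → Wire C → Set) : Set where
    field
      D          : Circuit 2
      threeGates : Circuit.size D ≡ 3
      computes   : Computes D XOR ⊎ Computes D ¬XOR
      sub        : SubCircuit D C
    private module D = Circuit D
    open SubCircuit sub
    field
      gates     : ∀ v → v ∈ B ⇔ (∃[ d ] D.Binary d × embed d ≡ v)
      sources   : ∀ d → IsVar (D.label d) → NonNeg (embed d)
      outGate   : D.Binary D.output
      inWires   : ∀ w → label⟨ in′ ⟩ w →
                  ∃[ d ] IsVar (D.label d) × tail C w ≡ embed d
      outWires  : ∀ w → label⟨ out ⟩ w → tail C w ≡ embed D.output

  InputsAreOutputs : ∀ {m} → MultiLabelling C m → Set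
  InputsAreOutputs lab =
    ∀ i w → T (lab w (i , in′)) →
      (∃[ j ] j ≢ i × T (lab w (j , out))) ⊎ IsVar (label (tail C w))

------------------------------------------------------------------------
-- Contraction and binary trees

-- A directed graph without parallel edges on a set of vertices considered
-- up to _≈_.
record Digraph : Set₁ where
  infix 4 _≈_ _⇒_
  field
    Vertex : Set
    _≈_    : Vertex → Vertex → Set
    _⇒_    : Vertex → Vertex → Set

-- A rooted tree, with edges directed towards the root, in which every vertex
-- has either no child or exactly two children.
record IsBinaryTree (G : Digraph) : Set where
  open Digraph G
  field
    root         : Vertex
    rootIsSink   : ∀ v → ¬ (root ⇒ v)
    uniqueParent : ∀ {v x y} → v ⇒ x → v ⇒ y → x ≈ y
    reachesRoot  : ∀ v → Star (λ x y → x ≈ y ⊎ x ⇒ y) v root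
    children     : ∀ v → (∀ u → ¬ (u ⇒ v)) ⊎
                   (∃[ l ] ∃[ r ] ¬ (l ≈ r) × l ⇒ v × r ⇒ v ×
                     (∀ u → u ⇒ v → u ≈ l ⊎ u ≈ r))

module _ {n : ℕ} (C : Circuit n) where
  open Circuit C

  -- Contracting the wires satisfying K: their endpoints are identified, and
  -- the other wires between gates or sources remain as edges.
  contract : (Wire C → Set) → Digraph
  contract K = record
    { Vertex = V
    ; _≈_    = _~_
    ; _⇒_    = λ x y → ∃[ w ] ¬ K w × (∃[ x′ ] ∃[ y′ ] x′ ~ x × y′ ~ y × Joins w x′ y′)
    }
    where
    V : Set
    V = Σ[ u ∈ Node ] NonNeg u

    Joins : Wire C → V → V → Set
    Joins w x y = tail C w ≡ proj₁ x × head C w ≡ just (proj₁ y)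

    _~_ : V → V → Set
    _~_ = EqClosure (λ x y → ∃[ w ] K w × Joins w x y)

  CoreWire : ∀ {m} → MultiLabelling C m → Wire C → Set
  CoreWire lab w = ∃[ i ] T (lab w (i , core))

{-# OPTIONS --safe #-}

-- Idea.  Each node is identified with the Boolean function it computes, up to
-- sign; ¬ gates then disappear and every gate is an ∧.  A restriction of one
-- variable kills a gate if its function becomes constant, a literal, or a copy
-- of an earlier one; the surviving gates still compute the parity of the
-- remaining variables.
--
-- Take a gate g of minimal rank, the ∧ of literals of x and y, and fix x so
-- that g becomes constant.  This kills g, another gate h fed by x (otherwise,
-- after fixing y so that g is constant, nothing would depend on x), and a gate
-- fed by g or by h.  Hence parity of n variables needs 3 (n - 1) gates, and in a
-- circuit of that size every restriction kills at most three.
--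
-- In the tight case this budget forces the successors: x and y feed exactly g
-- and h, while g and h feed only one gate p.  Each alternative leaves an input
-- that reaches the output through a single gate, which the other inputs can
-- make constant.  Then g and h are minterms of opposite assignments, so p is
-- x ⊕ y up to sign.  Fixing x removes exactly g, h and p, and p takes the place
-- of the variable y; induction gives all blocks.
module Submission where

open import Defs
open import Data.Bool using (Bool; true; false; T; T?; not; _∧_; _∨_; _xor_; if_then_else_)
import Data.Bool as Bool
open import Data.Bool.Properties using (∧-comm; not-¬; ¬-not; not-involutive; xor-same; xor-assoc; xor-comm; xor-identityʳ; T-irrelevant)
open import Data.Empty using (⊥; ⊥-elim)
open import Data.Fin using (Fin; zero; suc; toℕ; punchIn; punchOut)
import Data.Fin.Properties as Finₚ
open import Data.Fin.Subset using (Subset; _∈_; _∪_; ⁅_⁆)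
open import Data.Fin.Subset.Properties using (_∈?_; x∈⁅x⁆; x∈⁅y⁆⇒x≡y; x∈p∪q⁺; x∈p∪q⁻)
open import Data.List using (List; []; _∷_; length; filter; filterᵇ; allFin; tabulate)
import Data.List as List
open import Data.List.Membership.Propositional using (find; lose) renaming (_∈_ to _∈ˡ_)
open import Data.List.Membership.Propositional.Properties using (∈-filter⁺; ∈-filter⁻; ∈-allFin; ∈-lookup)
open import Data.List.Properties using (length-filter; filter-notAll)
open import Data.List.Relation.Unary.All as All using (All; []; _∷_)
open import Data.List.Relation.Unary.AllPairs using ([]; _∷_)
open import Data.List.Relation.Unary.Any as Any using (Any; here; there; any?)
open import Data.List.Relation.Unary.Any.Properties using (lookup-index)
open import Data.List.Relation.Unary.Unique.Propositional using (Unique)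
open import Data.List.Relation.Unary.Unique.Propositional.Properties using (filter⁺; allFin⁺)
open import Data.Maybe using (just)
open import Data.Maybe.Properties using (just-injective)
open import Data.Nat using (ℕ; zero; suc; _<_; _≤_; _≥_; z≤n; s≤s; _+_; _∸_; _*_; _%_; _≡ᵇ_; _<?_)
open import Data.Nat.Induction using (<-wellFounded)
import Data.Nat.Properties as ℕₚ
open import Data.Product using (∃-syntax; Σ-syntax; _×_; _,_; proj₁; proj₂)
import Data.Sum as Sum
open import Data.Sum using (_⊎_; inj₁; inj₂)
open import Data.Unit using (tt)
open import Data.Vec using (Vec; []; _∷_; lookup; insertAt; updateAt; _[_]≔_; replicate; count)
open import Data.Vec.Properties using (insertAt-lookup; insertAt-punchIn; lookup∘updateAt; lookup∘updateAt′)
open import Function using (_∘_; case_of_; mk⇔)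
open import Induction.WellFounded using (Acc; acc)
open import Relation.Binary using (tri<; tri≈; tri>)
import Relation.Binary.Construct.Closure.Equivalence as EqClosure
open import Relation.Binary.Construct.Closure.ReflexiveTransitive using (Star; ε; _◅_)
open import Relation.Binary.PropositionalEquality
open import Relation.Nullary using (¬_; Dec; yes; no; contradiction; ¬?)
open import Relation.Nullary.Decidable using (toWitness; fromWitness; isYes; ⌊_⌋; map′; _×-dec_; _⊎-dec_; _→-dec_)
open import Relation.Unary using (Decidable)

-- Boolean functions up to sign

-- The net is never rebuilt. A restriction changes only the interpretation and shortens the list of
-- gates in play; an operand is available as soon as some earlier listed gate computes the same
-- function up to sign. Deleting a gate thus needs no rewiring, and the lower bound holds for every
-- list of gates that supports parity, not only for circuits. Dependence on an input is tested by
-- flipping it. Parity changes at every flip, so one assignment at which no change reaches the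
-- output is a contradiction. Functions do not determine wires, whereas the theorem speaks of the
-- wires of the whole circuit. The induction therefore carries two syntactic invariants: surviving
-- gates read only survivors and nodes that represent inputs, and removed gates read neither. That
-- an optimal circuit stays within the budget follows from an explicit circuit with 3 (n - 1) gates.

∀-Bool? : ∀ {p} {P : Bool → Set p} → (∀ b → Dec (P b)) → Dec (∀ b → P b)
∀-Bool? {P = P} P? = map′ (λ { (f , t) false → f ; (f , t) true → t }) (λ p → p false , p true)
                 (P? false ×-dec P? true)

xor-cancelˡ : ∀ s b → s xor s xor b ≡ b
xor-cancelˡ = toWitness {a? = ∀-Bool? λ s → ∀-Bool? λ b → (s xor s xor b) Bool.≟ b} _

-- Failure comes with an explicit assignment; `constOn?` turns it into a point at which an input can
-- be flipped.
∀-or-counterexample : ∀ {m} {P : Vec Bool m → Set} → (∀ a → Dec (P a)) →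
                      (∀ a → P a) ⊎ (∃[ a ] ¬ P a)
∀-or-counterexample {zero} P? with P? []
... | yes p = inj₁ λ { [] → p }
... | no ¬p = inj₂ ([] , ¬p)
∀-or-counterexample {suc m} P? with ∀-or-counterexample (P? ∘ (false ∷_)) | ∀-or-counterexample (P? ∘ (true ∷_))
... | inj₂ (a , ¬p) | _             = inj₂ (false ∷ a , ¬p)
... | inj₁ _        | inj₂ (a , ¬p) = inj₂ (true ∷ a , ¬p)
... | inj₁ p        | inj₁ q        = inj₁ λ { (false ∷ a) → p a ; (true ∷ a) → q a }

∀-Vec? : ∀ {m} {P : Vec Bool m → Set} → (∀ a → Dec (P a)) → Dec (∀ a → P a)
∀-Vec? P? with ∀-or-counterexample P?
... | inj₁ p        = yes p
... | inj₂ (a , ¬p) = no λ p → ¬p (p a)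

infix 4 _~_

-- The sign is a Boolean rather than a disjunction of two cases, so that composing agreements is
-- `xor` of signs.
record _~_ {m} (f g : BoolFun m) : Set where
  constructor _,_
  field
    sign : Bool
    eq   : ∀ a → f a ≡ sign xor g a

~-refl : ∀ {m} {f : BoolFun m} → f ~ f
~-refl = false , λ _ → refl

~-sym : ∀ {m} {f g : BoolFun m} → f ~ g → g ~ f
~-sym {f = f} {g} (s , e) = s , λ a → trans (sym (xor-cancelˡ s (g a))) (cong (s xor_) (sym (e a)))

~-trans : ∀ {m} {f g h : BoolFun m} → f ~ g → g ~ h → f ~ h
~-trans (s , e) (t , d) = s xor t , λ a → trans (e a) (trans (cong (s xor_) (d a)) (sym (xor-assoc s t _)))

infix 4 _~?_

_~?_ : ∀ {m} (f g : BoolFun m) → Dec (f ~ g)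
f ~? g = map′ (λ { (inj₁ e) → false , e ; (inj₂ e) → true , e })
              (λ { (false , e) → inj₁ e ; (true , e) → inj₂ e })
              (∀-Vec? (λ a → f a Bool.≟ g a) ⊎-dec ∀-Vec? (λ a → f a Bool.≟ not (g a)))

coord : ∀ {m} → Fin m → BoolFun m
coord i a = lookup a i

-- These are the functions that cost no gate.
data Trivial {m} (f : BoolFun m) : Set where
  constant : ∀ c → (∀ a → f a ≡ c) → Trivial f
  literal  : ∀ i → f ~ coord i → Trivial f

trivial? : ∀ {m} (f : BoolFun m) → Dec (Trivial f)
trivial? f = map′ (λ { (inj₁ (inj₁ e)) → constant false e ; (inj₁ (inj₂ e)) → constant true e ; (inj₂ (i , e)) → literal i e })
                  (λ { (constant false e) → inj₁ (inj₁ e) ; (constant true e) → inj₁ (inj₂ e) ; (literal i e) → inj₂ (i , e) })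
                  ((∀-Vec? (λ a → f a Bool.≟ false) ⊎-dec ∀-Vec? (λ a → f a Bool.≟ true)) ⊎-dec
                   Finₚ.any? (λ i → f ~? coord i))

trivial-resp-~ : ∀ {m} {f g : BoolFun m} → f ~ g → Trivial g → Trivial f
trivial-resp-~ (s , e) (constant c d) = constant (s xor c) λ a → trans (e a) (cong (s xor_) (d a))
trivial-resp-~ r       (literal i q)  = literal i (~-trans r q)

-- Restrictions and flips

restrict : ∀ {m} → Fin (suc m) → Bool → BoolFun (suc m) → BoolFun m
restrict x c f a = f (insertAt a x c)

ConstOn : ∀ {m} → Fin m → Bool → BoolFun m → Set
ConstOn x c f = ∃[ b ] ∀ a → lookup a x ≡ c → f a ≡ b

restrict-~ : ∀ {m x c} {f g : BoolFun (suc m)} → f ~ g → restrict x c f ~ restrict x c g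
restrict-~ {x = x} {c} (s , e) = s , λ a → e (insertAt a x c)

restrict-const : ∀ {m x c} {f : BoolFun (suc m)} → ConstOn x c f → ∃[ b ] ∀ a → restrict x c f a ≡ b
restrict-const {x = x} {c} (b , e) = b , λ a → e (insertAt a x c) (insertAt-lookup a x c)

restrict-coord : ∀ {m} x c {f : BoolFun (suc m)} {j} (x≢j : x ≢ j) → f ~ coord j →
                 restrict x c f ~ coord (punchOut x≢j)
restrict-coord x c {j = j} x≢j (s , e) = s , λ a → trans (e (insertAt a x c)) (cong (s xor_)
  (trans (cong (lookup (insertAt a x c)) (sym (Finₚ.punchIn-punchOut x≢j))) (insertAt-punchIn a x c _)))

coord-constOn : ∀ {m x c} {f : BoolFun m} → f ~ coord x → ConstOn x c f
coord-constOn {c = c} (s , e) = s xor c , λ a p → trans (e a) (cong (s xor_) p)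

restrict-trivial : ∀ {m} x c {f : BoolFun (suc m)} → Trivial f → Trivial (restrict x c f)
restrict-trivial x c (constant b e) = constant b λ a → e _
restrict-trivial x c (literal j q) with x Finₚ.≟ j
... | yes refl = let b , e = restrict-const (coord-constOn {c = c} q) in constant b e
... | no x≢j   = literal _ (restrict-coord x c x≢j q)

flip : ∀ {m} → Fin m → Vec Bool m → Vec Bool m
flip x a = updateAt a x not

lookup-flip : ∀ {m} (x : Fin m) a → lookup (flip x a) x ≡ not (lookup a x)
lookup-flip x a = lookup∘updateAt x a

lookup-flip′ : ∀ {m} {x y : Fin m} a → y ≢ x → lookup (flip x a) y ≡ lookup a y
lookup-flip′ {x = x} {y} a y≢x = lookup∘updateAt′ y x y≢x a

-- Coordinates other than `x` and `y` never matter and default to `false`. The update at `y` comes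
-- last, so the value at `x` is `c` only when `x ≢ y`.
point : ∀ {m} → Fin m → Bool → Fin m → Bool → Vec Bool m
point x c y d = (replicate _ false [ x ]≔ c) [ y ]≔ d

lookup-point₂ : ∀ {m} (x : Fin m) c y d → lookup (point x c y d) y ≡ d
lookup-point₂ x c y d = lookup∘updateAt y (replicate _ false [ x ]≔ c)

lookup-point₁ : ∀ {m} {x : Fin m} c {y} d → x ≢ y → lookup (point x c y d) x ≡ c
lookup-point₁ {x = x} c {y} d x≢y =
  trans (lookup∘updateAt′ x y x≢y (replicate _ false [ x ]≔ c)) (lookup∘updateAt x (replicate _ false))

-- Parity

parity : ∀ {m} → BoolFun m
parity []      = false
parity (b ∷ a) = b xor parity a

parity-flip : ∀ {m} (x : Fin m) a → parity (flip x a) ≡ not (parity a)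
parity-flip zero    (true ∷ a)  = sym (not-involutive _)
parity-flip zero    (false ∷ a) = refl
parity-flip (suc x) (true ∷ a)  = cong not (parity-flip x a)
parity-flip (suc x) (false ∷ a) = parity-flip x a

parity-restrict : ∀ {m} x c → restrict x c (parity {suc m}) ~ parity
parity-restrict x c = c , eq x
  where
  swap : ∀ b c p → b xor (c xor p) ≡ c xor (b xor p)
  swap = toWitness {a? = ∀-Bool? λ b → ∀-Bool? λ c → ∀-Bool? λ p → (b xor (c xor p)) Bool.≟ (c xor (b xor p))} _
  eq : ∀ {m} (x : Fin (suc m)) a → parity (insertAt a x c) ≡ c xor parity a
  eq zero    a       = refl
  eq (suc x) (b ∷ a) = trans (cong (b xor_) (eq x a)) (swap b c (parity a))

-- Every flip changes parity, so a single flip that `f` does not notice excludes both signs.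
parity≁ : ∀ {m} {f : BoolFun m} x a → f a ≡ f (flip x a) → ¬ (parity ~ f)
parity≁ x a f≡ (s , e) = not-¬ {parity a} refl
  (trans (e a) (trans (cong (s xor_) f≡) (trans (sym (e (flip x a))) (parity-flip x a))))

-- The flip is made at `y`, inside the half cube where `f` is constant.
parity≁constOn : ∀ {m x y c} {f : BoolFun m} → x ≢ y → ConstOn x c f → ¬ (parity ~ f)
parity≁constOn {x = x} {y} {c} x≢y (b , e) = parity≁ y a (trans (e a ax) (sym (e _ (trans (lookup-flip′ a x≢y) ax))))
  where
  a  = point x c y false
  ax = lookup-point₁ c false x≢y

-- Two inputs are essential: on one input parity is a literal. A literal becomes constant when its
-- variable is fixed, while the parity still depends on another one.
parity-nontrivial : ∀ {m} → ¬ Trivial (parity {suc (suc m)})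
parity-nontrivial {m} (constant c e) = parity≁ {f = λ _ → c} zero (replicate _ false) refl (false , e)
parity-nontrivial (literal zero q)    = parity≁constOn {y = suc zero} {c = false} (λ ()) (coord-constOn ~-refl) q
parity-nontrivial (literal (suc i) q) = parity≁constOn {y = zero} {c = false} (λ ()) (coord-constOn ~-refl) q

coord-injective : ∀ {m} {x y : Fin m} → coord x ~ coord y → x ≡ y
coord-injective {x = x} {y} (s , e) with x Finₚ.≟ y
... | yes x≡y = x≡y
... | no x≢y  = contradiction
  (trans (e a) (trans (cong (s xor_) (sym (lookup-flip′ a (x≢y ∘ sym)))) (trans (sym (e (flip x a))) (lookup-flip x a))))
  (not-¬ refl)
  where a = replicate _ false

constOn-resp-~ : ∀ {m x c} {f g : BoolFun m} → f ~ g → ConstOn x c g → ConstOn x c f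
constOn-resp-~ (s , e) (b , d) = s xor b , λ a p → trans (e a) (cong (s xor_) (d a p))

constOn? : ∀ {m} x c (f : BoolFun m) → ∀ b → (∀ a → lookup a x ≡ c → f a ≡ b) ⊎ (∃[ a ] lookup a x ≡ c × f a ≡ not b)
constOn? x c f b with ∀-or-counterexample (λ a → (lookup a x Bool.≟ c) →-dec (f a Bool.≟ b))
... | inj₁ p        = inj₁ p
... | inj₂ (a , ¬p) with lookup a x Bool.≟ c
...   | yes q = inj₂ (a , q , ¬-not λ r → ¬p λ _ → r)
...   | no ¬q = contradiction (λ q → contradiction q ¬q) ¬p

-- Counting

module _ {N : ℕ} where

  private
    variable
      xs ys : List (Fin N)

  length-mono-⊆ : Unique xs → (∀ {v} → v ∈ˡ xs → v ∈ˡ ys) → length xs ≤ length ys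
  length-mono-⊆ [] _ = z≤n
  length-mono-⊆ {x ∷ xs} {ys} (x≢ ∷ u) sub = ℕₚ.≤-trans
    (s≤s (length-mono-⊆ u λ v∈ → ∈-filter⁺ (λ v → ¬? (x Finₚ.≟ v)) (sub (there v∈)) (All.lookup x≢ v∈)))
    (filter-notAll (λ v → ¬? (x Finₚ.≟ v)) ys (lose (sub (here refl)) λ ¬eq → ¬eq refl))

  module _ {P : Fin N → Set} (P? : Decidable P) where

    length-filter-¬ : ∀ xs → length (filter (¬? ∘ P?) xs) + length (filter P? xs) ≡ length xs
    length-filter-¬ [] = refl
    length-filter-¬ (x ∷ xs) with P? x
    ... | yes _ = trans (ℕₚ.+-suc _ _) (cong suc (length-filter-¬ xs))
    ... | no  _ = cong suc (length-filter-¬ xs)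

    -- The budget inequality of gate elimination: with `P` read as survival, `ks` are killed gates
    -- that have been named explicitly.
    length-filter-≤ : ∀ {ks} → Unique ks → All (λ k → k ∈ˡ xs × ¬ P k) ks → length ks + length (filter P? xs) ≤ length xs
    length-filter-≤ {xs} u ks⊆ = ℕₚ.≤-trans
      (ℕₚ.+-monoˡ-≤ _ (length-mono-⊆ u λ k∈ → let k∈xs , ¬p = All.lookup ks⊆ k∈ in ∈-filter⁺ (¬? ∘ P?) k∈xs ¬p))
      (ℕₚ.≤-reflexive (length-filter-¬ xs))

-- Nets: circuits whose ¬ gates are absorbed into signs

record Net : Set₁ where
  field
    N        : ℕ
  Node : Set
  Node = Fin N
  field
    Gate     : Node → Set
    src      : Node → Bool → Node
    sgn      : Node → Bool → Bool
    osgn     : Node → Bool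
    rank     : Node → ℕ
    -- Injectivity makes the ranks a strict total order, so of two distinct nodes with the same
    -- function one is always the earlier.
    rank-inj : ∀ {u v} → rank u ≡ rank v → u ≡ v
    src-rank : ∀ {v} → Gate v → ∀ k → rank (src v k) < rank v

-- Supports of parity and irredundant lists of gates

module NetTheory (net : Net) where
  open Net net

  -- The functions are kept apart from the net, so that a restriction leaves nodes, wires and ranks
  -- untouched.
  record Interp (m : ℕ) : Set where
    field
      φ    : Node → BoolFun m
      φ-eq : ∀ {v} → Gate v → ∀ a →
             φ v a ≡ osgn v xor ((sgn v false xor φ (src v false) a) ∧ (sgn v true xor φ (src v true) a))

    φ-eqₖ : ∀ {v} → Gate v → ∀ k a →
            φ v a ≡ osgn v xor ((sgn v k xor φ (src v k) a) ∧ (sgn v (not k) xor φ (src v (not k)) a))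
    φ-eqₖ g false a = φ-eq g a
    φ-eqₖ {v} g true a = trans (φ-eq g a) (cong (osgn v xor_) (∧-comm (sgn v false xor φ (src v false) a) _))

    -- After its sign, a constant is either absorbing or neutral for ∧.
    const-operand : ∀ {v} → Gate v → ∀ k {b} → (∀ a → φ (src v k) a ≡ b) →
                    (∃[ c ] ∀ a → φ v a ≡ c) ⊎ φ v ~ φ (src v (not k))
    const-operand {v} g k {b} e with sgn v k xor b in eq
    ... | false = inj₁ (osgn v xor false , λ a → trans (φ-eqₖ g k a) (cong (λ z → osgn v xor (z ∧ (sgn v (not k) xor φ (src v (not k)) a))) (trans (cong (sgn v k xor_) (e a)) eq)))
    ... | true  = inj₂ (osgn v xor sgn v (not k) , λ a → trans (φ-eqₖ g k a)
                    (trans (cong (λ z → osgn v xor (z ∧ (sgn v (not k) xor φ (src v (not k)) a))) (trans (cong (sgn v k xor_) (e a)) eq)) (sym (xor-assoc (osgn v) (sgn v (not k)) _))))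

  restrictᴵ : ∀ {m} → Fin (suc m) → Bool → Interp (suc m) → Interp m
  restrictᴵ x c I = record
    { φ    = λ v → restrict x c (φ v)
    ; φ-eq = λ g a → φ-eq g (insertAt a x c)
    }
    where open Interp I

  module _ {m : ℕ} (I : Interp m) (S : List Node) where
    open Interp I

    -- What a gate of rank `r` may read. The condition concerns functions only; which node actually
    -- supplies the operand is irrelevant.
    data Below (r : ℕ) (f : BoolFun m) : Set where
      trivial : Trivial f → Below r f
      earlier : ∀ {s} → s ∈ˡ S → rank s < r → f ~ φ s → Below r f

    below? : ∀ r f → Dec (Below r f)
    below? r f = map′ to (λ { (trivial t) → inj₁ t ; (earlier s∈ lt q) → inj₂ (lose s∈ (lt , q)) })
                      (trivial? f ⊎-dec any? (λ s → (rank s <? r) ×-dec (f ~? φ s)) S)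
      where
      to : Trivial f ⊎ Any (λ s → rank s < r × f ~ φ s) S → Below r f
      to (inj₁ t) = trivial t
      to (inj₂ p) = let s , s∈ , lt , q = find p in earlier s∈ lt q

    Dead : Node → Set
    Dead v = Below (rank v) (φ v)

    dead? : Decidable Dead
    dead? v = below? (rank v) (φ v)

    -- Operands need only agree with earlier elements up to sign, so gates repeating a function can be dropped.
    record Support : Set where
      field
        gate    : ∀ {v} → v ∈ˡ S → Gate v
        operand : ∀ {v} → v ∈ˡ S → ∀ k → Below (rank v) (φ (src v k))
        covers  : Trivial (parity {m}) ⊎ (∃[ s ] s ∈ˡ S × parity ~ φ s)

    -- Reading is semantic as well: any operand that agrees with `f` up to sign counts, even one
    -- whose node was deleted in favour of an earlier copy.
    Feeds : BoolFun m → Node → Set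
    Feeds f v = ∃[ k ] φ (src v k) ~ f

    feeds? : ∀ f → Decidable (Feeds f)
    feeds? f v = map′ (λ { (inj₁ p) → false , p ; (inj₂ p) → true , p })
                      (λ { (false , p) → inj₁ p ; (true , p) → inj₂ p })
                      ((φ (src v false) ~? f) ⊎-dec (φ (src v true) ~? f))

    record Irredundant : Set where
      field
        support : Support
        alive   : ∀ {v} → v ∈ˡ S → ¬ Dead v
        used    : ∀ {s} → s ∈ˡ S → ¬ parity ~ φ s → ∃[ v ] v ∈ˡ S × Feeds (φ s) v
      open Support support public

  below-~ : ∀ {m} {I : Interp m} {S r f g} → f ~ g → Below I S r g → Below I S r f
  below-~ p (trivial t)       = trivial (trivial-resp-~ p t)
  below-~ p (earlier s∈ lt q) = earlier s∈ lt (~-trans p q)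

  module _ {m : ℕ} (I : Interp m) (S : List Node) where
    open Interp I

    live : List Node
    live = filter (¬? ∘ dead? I S) S

    live⁺ : ∀ {v} → v ∈ˡ S → ¬ Dead I S v → v ∈ˡ live
    live⁺ = ∈-filter⁺ (¬? ∘ dead? I S)

    live⁻ : ∀ {v} → v ∈ˡ live → v ∈ˡ S × ¬ Dead I S v
    live⁻ = ∈-filter⁻ (¬? ∘ dead? I S)

    -- A dead nontrivial gate points to an earlier copy. Ranks decrease along such pointers, so the
    -- chain ends at a live gate or at a trivial function.
    represent : ∀ {v} → Acc _<_ (rank v) → v ∈ˡ S →
                Trivial (φ v) ⊎ (∃[ s ] s ∈ˡ live × rank s ≤ rank v × φ v ~ φ s)
    represent {v} (acc rs) v∈ with dead? I S v
    ... | no ¬d                    = inj₂ (v , ∈-filter⁺ (¬? ∘ dead? I S) v∈ ¬d , ℕₚ.≤-refl , ~-refl)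
    ... | yes (trivial t)          = inj₁ t
    ... | yes (earlier s∈ lt q) with represent (rs lt) s∈
    ...   | inj₁ t                  = inj₁ (trivial-resp-~ q t)
    ...   | inj₂ (s , s∈′ , le , p) = inj₂ (s , s∈′ , ℕₚ.≤-trans le (ℕₚ.<⇒≤ lt) , ~-trans q p)

    below-live : ∀ {r f} → Below I S r f → Below I live r f
    below-live (trivial t) = trivial t
    below-live (earlier s∈ lt q) with represent (<-wellFounded _) s∈
    ... | inj₁ t                  = trivial (trivial-resp-~ q t)
    ... | inj₂ (s , s∈′ , le , p) = earlier s∈′ (ℕₚ.≤-<-trans le lt) (~-trans q p)

    support-live : Support I S → Support I live
    support-live sup = record
      { gate    = gate ∘ proj₁ ∘ ∈-filter⁻ (¬? ∘ dead? I S)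
      ; operand = λ v∈ k → below-live (operand (proj₁ (∈-filter⁻ (¬? ∘ dead? I S) v∈)) k)
      ; covers  = cov covers
      }
      where
      open Support sup
      cov : Trivial (parity {m}) ⊎ (∃[ s ] s ∈ˡ S × parity ~ φ s) →
            Trivial (parity {m}) ⊎ (∃[ s ] s ∈ˡ live × parity ~ φ s)
      cov (inj₁ t) = inj₁ t
      cov (inj₂ (s , s∈ , q)) with represent (<-wellFounded _) s∈
      ... | inj₁ t                  = inj₁ (trivial-resp-~ q t)
      ... | inj₂ (s , s∈′ , _ , p) = inj₂ (s , s∈′ , ~-trans q p)

    live-alive : ∀ {v} → v ∈ˡ live → ¬ Dead I live v
    live-alive v∈ (trivial t)       = proj₂ (∈-filter⁻ (¬? ∘ dead? I S) {xs = S} v∈) (trivial t)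
    live-alive v∈ (earlier s∈ lt q) = proj₂ (∈-filter⁻ (¬? ∘ dead? I S) {xs = S} v∈)
      (earlier (proj₁ (∈-filter⁻ (¬? ∘ dead? I S) s∈)) lt q)

    module _ (s : Node) where

      others : List Node
      others = filter (λ v → ¬? (v Finₚ.≟ s)) S

      support-others : Support I S → ¬ parity ~ φ s → (∀ {v} → v ∈ˡ S → ¬ Feeds I S (φ s) v) → Support I others
      support-others sup ≁s unused = record
        { gate    = gate ∘ proj₁ ∘ ∈-filter⁻ ≢s?
        ; operand = λ v∈ k → let v∈S = proj₁ (∈-filter⁻ ≢s? v∈) in below v∈S k (operand v∈S k)
        ; covers  = cov covers
        }
        where
        open Support sup
        ≢s? = λ v → ¬? (v Finₚ.≟ s)
        below : ∀ {v} → v ∈ˡ S → ∀ k {r} → Below I S r (φ (src v k)) → Below I others r (φ (src v k))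
        below v∈ k (trivial t)       = trivial t
        below v∈ k (earlier s∈ lt q) = earlier (∈-filter⁺ ≢s? s∈ λ { refl → unused v∈ (k , q) }) lt q
        cov : Trivial (parity {m}) ⊎ (∃[ s ] s ∈ˡ S × parity ~ φ s) →
              Trivial (parity {m}) ⊎ (∃[ s ] s ∈ˡ others × parity ~ φ s)
        cov (inj₁ t)             = inj₁ t
        cov (inj₂ (t , t∈ , q)) = inj₂ (t , ∈-filter⁺ ≢s? t∈ (λ { refl → ≁s q }) , q)

    removable? : Dec (∃[ s ] s ∈ˡ S × ¬ parity ~ φ s × ¬ Any (Feeds I S (φ s)) S)
    removable? = map′ find (λ (s , s∈ , p) → lose s∈ p)
      (any? (λ s → ¬? (parity ~? φ s) ×-dec ¬? (any? (feeds? I S (φ s)) S)) S)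

    irredundant : Support I S → (∀ {v} → v ∈ˡ S → ¬ Dead I S v) →
                  ¬ (∃[ s ] s ∈ˡ S × ¬ parity ~ φ s × ¬ Any (Feeds I S (φ s)) S) → Irredundant I S
    irredundant sup al ¬rem = record
      { support = sup
      ; alive   = al
      ; used    = λ {s} s∈ ≁s → case any? (feeds? I S (φ s)) S of λ where
          (yes p) → find p
          (no ¬p) → contradiction (s , s∈ , ≁s , ¬p) ¬rem
      }

  -- Deleting an unread gate may leave further gates unread, so the cleaning is iterated. Each such
  -- deletion shortens the list, which bounds the number of rounds.
  reduce : ∀ {m} (I : Interp m) S → Acc _<_ (length S) → Support I S →
           ∃[ S′ ] length S′ ≤ length S × Irredundant I S′
  reduce I S (acc rs) sup with removable? I (live I S)
  ... | no ¬rem = live I S , length-filter (¬? ∘ dead? I S) S ,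
                  irredundant I (live I S) (support-live I S sup) (live-alive I S) ¬rem
  ... | yes (s , s∈ , ≁s , unused) =
    let shorter = ℕₚ.<-≤-trans (filter-notAll (λ v → ¬? (v Finₚ.≟ s)) (live I S) (lose s∈ λ ≢ → ≢ refl))
                               (length-filter (¬? ∘ dead? I S) S)
        S′ , le , irr = reduce I (others I (live I S) s) (rs shorter)
          (support-others I (live I S) s (support-live I S sup) ≁s (λ v∈ f → unused (lose v∈ f)))
    in S′ , ℕₚ.≤-trans le (ℕₚ.<⇒≤ shorter) , irr

  support-restrict : ∀ {m} (I : Interp (suc m)) S x c → Support I S → Support (restrictᴵ x c I) S
  support-restrict {m} I S x c sup = record
    { gate    = gate
    ; operand = λ v∈ k → below (operand v∈ k)
    ; covers  = cov covers
    }
    where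
    open Interp I
    open Support sup
    below : ∀ {r f} → Below I S r f → Below (restrictᴵ x c I) S r (restrict x c f)
    below (trivial t)       = trivial (restrict-trivial x c t)
    below (earlier s∈ lt q) = earlier s∈ lt (restrict-~ q)
    cov : Trivial (parity {suc m}) ⊎ (∃[ s ] s ∈ˡ S × parity ~ φ s) →
          Trivial (parity {m}) ⊎ (∃[ s ] s ∈ˡ S × parity ~ restrict x c (φ s))
    cov (inj₁ t)             = inj₁ (trivial-resp-~ (~-sym (parity-restrict x c)) (restrict-trivial x c t))
    cov (inj₂ (s , s∈ , q)) = inj₂ (s , s∈ , ~-trans (~-sym (parity-restrict x c)) (restrict-~ q))

-- Gate elimination and the lower bound

module Local (net : Net) where
 open Net net
 open NetTheory net

 module Analysis {m} (I : Interp (suc (suc m))) (S : List Node) (irr : Irredundant I S) where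
  open Interp I
  open Irredundant irr

  private
    op : Node → Bool → BoolFun (suc (suc m))
    op v k = φ (src v k)

  nontrivial : ∀ {s} → s ∈ˡ S → ¬ Trivial (φ s)
  nontrivial s∈ t = alive s∈ (trivial t)

  -- With a constant operand the gate would be constant or a copy of its other operand, which lies
  -- below it; in both cases it would be dead.
  operand-nonconst : ∀ {v} → v ∈ˡ S → ∀ k {b} → ¬ (∀ a → op v k a ≡ b)
  operand-nonconst v∈ k e with const-operand (gate v∈) k e
  ... | inj₁ (c , d) = nontrivial v∈ (constant c d)
  ... | inj₂ q       = alive v∈ (below-~ q (operand v∈ (not k)))

  -- The ∧ of two signed copies of `f` is constant or again a signed copy of `f`, so the gate would
  -- be dead.
  operands-≁ : ∀ {v} → v ∈ˡ S → ∀ k {f} → op v k ~ f → ¬ op v (not k) ~ f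
  operands-≁ {v} v∈ k {f} p@(t , e) (t′ , e′) = alive v∈ dead
    where
    s = sgn v k
    s′ = sgn v (not k)
    -- True when both operands contribute `f` with the same total sign; otherwise the ∧ is that of a
    -- function and its negation.
    same = not ((s xor t) xor (s′ xor t′))
    ∧-same : ∀ s t s′ t′ f → (s xor t xor f) ∧ (s′ xor t′ xor f) ≡ not ((s xor t) xor (s′ xor t′)) ∧ ((s xor t) xor f)
    ∧-same = toWitness {a? = ∀-Bool? λ s → ∀-Bool? λ t → ∀-Bool? λ s′ → ∀-Bool? λ t′ → ∀-Bool? λ f →
      ((s xor t xor f) ∧ (s′ xor t′ xor f)) Bool.≟ (not ((s xor t) xor (s′ xor t′)) ∧ ((s xor t) xor f))} _
    φ-v : ∀ a → φ v a ≡ osgn v xor (same ∧ ((s xor t) xor f a))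
    φ-v a = trans (φ-eqₖ (gate v∈) k a) (cong (osgn v xor_)
      (trans (cong₂ (λ p q → (s xor p) ∧ (s′ xor q)) (e a) (e′ a)) (∧-same s t s′ t′ (f a))))
    dead : Dead I S v
    dead with same in eq
    ... | false = trivial (constant (osgn v xor false) λ a → trans (φ-v a) (cong (λ z → osgn v xor (z ∧ ((s xor t) xor f a))) eq))
    ... | true  = below-~ (~-trans (osgn v xor (s xor t) , λ a → trans (φ-v a)
                    (trans (cong (λ z → osgn v xor (z ∧ ((s xor t) xor f a))) eq) (sym (xor-assoc (osgn v) (s xor t) (f a))))) (~-sym p)) (operand v∈ k)

  alive-injective : ∀ {s t} → s ∈ˡ S → t ∈ˡ S → φ s ~ φ t → s ≡ t
  alive-injective {s} {t} s∈ t∈ q with ℕₚ.<-cmp (rank s) (rank t)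
  ... | tri< lt _ _ = contradiction (earlier s∈ lt (~-sym q)) (alive t∈)
  ... | tri≈ _ eq _ = rank-inj eq
  ... | tri> _ _ gt = contradiction (earlier t∈ gt q) (alive s∈)

  -- A semantic reader still comes later: the earlier gate that supplies the operand has the
  -- function of `s`, and live gates with equal functions coincide.
  feeds-rank : ∀ {v s} → v ∈ˡ S → s ∈ˡ S → Feeds I S (φ s) v → rank s < rank v
  feeds-rank v∈ s∈ (k , q) with operand v∈ k
  ... | trivial t         = contradiction (trivial-resp-~ (~-sym q) t) (nontrivial s∈)
  ... | earlier t∈ lt q′ = subst (λ t → rank t < _) (alive-injective t∈ s∈ (~-trans (~-sym q′) q)) lt

  feeds-≢ : ∀ {v s} → v ∈ˡ S → s ∈ˡ S → Feeds I S (φ s) v → v ≢ s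
  feeds-≢ v∈ s∈ f refl = ℕₚ.<-irrefl refl (feeds-rank v∈ s∈ f)

  other-operand : ∀ {v f f′ k k′} → ¬ f ~ f′ → op v k ~ f → op v k′ ~ f′ → k′ ≡ not k
  other-operand {k = k} {k′} f≁ p p′ with k Bool.≟ k′
  ... | yes refl = contradiction (~-trans (~-sym p) p′) f≁
  ... | no k≢k′  = ¬-not (k≢k′ ∘ sym)

  coord≁ : ∀ {s x} → s ∈ˡ S → ¬ φ s ~ coord x
  coord≁ s∈ q = nontrivial s∈ (literal _ q)

  constOn-both : ∀ {v x c} → v ∈ˡ S → ∀ k → ConstOn x c (op v k) → ConstOn x c (op v (not k)) → ConstOn x c (φ v)
  constOn-both {v} v∈ k (b , e) (b′ , e′) = osgn v xor ((sgn v k xor b) ∧ (sgn v (not k) xor b′)) , λ a p →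
    trans (φ-eqₖ (gate v∈) k a) (cong₂ (λ z w → osgn v xor ((sgn v k xor z) ∧ (sgn v (not k) xor w))) (e a p) (e′ a p))

  Killed : Fin (suc (suc m)) → Bool → Node → Set
  Killed x c = Dead (restrictᴵ x c I) S

  killed-const : ∀ {v x c} → ConstOn x c (φ v) → Killed x c v
  killed-const k = let b , e = restrict-const k in trivial (constant b e)

  -- Once `f` is constant, `v` becomes constant or a copy of its other operand, which remains below
  -- it after the restriction.
  killed-feeds : ∀ {v x c f} → v ∈ˡ S → ConstOn x c f → Feeds I S f v → Killed x c v
  killed-feeds {x = x} {c} v∈ f-const (k , q)
    with Interp.const-operand (restrictᴵ x c I) (gate v∈) k (proj₂ (restrict-const (constOn-resp-~ q f-const)))
  ... | inj₁ (b , e) = trivial (constant b e)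
  ... | inj₂ p       = below-~ p (Support.operand (support-restrict I S x c support) v∈ (not k))

  -- Flipping an input

  -- The operands that are allowed to change when `x` is flipped: the input itself and the gates in
  -- `E`, whose change is tolerated as long as their readers absorb it.
  data Bad (x : Fin (suc (suc m))) (E : List Node) (f : BoolFun (suc (suc m))) : Set where
    input  : f ~ coord x → Bad x E f
    exempt : ∀ {e} → e ∈ˡ E → f ~ φ e → Bad x E f

  module _ (x : Fin (suc (suc m))) (a : Vec Bool (suc (suc m))) (E : List Node) where

    Agree : BoolFun (suc (suc m)) → Set
    Agree f = f a ≡ f (flip x a)

    agree-~ : ∀ {f g} → f ~ g → Agree g → Agree f
    agree-~ (s , e) p = trans (e a) (trans (cong (s xor_) p) (sym (e (flip x a))))

    agree-constOn : ∀ {f z c} → z ≢ x → lookup a z ≡ c → ConstOn z c f → Agree f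
    agree-constOn z≢x az (b , e) = trans (e a az) (sym (e (flip x a) (trans (lookup-flip′ a z≢x) az)))

    -- An operand that stays at the absorbing value hides any change of the other one.
    agree-dominated : ∀ {v} → v ∈ˡ S → ∀ k → sgn v k xor op v k a ≡ false → Agree (op v k) → Agree (φ v)
    agree-dominated {v} v∈ k z p = trans (dom a z) (sym (dom (flip x a) (trans (cong (sgn v k xor_) (sym p)) z)))
      where
      dom : ∀ a → sgn v k xor op v k a ≡ false → φ v a ≡ osgn v xor false
      dom a z = trans (φ-eqₖ (gate v∈) k a) (cong (λ z → osgn v xor (z ∧ (sgn v (not k) xor op v (not k) a))) z)

    -- The only obligation left to a caller: a gate outside `E` with a bad operand must absorb the
    -- flip.
    module _ (step : ∀ {v} → v ∈ˡ S → ¬ v ∈ˡ E → ∀ k → Bad x E (op v k) → Bad x E (op v (not k)) ⊎ Agree (op v (not k)) → Agree (φ v)) where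

      -- Induction along ranks. An operand is a constant, a literal or an earlier gate, so it is
      -- either unchanged by the flip or bad; gates without bad operands inherit the agreement.
      propagate : ∀ {v} → Acc _<_ (rank v) → v ∈ˡ S → v ∈ˡ E ⊎ Agree (φ v)
      propagate {v} (acc rs) v∈ with any? (v Finₚ.≟_) E
      ... | yes v∈E = inj₁ v∈E
      ... | no v∉E  = inj₂ (go (status false) (status true))
        where
        status : ∀ k → Bad x E (op v k) ⊎ Agree (op v k)
        status k with operand v∈ k
        ... | trivial (constant c e) = inj₂ (trans (e a) (sym (e (flip x a))))
        ... | trivial (literal j q) with j Finₚ.≟ x
        ...   | yes refl = inj₁ (input q)
        ...   | no j≢x   = inj₂ (agree-~ q (sym (lookup-flip′ a j≢x)))
        status k | earlier s∈ lt q with propagate (rs lt) s∈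
        ...   | inj₁ s∈E = inj₁ (exempt s∈E q)
        ...   | inj₂ p   = inj₂ (agree-~ q p)
        go : Bad x E (op v false) ⊎ Agree (op v false) → Bad x E (op v true) ⊎ Agree (op v true) → Agree (φ v)
        go (inj₁ p) q        = step v∈ v∉E false p q
        go (inj₂ p) (inj₁ q) = step v∈ v∉E true q (inj₂ p)
        go (inj₂ p) (inj₂ q) = trans (φ-eq (gate v∈) a) (trans
          (cong₂ (λ z w → osgn v xor ((sgn v false xor z) ∧ (sgn v true xor w))) p q) (sym (φ-eq (gate v∈) (flip x a))))

      -- If the gate computing parity is not exempt, the flip leaves it unchanged.
      flip-contradiction : (∀ {e} → e ∈ˡ E → ¬ parity ~ φ e) → ⊥
      flip-contradiction E≁ with covers
      ... | inj₁ t = parity-nontrivial t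
      ... | inj₂ (s , s∈ , q) with propagate (<-wellFounded _) s∈
      ...   | inj₁ s∈E = E≁ s∈E q
      ...   | inj₂ p   = parity≁ x a p q

  -- Gates fed by two inputs

  -- `α` and `β` are the absorbing values: fixing `x` to `α`, or `y` to `β`, makes `g` constant.
  record Base (g : Node) (x y : Fin (suc (suc m))) (α β : Bool) : Set where
    field
      g∈S     : g ∈ˡ S
      x≢y     : x ≢ y
      feeds-x : Feeds I S (coord x) g
      feeds-y : Feeds I S (coord y) g
      o       : Bool
      form    : ∀ a → φ g a ≡ o xor ((α xor lookup a x) ∧ (β xor lookup a y))

    const-x : ConstOn x α (φ g)
    const-x = o xor false , λ a p → trans (form a) (cong (λ z → o xor (z ∧ (β xor lookup a y)))
      (trans (cong (α xor_) p) (xor-same α)))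

    ≁parity : ¬ parity ~ φ g
    ≁parity = parity≁constOn x≢y const-x

  swap : ∀ {g x y α β} → Base g x y α β → Base g y x β α
  swap {x = x} {y} {α} {β} b = record
    { g∈S = g∈S ; x≢y = x≢y ∘ sym ; feeds-x = feeds-y ; feeds-y = feeds-x ; o = o
    ; form = λ a → trans (form a) (cong (o xor_) (∧-comm (α xor lookup a x) _)) }
    where open Base b

  base : ∀ {g x y} k → g ∈ˡ S → x ≢ y → op g k ~ coord x → op g (not k) ~ coord y → ∃[ α ] ∃[ β ] Base g x y α β
  base {g} {x} {y} k g∈ x≢y p@(t , e) q@(t′ , e′) = sgn g k xor t , sgn g (not k) xor t′ , record
    { g∈S = g∈ ; x≢y = x≢y ; feeds-x = k , p ; feeds-y = not k , q ; o = osgn g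
    ; form = λ a → trans (φ-eqₖ (gate g∈) k a) (cong (osgn g xor_) (cong₂ _∧_
        (trans (cong (sgn g k xor_) (e a)) (sym (xor-assoc (sgn g k) t _)))
        (trans (cong (sgn g (not k) xor_) (e′ a)) (sym (xor-assoc (sgn g (not k)) t′ _))))) }

  minimal : ∀ {s} → Acc _<_ (rank s) → s ∈ˡ S → ∃[ g ] g ∈ˡ S × (∀ {t} → t ∈ˡ S → ¬ rank t < rank g)
  minimal {s} (acc rs) s∈ with any? (λ t → rank t <? rank s) S
  ... | yes p = let t , t∈ , lt = find p in minimal (rs lt) t∈
  ... | no ¬p = s , s∈ , λ t∈ lt → ¬p (lose t∈ lt)

  -- A gate of minimal rank has no earlier gate to read and no constant operand; its two literals
  -- have different variables by `operands-≁`.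
  exists-base : ∃[ g ] ∃[ x ] ∃[ y ] ∃[ α ] ∃[ β ] Base g x y α β
  exists-base with covers
  ... | inj₁ t = contradiction t parity-nontrivial
  ... | inj₂ (s , s∈ , _) with minimal (<-wellFounded _) s∈
  ...   | g , g∈ , min with operand g∈ false | operand g∈ true
  ...     | earlier t∈ lt _        | _                       = contradiction lt (min t∈)
  ...     | trivial _              | earlier t∈ lt _         = contradiction lt (min t∈)
  ...     | trivial (constant _ e) | trivial _               = contradiction e (operand-nonconst g∈ false)
  ...     | trivial (literal _ _)  | trivial (constant _ e)  = contradiction e (operand-nonconst g∈ true)
  ...     | trivial (literal x p)  | trivial (literal y q)   =
    g , x , y , base false g∈ (λ { refl → operands-≁ g∈ false p q }) p q

  second : ∀ {g x y α β} → Base g x y α β → ∃[ h ] h ∈ˡ S × h ≢ g × Feeds I S (coord x) h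
  second {g} {x} {y} {α} {β} b with any? (λ h → ¬? (h Finₚ.≟ g) ×-dec feeds? I S (coord x) h) S
  ... | yes p = find p
  ... | no ¬p = ⊥-elim (flip-contradiction x a [] step λ ())
    where
    open Base b
    -- The value `β` of `y` silences `g`, assumed to be the only reader of `x`; the value of `x` is
    -- arbitrary.
    a = point x false y β
    step : ∀ {v} → v ∈ˡ S → ¬ v ∈ˡ [] → ∀ k → Bad x [] (op v k) → Bad x [] (op v (not k)) ⊎ Agree x a [] (op v (not k)) → Agree x a [] (φ v)
    step {v} v∈ _ k (input q) _ with v Finₚ.≟ g
    ... | yes refl = agree-constOn x a [] (x≢y ∘ sym) (lookup-point₂ x false y β) (Base.const-x (swap b))
    ... | no v≢g   = contradiction (lose v∈ (v≢g , k , q)) ¬p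

  record Killed₃ (x : Fin (suc (suc m))) (c : Bool) : Set where
    field
      {v₁ v₂ v₃} : Node
      in₁ : v₁ ∈ˡ S
      in₂ : v₂ ∈ˡ S
      in₃ : v₃ ∈ˡ S
      ≢₁₂ : v₁ ≢ v₂
      ≢₁₃ : v₁ ≢ v₃
      ≢₂₃ : v₂ ≢ v₃
      k₁  : Killed x c v₁
      k₂  : Killed x c v₂
      k₃  : Killed x c v₃

  -- If the only gate fed by g is h, then h is constant with g, and kills its own successor.
  kills-three : ∀ {g x y α β} → Base g x y α β → Killed₃ x α
  kills-three {g} {x} {y} {α} {β} b with second b | used (Base.g∈S b) (Base.≁parity b)
  ... | h , h∈ , h≢g , kx , hx | p , p∈ , kg , pg with p Finₚ.≟ h
  ...   | no p≢h = record
    { in₁ = g∈S ; in₂ = h∈ ; in₃ = p∈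
    ; ≢₁₂ = h≢g ∘ sym ; ≢₁₃ = feeds-≢ p∈ g∈S (kg , pg) ∘ sym ; ≢₂₃ = p≢h ∘ sym
    ; k₁ = killed-const const-x ; k₂ = killed-feeds h∈ (coord-constOn ~-refl) (kx , hx) ; k₃ = killed-feeds p∈ const-x (kg , pg) }
    where open Base b
  ...   | yes refl with other-operand {v = h} (λ q → coord≁ (Base.g∈S b) (~-sym q)) hx pg
  ...     | refl with constOn-both h∈ kx (constOn-resp-~ hx (coord-constOn {c = α} ~-refl)) (constOn-resp-~ pg (Base.const-x b))
  ...       | h-const with used h∈ (parity≁constOn (Base.x≢y b) h-const)
  ...         | q , q∈ , qh = record
    { in₁ = g∈S ; in₂ = h∈ ; in₃ = q∈
    ; ≢₁₂ = h≢g ∘ sym ; ≢₁₃ = λ { refl → ℕₚ.<-asym (feeds-rank h∈ g∈S (kg , pg)) (feeds-rank q∈ h∈ qh) }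
    ; ≢₂₃ = feeds-≢ q∈ h∈ qh ∘ sym
    ; k₁ = killed-const const-x ; k₂ = killed-const h-const ; k₃ = killed-feeds q∈ h-const qh }
    where open Base b

 -- Stated for arbitrary supports because the survivors of a restriction need not form a circuit:
 -- their operands may be nodes that were deleted as copies.
 lower-bound : ∀ m (I : Interp (suc m)) S → Support I S → 3 * m ≤ length S
 lower-bound zero    I S sup = z≤n
 lower-bound (suc m) I S sup with reduce I S (<-wellFounded _) sup
 ... | S′ , le , irr with Analysis.exists-base I S′ irr
 ...   | g , x , y , α , β , b = ℕₚ.≤-trans (ℕₚ.≤-trans (ℕₚ.≤-reflexive (ℕₚ.*-suc 3 m))
         (ℕₚ.≤-trans (ℕₚ.+-monoʳ-≤ 3 (lower-bound m I′ (live I′ S′) (support-live I′ S′ (support-restrict I S′ x α support))))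
           (length-filter-≤ (¬? ∘ dead? I′ S′) ((≢₁₂ ∷ ≢₁₃ ∷ []) ∷ (≢₂₃ ∷ []) ∷ [] ∷ [])
             ((in₁ , λ n → n k₁) ∷ (in₂ , λ n → n k₂) ∷ (in₃ , λ n → n k₃) ∷ [])))) le
   where
   open Irredundant irr
   open Analysis I S′ irr
   open Killed₃ (kills-three b)
   I′ = restrictᴵ x α I

-- The successors of a base gate when the budget is tight

module Tight (net : Net) where
 open Net net
 open NetTheory net
 open Local net

 module TightAnalysis {m} (I : Interp (suc (suc m))) (S : List Node) (irr : Irredundant I S) (tight : length S ≤ 3 * suc m) where
  open Interp I
  open Irredundant irr
  open Analysis I S irr

  private
    op : Node → Bool → BoolFun (suc (suc m))
    op v k = φ (src v k)

  -- After a restriction `3 * m` gates must survive, so a list of at most `3 * suc m` gates can lose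
  -- no more than three. The double negation is the shape produced by filtering for gates that are
  -- not dead.
  at-most-three : ∀ {x c ks} → Unique ks → All (λ v → v ∈ˡ S × ¬ ¬ Killed x c v) ks → length ks ≤ 3
  at-most-three {x} {c} {ks} u killed = ℕₚ.+-cancelʳ-≤ (3 * m) (length ks) 3 (ℕₚ.≤-trans
    (ℕₚ.+-monoʳ-≤ (length ks) (lower-bound m I′ (live I′ S) (support-live I′ S (support-restrict I S x c support))))
    (ℕₚ.≤-trans (length-filter-≤ (¬? ∘ dead? I′ S) u killed) (ℕₚ.≤-trans tight (ℕₚ.≤-reflexive (ℕₚ.*-suc 3 m)))))
    where I′ = restrictᴵ x c I

  only-killed : ∀ {x c v} (K : Killed₃ x c) → v ∈ˡ S → Killed x c v →
                v ≡ Killed₃.v₁ K ⊎ v ≡ Killed₃.v₂ K ⊎ v ≡ Killed₃.v₃ K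
  only-killed {v = v} K v∈ k with v Finₚ.≟ Killed₃.v₁ K | v Finₚ.≟ Killed₃.v₂ K | v Finₚ.≟ Killed₃.v₃ K
  ... | yes p | _     | _     = inj₁ p
  ... | no _  | yes p | _     = inj₂ (inj₁ p)
  ... | no _  | no _  | yes p = inj₂ (inj₂ p)
  ... | no n₁ | no n₂ | no n₃ = contradiction
    (at-most-three ((n₁ ∷ n₂ ∷ n₃ ∷ []) ∷ (≢₁₂ ∷ ≢₁₃ ∷ []) ∷ (≢₂₃ ∷ []) ∷ [] ∷ [])
      ((v∈ , (λ n → n k)) ∷ (in₁ , λ n → n k₁) ∷ (in₂ , λ n → n k₂) ∷ (in₃ , λ n → n k₃) ∷ []))
    λ { (s≤s (s≤s (s≤s ()))) }
    where open Killed₃ K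

  -- Otherwise x would reach the output only through h, and y could be set so that h ignores x.
  not-nested : ∀ {g h x y α β} → Base g x y α β → h ∈ˡ S → h ≢ g → Feeds I S (coord x) h → ¬ Feeds I S (φ g) h
  not-nested {g} {h} {x} {y} {α} {β} b h∈ h≢g (kx , hx@(t , ex)) (kg , hg@(t′ , eg))
    with other-operand {v = h} (λ q → coord≁ (Base.g∈S b) (~-sym q)) hx hg
  ... | refl = contra
    where
    open Base b
    h-const : ConstOn x α (φ h)
    h-const = constOn-both h∈ kx (constOn-resp-~ hx (coord-constOn ~-refl)) (constOn-resp-~ hg const-x)
    q,q∈,qh = used h∈ (parity≁constOn x≢y h-const)
    q = proj₁ q,q∈,qh
    q∈ = proj₁ (proj₂ q,q∈,qh)
    qh = proj₂ (proj₂ q,q∈,qh)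
    g<h = feeds-rank h∈ g∈S (not kx , hg)
    h<q = feeds-rank q∈ h∈ qh
    K : Killed₃ x α
    K = record
      { in₁ = g∈S ; in₂ = h∈ ; in₃ = q∈
      ; ≢₁₂ = h≢g ∘ sym ; ≢₁₃ = λ eq → ℕₚ.<-irrefl (cong rank eq) (ℕₚ.<-trans g<h h<q) ; ≢₂₃ = feeds-≢ q∈ h∈ qh ∘ sym
      ; k₁ = killed-const const-x ; k₂ = killed-const h-const ; k₃ = killed-feeds q∈ h-const qh }
    -- Were `q` constant as well, its own reader would be a fourth killed gate.
    q-nonconst : ¬ ConstOn x α (φ q)
    q-nonconst q-const with used q∈ (parity≁constOn x≢y q-const)
    ... | r , r∈ , rq with feeds-rank r∈ q∈ rq | only-killed K r∈ (killed-feeds r∈ q-const rq)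
    ...   | q<r | inj₁ refl        = ℕₚ.<-asym q<r (ℕₚ.<-trans g<h h<q)
    ...   | q<r | inj₂ (inj₁ refl) = ℕₚ.<-asym q<r h<q
    ...   | q<r | inj₂ (inj₂ refl) = ℕₚ.<-irrefl refl q<r
    q-op : ∀ {f} k → op q k ~ f → ConstOn x α f → ¬ f ~ φ h → ⊥
    q-op k qf f-const f≁ with other-operand {v = q} (f≁ ∘ ~-sym) (proj₂ qh) qf
    ... | refl = q-nonconst (constOn-both q∈ (proj₁ qh) (constOn-resp-~ (proj₂ qh) h-const) (constOn-resp-~ qf f-const))
    feeds-x⇒ : ∀ {v} k → v ∈ˡ S → op v k ~ coord x → v ≡ g ⊎ v ≡ h
    feeds-x⇒ k v∈ p with only-killed K v∈ (killed-feeds v∈ (coord-constOn ~-refl) (k , p))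
    ... | inj₁ e           = inj₁ e
    ... | inj₂ (inj₁ e)    = inj₂ e
    ... | inj₂ (inj₂ refl) = ⊥-elim (q-op k p (coord-constOn ~-refl) (λ r → coord≁ h∈ (~-sym r)))
    feeds-g⇒ : ∀ {v} k → v ∈ˡ S → op v k ~ φ g → v ≡ h
    feeds-g⇒ k v∈ p with only-killed K v∈ (killed-feeds v∈ const-x (k , p))
    ... | inj₁ e           = contradiction e (feeds-≢ v∈ g∈S (k , p))
    ... | inj₂ (inj₁ e)    = e
    ... | inj₂ (inj₂ refl) = ⊥-elim (q-op k p const-x (λ r → h≢g (sym (alive-injective g∈S h∈ r))))
    oₕ = osgn h
    s₁ = sgn h kx xor t
    s₂ = (sgn h (not kx) xor t′) xor o
    normalise : ∀ o s t s′ t′ o′ a u → o xor ((s xor t xor a) ∧ (s′ xor t′ xor o′ xor u)) ≡ o xor (((s xor t) xor a) ∧ (((s′ xor t′) xor o′) xor u))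
    normalise o s t s′ t′ o′ a u = cong (o xor_) (cong₂ _∧_ (sym (xor-assoc s t a))
      (trans (sym (xor-assoc s′ t′ (o′ xor u))) (sym (xor-assoc (s′ xor t′) o′ u))))
    h-form : ∀ a → φ h a ≡ oₕ xor ((s₁ xor lookup a x) ∧ (s₂ xor ((α xor lookup a x) ∧ (β xor lookup a y))))
    h-form a = trans (φ-eqₖ (gate h∈) kx a) (trans
      (cong₂ (λ z w → oₕ xor ((sgn h kx xor z) ∧ (sgn h (not kx) xor w))) (ex a) (trans (eg a) (cong (t′ xor_) (form a))))
      (normalise oₕ (sgn h kx) t (sgn h (not kx)) t′ o (lookup a x) _))
    -- With the opposite sign, `g` sits at its constant value whenever the literal of `x` in `h` is
    -- 1, so `h` would be a constant or a literal.
    s₁≡α : s₁ ≡ α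
    s₁≡α with s₁ Bool.≟ α | s₂ in eq₂
    ... | yes e | _     = e
    ... | no n  | false = contradiction (constant (oₕ xor false) λ a → trans (h-form a)
                            (trans (cong₂ (λ z w → oₕ xor ((z xor lookup a x) ∧ (w xor _))) (¬-not n) eq₂) (zero′ oₕ α _ _))) (nontrivial h∈)
      where
      zero′ : ∀ o α a b → o xor ((not α xor a) ∧ (false xor ((α xor a) ∧ b))) ≡ o xor false
      zero′ = toWitness {a? = ∀-Bool? λ o → ∀-Bool? λ α → ∀-Bool? λ a → ∀-Bool? λ b → (o xor ((not α xor a) ∧ (false xor ((α xor a) ∧ b)))) Bool.≟ (o xor false)} _
    ... | no n  | true  = contradiction (literal x (oₕ xor not α , λ a → trans (h-form a)
                            (trans (cong₂ (λ z w → oₕ xor ((z xor lookup a x) ∧ (w xor _))) (¬-not n) eq₂) (one′ oₕ α _ _)))) (nontrivial h∈)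
      where
      one′ : ∀ o α a b → o xor ((not α xor a) ∧ (true xor ((α xor a) ∧ b))) ≡ (o xor not α) xor a
      one′ = toWitness {a? = ∀-Bool? λ o → ∀-Bool? λ α → ∀-Bool? λ a → ∀-Bool? λ b → (o xor ((not α xor a) ∧ (true xor ((α xor a) ∧ b)))) Bool.≟ ((o xor not α) xor a)} _
    -- Where the common literal of `x` is 1, the other factor of `h` is `s₂ xor (β xor y)`. This `y`
    -- makes it 0, so `h` takes one value for both values of `x`.
    a = point x false y (β xor s₂)
    h-value : ∀ a → lookup a y ≡ β xor s₂ → φ h a ≡ oₕ xor false
    h-value a e = trans (h-form a) (trans (cong₂ (λ z w → oₕ xor ((z xor lookup a x) ∧ (s₂ xor ((α xor lookup a x) ∧ (β xor w))))) s₁≡α e) (zero″ oₕ α _ s₂ β))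
      where
      zero″ : ∀ o α a s β → o xor ((α xor a) ∧ (s xor ((α xor a) ∧ (β xor (β xor s))))) ≡ o xor false
      zero″ = toWitness {a? = ∀-Bool? λ o → ∀-Bool? λ α → ∀-Bool? λ a → ∀-Bool? λ s → ∀-Bool? λ β → (o xor ((α xor a) ∧ (s xor ((α xor a) ∧ (β xor (β xor s)))))) Bool.≟ (o xor false)} _
    ay = lookup-point₂ x false y (β xor s₂)
    h-agree : Agree x a (g ∷ []) (φ h)
    h-agree = trans (h-value a ay) (sym (h-value (flip x a) (trans (lookup-flip′ a (x≢y ∘ sym)) ay)))
    step : ∀ {v} → v ∈ˡ S → ¬ v ∈ˡ (g ∷ []) → ∀ k → Bad x (g ∷ []) (op v k) → _ → Agree x a (g ∷ []) (φ v)
    step v∈ v∉ k (input p) _ with feeds-x⇒ k v∈ p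
    ... | inj₁ e    = contradiction (here e) v∉
    ... | inj₂ refl = h-agree
    step v∈ v∉ k (exempt (here refl) p) _ with feeds-g⇒ k v∈ p
    ... | refl = h-agree
    contra : ⊥
    -- The gate `g` may change under the flip and is exempt: its only reader is `h`, which does not
    -- change.
    contra = flip-contradiction x a (g ∷ []) step λ { (here refl) → ≁parity }

  record Fan (g : Node) (x : Fin (suc (suc m))) (α : Bool) (h p : Node) : Set where
    field
      h∈S         : h ∈ˡ S
      p∈S         : p ∈ˡ S
      h≢g         : h ≢ g
      p≢g         : p ≢ g
      p≢h         : p ≢ h
      h-fed       : Feeds I S (coord x) h
      p-fed       : Feeds I S (φ g) p
      only-x      : ∀ {v} → v ∈ˡ S → Feeds I S (coord x) v → v ≡ g ⊎ v ≡ h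
      only-g      : ∀ {v} → v ∈ˡ S → Feeds I S (φ g) v → v ≡ p
      only-killed′ : ∀ {v} → v ∈ˡ S → Killed x α v → v ≡ g ⊎ v ≡ h ⊎ v ≡ p

  -- All readers of `x` and of `g` die at `x = α`, hence are among `g`, `h` and `p`. By `not-nested`
  -- no gate other than `g` reads both `x` and `g`, which separates the two kinds of readers.
  fan : ∀ {g x y α β} → Base g x y α β → ∃[ h ] ∃[ p ] Fan g x α h p
  fan {g} {x} {y} {α} b with second b | used (Base.g∈S b) (Base.≁parity b)
  ... | h , h∈ , h≢g , hx | p , p∈ , pg = h , p , record
    { h∈S = h∈ ; p∈S = p∈ ; h≢g = h≢g ; p≢g = p≢g ; p≢h = p≢h ; h-fed = hx ; p-fed = pg
    ; only-x = ox ; only-g = og ; only-killed′ = only-killed K }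
    where
    open Base b
    p≢g = feeds-≢ p∈ g∈S pg
    p≢h : p ≢ h
    p≢h refl = not-nested b h∈ h≢g hx pg
    K : Killed₃ x α
    K = record
      { in₁ = g∈S ; in₂ = h∈ ; in₃ = p∈
      ; ≢₁₂ = h≢g ∘ sym ; ≢₁₃ = p≢g ∘ sym ; ≢₂₃ = p≢h ∘ sym
      ; k₁ = killed-const const-x ; k₂ = killed-feeds h∈ (coord-constOn ~-refl) hx ; k₃ = killed-feeds p∈ const-x pg }
    ox : ∀ {v} → v ∈ˡ S → Feeds I S (coord x) v → v ≡ g ⊎ v ≡ h
    ox v∈ f with only-killed K v∈ (killed-feeds v∈ (coord-constOn ~-refl) f)
    ... | inj₁ e           = inj₁ e
    ... | inj₂ (inj₁ e)    = inj₂ e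
    ... | inj₂ (inj₂ refl) = ⊥-elim (not-nested b p∈ p≢g f pg)
    og : ∀ {v} → v ∈ˡ S → Feeds I S (φ g) v → v ≡ p
    og v∈ f with only-killed K v∈ (killed-feeds v∈ const-x f)
    ... | inj₁ e           = contradiction e (feeds-≢ v∈ g∈S f)
    ... | inj₂ (inj₁ refl) = ⊥-elim (not-nested b h∈ h≢g hx f)
    ... | inj₂ (inj₂ e)    = e

  -- With x fixed to c, the input z cannot reach the output only through q:
  -- the other operand of q is not constant, so it can be made to dominate q.
  single-carrier : ∀ {x z c E q} → x ≢ z → (∀ {e} → e ∈ˡ E → ¬ parity ~ φ e) → q ∈ˡ S → ¬ Killed x c q →
                   (∀ k → Bad z E (op q k) → ¬ Bad z E (op q (not k))) → (∃[ k ] Bad z E (op q k)) →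
                   (∀ {v} → v ∈ˡ S → ¬ v ∈ˡ E → ∀ k → Bad z E (op v k) → v ≡ q ⊎ ConstOn x c (φ v)) → ⊥
  single-carrier {x} {z} {c} {E} {q} x≢z E≁ q∈ q-live once (kq , bad) spread
    -- The value tested is the neutral one. An operand constantly neutral on `x = c` would get `q`
    -- killed, so at some point with `x = c` it is absorbing.
    with constOn? x c (op q (not kq)) (not (sgn q (not kq)))
  ... | inj₁ e = q-live (killed-feeds q∈ (not (sgn q (not kq)) , e) (not kq , ~-refl))
  ... | inj₂ (a , ax , w) = flip-contradiction z a E step E≁
    where
    dominated : sgn q (not kq) xor op q (not kq) a ≡ false
    dominated = trans (cong (sgn q (not kq) xor_) (trans w (not-involutive _))) (xor-same (sgn q (not kq)))
    step : ∀ {v} → v ∈ˡ S → ¬ v ∈ˡ E → ∀ k → Bad z E (op v k) → Bad z E (op v (not k)) ⊎ Agree z a E (op v (not k)) → Agree z a E (φ v)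
    step v∈ v∉ k p r with spread v∈ v∉ k p
    ... | inj₂ v-const = agree-constOn z a E x≢z ax v-const
    ... | inj₁ refl with k Bool.≟ kq | r
    ...   | no k≢kq  | _      = contradiction (subst (λ k → Bad z E (op q k)) (¬-not k≢kq) p) (once kq bad)
    ...   | yes refl | inj₁ p′ = contradiction p′ (once k p)
    ...   | yes refl | inj₂ r′ = agree-dominated z a E v∈ (not k) dominated r′

  -- Setting `x = α` silences `g`. If `h′` differed from `h`, it would survive as the only reader
  -- through which `y` reaches the output.
  same-partner : ∀ {g x y α β h p h′ p′} → Base g x y α β → Fan g x α h p → Fan g y β h′ p′ → h ≡ h′
  same-partner {g} {x} {y} {α} {β} {h} {p} {h′} {p′} b F F′ with h′ Finₚ.≟ h
  ... | yes e = sym e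
  ... | no h′≢h = ⊥-elim (single-carrier {c = α} {E = []} x≢y (λ ()) F′.h∈S h′-live once (k , input hy) spread)
    where
    open Base b
    module F = Fan F
    module F′ = Fan F′
    k = proj₁ F′.h-fed
    hy = proj₂ F′.h-fed
    h′-live : ¬ Killed x α h′
    h′-live d with F.only-killed′ F′.h∈S d
    ... | inj₁ e        = F′.h≢g e
    ... | inj₂ (inj₁ e) = h′≢h e
    -- Since `p` reads `g`, it is the reader `p′` of the second fan, which differs from `h′`.
    ... | inj₂ (inj₂ e) = F′.p≢h (sym (trans e (F′.only-g F.p∈S F.p-fed)))
    once : ∀ k → Bad y [] (op h′ k) → ¬ Bad y [] (op h′ (not k))
    once k (input r) (input r′) = operands-≁ F′.h∈S k r r′
    spread : ∀ {v} → v ∈ˡ S → ¬ v ∈ˡ [] → ∀ k → Bad y [] (op v k) → v ≡ h′ ⊎ ConstOn x α (φ v)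
    spread v∈ _ k (input r) with F′.only-x v∈ (k , r)
    ... | inj₁ refl = inj₂ const-x
    ... | inj₂ e    = inj₁ e

  -- If the same value of `x` silenced both `g` and `h`, the output would no longer depend on `y`.
  opposite-sign : ∀ {g h x y α α′ β β′} → Base g x y α β → Base h x y α′ β′ →
                  (∀ {v} → v ∈ˡ S → Feeds I S (coord y) v → v ≡ g ⊎ v ≡ h) → α′ ≡ not α
  opposite-sign {x = x} {y} {α} {α′} b b′ only-y with α′ Bool.≟ α
  ... | no n     = ¬-not n
  ... | yes refl = ⊥-elim (flip-contradiction y a [] step λ ())
    where
    open Base b using (x≢y)
    a = point x α y false
    ax = lookup-point₁ α false x≢y
    step : ∀ {v} → v ∈ˡ S → ¬ v ∈ˡ [] → ∀ k → Bad y [] (op v k) → _ → Agree y a [] (φ v)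
    step v∈ _ k (input r) _ with only-y v∈ (k , r)
    ... | inj₁ refl = agree-constOn y a [] x≢y ax (Base.const-x b)
    ... | inj₂ refl = agree-constOn y a [] x≢y ax (Base.const-x b′)

  -- At `x = α` the gate `g` is constant, so `y` goes on only through `h`, and from there only
  -- through `q`. If `q` were not `p`, it would survive this restriction and be a single carrier of
  -- `y`.
  same-join : ∀ {g x y α β h p q α′ β′} → Base g x y α β → Base h x y α′ β′ → Fan g x α h p → Fan h x α′ g q →
              (∀ {v} → v ∈ˡ S → Feeds I S (coord y) v → v ≡ g ⊎ v ≡ h) → q ≡ p
  same-join {g} {x} {y} {α} {h = h} {p} {q} b b′ F F′ only-y with q Finₚ.≟ p
  ... | yes e = e
  ... | no q≢p = ⊥-elim (single-carrier {c = α} {E = h ∷ []} x≢y (λ { (here refl) → Base.≁parity b′ }) F′.p∈S q-live once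
                   (proj₁ F′.p-fed , exempt (here refl) (proj₂ F′.p-fed)) spread)
    where
    open Base b
    module F = Fan F
    module F′ = Fan F′
    q-live : ¬ Killed x α q
    q-live d with F.only-killed′ F′.p∈S d
    ... | inj₁ e        = F′.p≢h e
    ... | inj₂ (inj₁ e) = F′.p≢g e
    ... | inj₂ (inj₂ e) = q≢p e
    q≁y : ∀ k → ¬ op q k ~ coord y
    q≁y k r with only-y F′.p∈S (k , r)
    ... | inj₁ e = F′.p≢h e
    ... | inj₂ e = F′.p≢g e
    once : ∀ k → Bad y (h ∷ []) (op q k) → ¬ Bad y (h ∷ []) (op q (not k))
    once k (input r) _ = q≁y k r
    once k _ (input r) = q≁y (not k) r
    once k (exempt (here refl) r) (exempt (here refl) r′) = operands-≁ F′.p∈S k r r′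
    spread : ∀ {v} → v ∈ˡ S → ¬ v ∈ˡ (h ∷ []) → ∀ k → Bad y (h ∷ []) (op v k) → v ≡ q ⊎ ConstOn x α (φ v)
    spread v∈ v∉ k (input r) with only-y v∈ (k , r)
    ... | inj₁ refl = inj₂ const-x
    ... | inj₂ e    = contradiction (here e) v∉
    spread v∈ v∉ k (exempt (here refl) r) = inj₁ (F′.only-g v∈ (k , r))

  record XORGates (g h p : Node) (x y : Fin (suc (suc m))) (α : Bool) : Set where
    field
      g∈S : g ∈ˡ S
      h∈S : h ∈ˡ S
      p∈S : p ∈ˡ S
      g≢h : g ≢ h
      p≢g : p ≢ g
      p≢h : p ≢ h
      x≢y : x ≢ y
      kg kh kp : Bool
      gx : op g kg ~ coord x
      gy : op g (not kg) ~ coord y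
      hx : op h kh ~ coord x
      hy : op h (not kh) ~ coord y
      pg : op p kp ~ φ g
      ph : op p (not kp) ~ φ h
      xor-form : φ p ~ λ a → lookup a x xor lookup a y
      g≁parity : ¬ parity ~ φ g
      h≁parity : ¬ parity ~ φ h
      only-x : ∀ {v} → v ∈ˡ S → Feeds I S (coord x) v → v ≡ g ⊎ v ≡ h
      only-y : ∀ {v} → v ∈ˡ S → Feeds I S (coord y) v → v ≡ g ⊎ v ≡ h
      only-g : ∀ {v} → v ∈ˡ S → Feeds I S (φ g) v → v ≡ p
      only-h : ∀ {v} → v ∈ˡ S → Feeds I S (φ h) v → v ≡ p
      only-killed₃ : ∀ {v} → v ∈ˡ S → Killed x α v → v ≡ g ⊎ v ≡ h ⊎ v ≡ p
      killed-g : Killed x α g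
      killed-h : Killed x α h
      killed-p : Killed x α p

  -- g and h are minterms of opposite assignments, so every other combination of them is constant, g or h.
  join-xor : ∀ {g h p x y α β} → Base g x y α β → Base h x y (not α) (not β) → p ∈ˡ S → p ≢ g → p ≢ h →
             ∀ k → op p k ~ φ g → op p (not k) ~ φ h → φ p ~ λ a → lookup a x xor lookup a y
  join-xor {g} {h} {p} {x} {y} {α} {β} b b′ p∈ p≢g p≢h k (t , e) (t′ , e′) = cases A refl B refl
    where
    module G = Base b
    module H = Base b′
    o = osgn p
    -- `A` and `B` are the signs with which the two minterms enter `p`. Since the minterms exclude
    -- each other, only two negated ones give a new function.
    A = sgn p k xor t xor G.o
    B = sgn p (not k) xor t′ xor H.o
    normalise : ∀ s t o a → s xor t xor o xor a ≡ (s xor t xor o) xor a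
    normalise s t o a = trans (cong (s xor_) (sym (xor-assoc t o a))) (sym (xor-assoc s (t xor o) a))
    u w : Vec Bool (suc (suc m)) → Bool
    u a = α xor lookup a x
    w a = β xor lookup a y
    u′ w′ : Vec Bool (suc (suc m)) → Bool
    u′ a = not α xor lookup a x
    w′ a = not β xor lookup a y
    form : ∀ a → φ p a ≡ o xor ((A xor (u a ∧ w a)) ∧ (B xor (u′ a ∧ w′ a)))
    form a = trans (φ-eqₖ (gate p∈) k a) (cong (o xor_) (cong₂ _∧_
      (trans (cong (sgn p k xor_) (trans (e a) (cong (t xor_) (G.form a)))) (normalise (sgn p k) t G.o _))
      (trans (cong (sgn p (not k) xor_) (trans (e′ a) (cong (t′ xor_) (H.form a)))) (normalise (sgn p (not k)) t′ H.o _))))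
    form′ : ∀ {c d} → A ≡ c → B ≡ d → ∀ a → φ p a ≡ o xor ((c xor (u a ∧ w a)) ∧ (d xor (u′ a ∧ w′ a)))
    form′ refl refl = form
    case-ff : ∀ o α β a b → o xor ((false xor ((α xor a) ∧ (β xor b))) ∧ (false xor ((not α xor a) ∧ (not β xor b)))) ≡ o xor false
    case-ff = toWitness {a? = ∀-Bool? λ o → ∀-Bool? λ α → ∀-Bool? λ β → ∀-Bool? λ a → ∀-Bool? λ b → (o xor ((false xor ((α xor a) ∧ (β xor b))) ∧ (false xor ((not α xor a) ∧ (not β xor b))))) Bool.≟ (o xor false)} _
    case-ft : ∀ o o′ α β a b → o xor ((false xor ((α xor a) ∧ (β xor b))) ∧ (true xor ((not α xor a) ∧ (not β xor b)))) ≡ (o xor o′) xor (o′ xor ((α xor a) ∧ (β xor b)))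
    case-ft = toWitness {a? = ∀-Bool? λ o → ∀-Bool? λ o′ → ∀-Bool? λ α → ∀-Bool? λ β → ∀-Bool? λ a → ∀-Bool? λ b → (o xor ((false xor ((α xor a) ∧ (β xor b))) ∧ (true xor ((not α xor a) ∧ (not β xor b))))) Bool.≟ ((o xor o′) xor (o′ xor ((α xor a) ∧ (β xor b))))} _
    case-tf : ∀ o o′ α β a b → o xor ((true xor ((α xor a) ∧ (β xor b))) ∧ (false xor ((not α xor a) ∧ (not β xor b)))) ≡ (o xor o′) xor (o′ xor ((not α xor a) ∧ (not β xor b)))
    case-tf = toWitness {a? = ∀-Bool? λ o → ∀-Bool? λ o′ → ∀-Bool? λ α → ∀-Bool? λ β → ∀-Bool? λ a → ∀-Bool? λ b → (o xor ((true xor ((α xor a) ∧ (β xor b))) ∧ (false xor ((not α xor a) ∧ (not β xor b))))) Bool.≟ ((o xor o′) xor (o′ xor ((not α xor a) ∧ (not β xor b))))} _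
    case-tt : ∀ o α β a b → o xor ((true xor ((α xor a) ∧ (β xor b))) ∧ (true xor ((not α xor a) ∧ (not β xor b)))) ≡ (o xor (α xor β)) xor (a xor b)
    case-tt = toWitness {a? = ∀-Bool? λ o → ∀-Bool? λ α → ∀-Bool? λ β → ∀-Bool? λ a → ∀-Bool? λ b → (o xor ((true xor ((α xor a) ∧ (β xor b))) ∧ (true xor ((not α xor a) ∧ (not β xor b))))) Bool.≟ ((o xor (α xor β)) xor (a xor b))} _
    cases : ∀ c → A ≡ c → ∀ d → B ≡ d → φ p ~ λ a → lookup a x xor lookup a y
    cases false eA false eB = contradiction (constant (o xor false) λ a → trans (form′ eA eB a) (case-ff o α β (lookup a x) (lookup a y))) (nontrivial p∈)
    cases false eA true  eB = contradiction (alive-injective p∈ G.g∈S (o xor G.o , λ a → trans (form′ eA eB a)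
      (trans (case-ft o G.o α β (lookup a x) (lookup a y)) (cong ((o xor G.o) xor_) (sym (G.form a)))))) p≢g
    cases true  eA false eB = contradiction (alive-injective p∈ H.g∈S (o xor H.o , λ a → trans (form′ eA eB a)
      (trans (case-tf o H.o α β (lookup a x) (lookup a y)) (cong ((o xor H.o) xor_) (sym (H.form a)))))) p≢h
    cases true  eA true  eB = o xor (α xor β) , λ a → trans (form′ eA eB a) (case-tt o α β (lookup a x) (lookup a y))

  -- Three fans are compared: those of `g` along `x` and along `y` yield the common partner `h`, and
  -- that of `h` along `x` identifies the reader of `h` with the reader of `g`.
  xor-gates : ∃[ g ] ∃[ h ] ∃[ p ] ∃[ x ] ∃[ y ] ∃[ α ] XORGates g h p x y α
  xor-gates with exists-base
  ... | g , x , y , α , β , b with fan b | fan (swap b)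
  ...   | h , p , F | h₂ , p₂ , F₂ with same-partner b F F₂
  ...     | refl with other-operand {v = h} (λ q → Base.x≢y b (coord-injective q)) (proj₂ (Fan.h-fed F)) (proj₂ (Fan.h-fed F₂))
  ...       | hy-eq with base (proj₁ (Fan.h-fed F)) (Fan.h∈S F) (Base.x≢y b) (proj₂ (Fan.h-fed F))
                          (subst (λ k → op h k ~ coord y) hy-eq (proj₂ (Fan.h-fed F₂)))
  ...         | α′ , β′ , b′ with opposite-sign b b′ (Fan.only-x F₂) | opposite-sign (swap b) (swap b′) (Fan.only-x F) | fan b′
  ...           | refl | refl | g′ , q , F′ = g , h , p , x , y , α , record
    { g∈S = g∈S ; h∈S = F.h∈S ; p∈S = F.p∈S ; g≢h = F.h≢g ∘ sym ; p≢g = F.p≢g ; p≢h = F.p≢h ; x≢y = x≢y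
    ; kg = proj₁ feeds-x ; kh = proj₁ F.h-fed ; kp = proj₁ F.p-fed
    ; gx = proj₂ feeds-x
    ; gy = subst (λ k → op g k ~ coord y) (other-operand {v = g} (λ q → x≢y (coord-injective q)) (proj₂ feeds-x) (proj₂ feeds-y)) (proj₂ feeds-y)
    ; hx = proj₂ F.h-fed ; hy = subst (λ k → op h k ~ coord y) hy-eq (proj₂ (Fan.h-fed F₂))
    ; pg = proj₂ F.p-fed ; ph = ph
    ; xor-form = join-xor b b′ F.p∈S F.p≢g F.p≢h (proj₁ F.p-fed) (proj₂ F.p-fed) ph
    ; g≁parity = ≁parity ; h≁parity = Base.≁parity b′
    ; only-x = F.only-x ; only-y = Fan.only-x F₂ ; only-g = F.only-g ; only-h = λ v∈ f → trans (F′.only-g v∈ f) q≡p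
    ; only-killed₃ = F.only-killed′
    ; killed-g = killed-const const-x
    ; killed-h = killed-feeds F.h∈S (coord-constOn ~-refl) F.h-fed
    ; killed-p = killed-feeds F.p∈S const-x F.p-fed
    }
    where
    open Base b
    module F = Fan F
    module F′ = Fan F′
    g′≡g : g′ ≡ g
    g′≡g with F.only-x F′.h∈S F′.h-fed
    ... | inj₁ e = e
    ... | inj₂ e = contradiction e F′.h≢g
    q≡p : q ≡ p
    q≡p = same-join b b′ F (subst (λ v → Fan h x _ v q) g′≡g F′) (Fan.only-x F₂)
    p-fed-h : Feeds I S (φ h) p
    p-fed-h = subst (Feeds I S (φ h)) q≡p F′.p-fed
    ph : op p (not (proj₁ F.p-fed)) ~ φ h
    ph = subst (λ k → op p k ~ φ h)
      (other-operand {v = p} (λ r → F.h≢g (sym (alive-injective g∈S F.h∈S r))) (proj₂ F.p-fed) (proj₂ p-fed-h)) (proj₂ p-fed-h)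

-- Peeling off the blocks one at a time

and-gate : Bool → Bool → Bool → Bool → Bool → Bool
and-gate o s₁ s₂ a b = o xor ((s₁ xor a) ∧ (s₂ xor b))

module Decompose (net : Net) where
 open Net net
 open NetTheory net
 open Local net
 open Tight net

 -- Dropping a dead or unread gate would leave a support shorter than the lower bound.
 tight-irredundant : ∀ {m} (I : Interp (suc m)) S → Support I S → length S ≤ 3 * m → Irredundant I S
 tight-irredundant {m} I S sup tight = irredundant I S sup alive unremovable
  where
  open Interp I
  alive : ∀ {v} → v ∈ˡ S → ¬ Dead I S v
  alive v∈ d = ℕₚ.<-irrefl refl (ℕₚ.<-≤-trans (filter-notAll (¬? ∘ dead? I S) S (lose v∈ λ ¬d → ¬d d))
    (ℕₚ.≤-trans tight (lower-bound m I (live I S) (support-live I S sup))))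
  unremovable : ¬ (∃[ s ] s ∈ˡ S × ¬ parity ~ φ s × ¬ Any (Feeds I S (φ s)) S)
  unremovable (s , s∈ , ≁s , unused) = ℕₚ.<-irrefl refl (ℕₚ.<-≤-trans
    (filter-notAll (λ v → ¬? (v Finₚ.≟ s)) S (lose s∈ λ ≢ → ≢ refl))
    (ℕₚ.≤-trans tight (lower-bound m I (others I S s) (support-others I S s sup ≁s λ v∈ f → unused (lose v∈ f)))))

 -- `XORGates` speaks of functions and of the current list; here the same facts concern actual wires
 -- and all gates of the net. The nodes `s` and `t` act as the two inputs.
 record Block : Set where
  field
    g h p s t : Node
    gate-g : Gate g
    gate-h : Gate h
    gate-p : Gate p
    g≢h : g ≢ h
    p≢g : p ≢ g
    p≢h : p ≢ h
    s≢t : s ≢ t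
    kg kh kp : Bool
    src-gs : src g kg ≡ s
    src-gt : src g (not kg) ≡ t
    src-hs : src h kh ≡ s
    src-ht : src h (not kh) ≡ t
    src-pg : src p kp ≡ g
    src-ph : src p (not kp) ≡ h
    fed-by-source : ∀ {v} → Gate v → ∀ k → src v k ≡ s ⊎ src v k ≡ t → v ≡ g ⊎ v ≡ h
    fed-by-inner  : ∀ {v} → Gate v → ∀ k → src v k ≡ g ⊎ src v k ≡ h → v ≡ p
    τ : Bool
    computes-xor : ∀ u w → and-gate (osgn p) (sgn p kp) (sgn p (not kp))
      (and-gate (osgn g) (sgn g kg) (sgn g (not kg)) u w)
      (and-gate (osgn h) (sgn h kh) (sgn h (not kh)) u w) ≡ τ xor (u xor w)

 infix 4 _∈ᵇ_

 _∈ᵇ_ : Node → Block → Set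
 v ∈ᵇ B = v ≡ g ⊎ v ≡ h ⊎ v ≡ p
  where open Block B

 record Decomposition (out : Node) (S : List Node) (Rep : Node → Set) (m : ℕ) : Set where
  field
    block    : Fin m → Block
    member⁺  : ∀ {v} → v ∈ˡ S → ∃[ i ] v ∈ᵇ block i
    member⁻  : ∀ {v i} → v ∈ᵇ block i → v ∈ˡ S
    disjoint : ∀ {v i j} → v ∈ᵇ block i → v ∈ᵇ block j → i ≡ j

  Source : Node → Set
  Source u = Rep u ⊎ (∃[ j ] u ≡ Block.p (block j))

  field
    source-s : ∀ i → Source (Block.s (block i))
    source-t : ∀ i → Source (Block.t (block i))
    root     : Source out
    unfed    : ∀ {v} → Gate v → ∀ k → src v k ≢ out

 -- Rep j v: in the circuit with the completed blocks collapsed, v plays the role of the j-th input.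
 record State (out : Node) {m} (I : Interp (suc m)) (S : List Node) (Rep : Fin (suc m) → Node → Set) : Set where
  open Interp I
  field
    tight      : length S ≤ 3 * m
    gate       : ∀ {v} → v ∈ˡ S → Gate v
    rep-φ      : ∀ {j v} → Rep j v → φ v ~ coord j
    rep-unique : ∀ {j u v} → Rep j u → Rep j v → u ≡ v
    inside     : ∀ {v} → v ∈ˡ S → ∀ k → src v k ∈ˡ S ⊎ (∃[ j ] Rep j (src v k))
    -- Removed gates must not read what is still in play; this extends statements about the readers
    -- within `S` to all gates of the net.
    outside    : ∀ {v} → Gate v → ¬ v ∈ˡ S → ∀ k → ¬ src v k ∈ˡ S × (∀ j → ¬ Rep j (src v k))
    out-in     : out ∈ˡ S ⊎ (∃[ j ] Rep j out)
    out-φ      : parity ~ φ out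

  state-support : Support I S
  state-support = record { gate = gate ; operand = below ; covers = cov out-in }
    where
    below : ∀ {v} → v ∈ˡ S → ∀ k → Below I S (rank v) (φ (src v k))
    below v∈ k with inside v∈ k
    ... | inj₁ s∈      = earlier s∈ (src-rank (gate v∈) k) ~-refl
    ... | inj₂ (j , r) = trivial (literal j (rep-φ r))
    cov : out ∈ˡ S ⊎ (∃[ j ] Rep j out) → Trivial (parity {suc m}) ⊎ (∃[ s ] s ∈ˡ S × parity ~ φ s)
    cov (inj₁ o∈)      = inj₂ (out , o∈ , out-φ)
    cov (inj₂ (j , r)) = inj₁ (trivial-resp-~ out-φ (literal j (rep-φ r)))

 module Step {out : Node} {m} (I : Interp (suc (suc m))) (S : List Node) (Rep : Fin (suc (suc m)) → Node → Set) (state : State out I S Rep) (irr : Irredundant I S) where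
  open Interp I
  open State state
  open Analysis I S irr hiding (swap)
  open TightAnalysis I S irr tight

  -- From functions back to wires: a live gate never computes a literal, so the operand can only be
  -- the representative of that input.
  src-coord : ∀ {v x} → v ∈ˡ S → ∀ k → φ (src v k) ~ coord x → Rep x (src v k)
  src-coord v∈ k q with inside v∈ k
  ... | inj₁ s∈      = contradiction q (coord≁ s∈)
  ... | inj₂ (j , r) = subst (λ j → Rep j _) (coord-injective (~-trans (~-sym (rep-φ r)) q)) r

  src-gate : ∀ {v s} → v ∈ˡ S → s ∈ˡ S → ∀ k → φ (src v k) ~ φ s → src v k ≡ s
  src-gate v∈ s∈ k q with inside v∈ k
  ... | inj₁ t∈      = alive-injective t∈ s∈ q
  ... | inj₂ (j , r) = contradiction (~-trans (~-sym q) (rep-φ r)) (coord≁ s∈)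

  module _ {g h p x y α} (X : XORGates g h p x y α) where
   open XORGates X

   rep-s : Rep x (src g kg)
   rep-s = src-coord g∈S kg gx
   rep-t : Rep y (src g (not kg))
   rep-t = src-coord g∈S (not kg) gy
   src-h₁ : src h kh ≡ src g kg
   src-h₁ = rep-unique (src-coord h∈S kh hx) rep-s
   src-h₂ : src h (not kh) ≡ src g (not kg)
   src-h₂ = rep-unique (src-coord h∈S (not kh) hy) rep-t
   src-p₁ : src p kp ≡ g
   src-p₁ = src-gate p∈S g∈S kp pg
   src-p₂ : src p (not kp) ≡ h
   src-p₂ = src-gate p∈S h∈S (not kp) ph

   new-block : Block
   new-block = record
     { g = g ; h = h ; p = p ; s = src g kg ; t = src g (not kg)
     ; gate-g = gate g∈S ; gate-h = gate h∈S ; gate-p = gate p∈S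
     ; g≢h = g≢h ; p≢g = p≢g ; p≢h = p≢h
     ; s≢t = λ e → x≢y (coord-injective (~-trans (~-sym gx) (subst (λ u → φ u ~ coord y) (sym e) gy)))
     ; kg = kg ; kh = kh ; kp = kp
     ; src-gs = refl ; src-gt = refl ; src-hs = src-h₁ ; src-ht = src-h₂ ; src-pg = src-p₁ ; src-ph = src-p₂
     ; fed-by-source = fed-source ; fed-by-inner = fed-inner
     ; τ = τ′ ; computes-xor = computes
     }
     where
     fed-source : ∀ {v} → Gate v → ∀ k → src v k ≡ src g kg ⊎ src v k ≡ src g (not kg) → v ≡ g ⊎ v ≡ h
     fed-source {v} gv k e with any? (v Finₚ.≟_) S
     fed-source gv k (inj₁ e) | yes v∈ = only-x v∈ (k , subst (λ u → φ u ~ coord x) (sym e) gx)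
     fed-source gv k (inj₂ e) | yes v∈ = only-y v∈ (k , subst (λ u → φ u ~ coord y) (sym e) gy)
     fed-source gv k (inj₁ e) | no v∉  = contradiction (subst (Rep x) (sym e) rep-s) (proj₂ (outside gv v∉ k) x)
     fed-source gv k (inj₂ e) | no v∉  = contradiction (subst (Rep y) (sym e) rep-t) (proj₂ (outside gv v∉ k) y)
     fed-inner : ∀ {v} → Gate v → ∀ k → src v k ≡ g ⊎ src v k ≡ h → v ≡ p
     fed-inner {v} gv k e with any? (v Finₚ.≟_) S
     fed-inner gv k (inj₁ e) | yes v∈ = only-g v∈ (k , subst (λ u → φ u ~ φ g) (sym e) ~-refl)
     fed-inner gv k (inj₂ e) | yes v∈ = only-h v∈ (k , subst (λ u → φ u ~ φ h) (sym e) ~-refl)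
     fed-inner gv k (inj₁ e) | no v∉  = contradiction (subst (_∈ˡ S) (sym e) g∈S) (proj₁ (outside gv v∉ k))
     fed-inner gv k (inj₂ e) | no v∉  = contradiction (subst (_∈ˡ S) (sym e) h∈S) (proj₁ (outside gv v∉ k))
     σ = _~_.sign gx
     ρ = _~_.sign gy
     -- The source nodes compute `x` and `y` with signs `σ` and `ρ`, which are moved into the sign
     -- of the block.
     τ′ = _~_.sign xor-form xor (σ xor ρ)
     G H P : Bool → Bool → Bool
     G = and-gate (osgn g) (sgn g kg) (sgn g (not kg))
     H = and-gate (osgn h) (sgn h kh) (sgn h (not kh))
     P = and-gate (osgn p) (sgn p kp) (sgn p (not kp))
     computes : ∀ u w → P (G u w) (H u w) ≡ τ′ xor (u xor w)
     computes u w = trans (sym φp) (trans (_~_.eq xor-form a) (trans (cong₂ (λ b c → _~_.sign xor-form xor (b xor c)) ax ay) (shuffle (_~_.sign xor-form) σ ρ u w)))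
       where
       shuffle : ∀ z σ ρ u w → z xor ((σ xor u) xor (ρ xor w)) ≡ (z xor (σ xor ρ)) xor (u xor w)
       shuffle = toWitness {a? = ∀-Bool? λ z → ∀-Bool? λ σ → ∀-Bool? λ ρ → ∀-Bool? λ u → ∀-Bool? λ w →
         (z xor ((σ xor u) xor (ρ xor w))) Bool.≟ ((z xor (σ xor ρ)) xor (u xor w))} _
       -- The signs are undone here, so that the source nodes carry exactly `u` and `w`.
       a = point x (σ xor u) y (ρ xor w)
       ax = lookup-point₁ (σ xor u) (ρ xor w) x≢y
       ay = lookup-point₂ x (σ xor u) y (ρ xor w)
       φs : φ (src g kg) a ≡ u
       φs = trans (_~_.eq gx a) (trans (cong (σ xor_) ax) (xor-cancelˡ σ u))
       φt : φ (src g (not kg)) a ≡ w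
       φt = trans (_~_.eq gy a) (trans (cong (ρ xor_) ay) (xor-cancelˡ ρ w))
       φg : φ g a ≡ G u w
       φg = trans (φ-eqₖ (gate g∈S) kg a) (cong₂ G φs φt)
       φh : φ h a ≡ H u w
       φh = trans (φ-eqₖ (gate h∈S) kh a) (cong₂ H
         (trans (cong (λ v → φ v a) src-h₁) φs) (trans (cong (λ v → φ v a) src-h₂) φt))
       φp : φ p a ≡ P (G u w) (H u w)
       φp = trans (φ-eqₖ (gate p∈S) kp a) (cong₂ P
         (trans (cong (λ v → φ v a) src-p₁) φg) (trans (cong (λ v → φ v a) src-p₂) φh))

   I′ : Interp (suc m)
   I′ = restrictᴵ x α I
   S′ : List Node
   S′ = live I′ S

   -- The output of the new block now represents the input y.
   Rep′ : Fin (suc m) → Node → Set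
   Rep′ j v = (punchIn x j ≡ y × v ≡ p) ⊎ (punchIn x j ≢ y × Rep (punchIn x j) v)

   S′⊆S : ∀ {v} → v ∈ˡ S′ → v ∈ˡ S
   S′⊆S v∈ = proj₁ (live⁻ I′ S v∈)

   S′-live : ∀ {v} → v ∈ˡ S′ → ¬ Killed x α v
   S′-live v∈ = proj₂ (live⁻ I′ S v∈)

   g∉S′ : ∀ {v} → v ∈ˡ S′ → v ≢ g
   g∉S′ v∈ refl = S′-live v∈ killed-g
   h∉S′ : ∀ {v} → v ∈ˡ S′ → v ≢ h
   h∉S′ v∈ refl = S′-live v∈ killed-h
   p∉S′ : ∀ {v} → v ∈ˡ S′ → v ≢ p
   p∉S′ v∈ refl = S′-live v∈ killed-p

   split : ∀ {v} → v ∈ˡ S → v ∈ᵇ new-block ⊎ v ∈ˡ S′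
   split {v} v∈ = case dead? I′ S v of λ where
     (yes d) → inj₁ (only-killed₃ v∈ d)
     (no ¬d) → inj₂ (live⁺ I′ S v∈ ¬d)

   rep∉S : ∀ {j v} → Rep j v → ¬ v ∈ˡ S
   rep∉S r v∈ = coord≁ v∈ (rep-φ r)

   p-rep : ∃[ j ] Rep′ j p
   p-rep = punchOut x≢y , inj₁ (Finₚ.punchIn-punchOut x≢y , refl)

   next-state : State out I′ S′ Rep′
   next-state = record
     { tight = ℕₚ.+-cancelˡ-≤ 3 (length S′) (3 * m) (ℕₚ.≤-trans
         (length-filter-≤ (¬? ∘ dead? I′ S) ((g≢h ∷ p≢g ∘ sym ∷ []) ∷ (p≢h ∘ sym ∷ []) ∷ [] ∷ [])
           ((g∈S , λ n → n killed-g) ∷ (h∈S , λ n → n killed-h) ∷ (p∈S , λ n → n killed-p) ∷ []))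
         (ℕₚ.≤-trans tight (ℕₚ.≤-reflexive (ℕₚ.*-suc 3 m))))
     ; gate = gate ∘ S′⊆S
     ; rep-φ = rep-φ′
     ; rep-unique = rep-unique′
     ; inside = inside′
     ; outside = outside′
     ; out-in = out-in′ out-in
     ; out-φ = ~-trans (~-sym (parity-restrict x α)) (restrict-~ out-φ)
     }
     where
     rep-φ′ : ∀ {j v} → Rep′ j v → restrict x α (φ v) ~ coord j
     -- With `x` fixed to `α`, the function `x xor y` computed by `p` is `y` up to sign.
     rep-φ′ {j} (inj₁ (refl , refl)) = let s , e = xor-form in s xor α , λ a → trans (e (insertAt a x α))
       (trans (cong₂ (λ b c → s xor (b xor c)) (insertAt-lookup a x α) (insertAt-punchIn a x α j)) (sym (xor-assoc s α _)))
     rep-φ′ {j} (inj₂ (_ , r)) = let s , e = rep-φ r in s , λ a → trans (e (insertAt a x α)) (cong (s xor_) (insertAt-punchIn a x α j))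
     rep-unique′ : ∀ {j u v} → Rep′ j u → Rep′ j v → u ≡ v
     rep-unique′ (inj₁ (_ , refl)) (inj₁ (_ , refl)) = refl
     rep-unique′ (inj₁ (e , _))    (inj₂ (n , _))    = contradiction e n
     rep-unique′ (inj₂ (n , _))    (inj₁ (e , _))    = contradiction e n
     rep-unique′ (inj₂ (_ , r))    (inj₂ (_ , r′))   = rep-unique r r′
     not-gh : ∀ {v} → v ∈ˡ S′ → v ≡ g ⊎ v ≡ h → ⊥
     not-gh v∈ (inj₁ e) = g∉S′ v∈ e
     not-gh v∈ (inj₂ e) = h∉S′ v∈ e
     -- A survivor reads neither `g` nor `h`, whose only reader is `p`, nor `x` or `y`, whose only
     -- readers are `g` and `h`. One that reads `p` now reads a representative.
     inside′ : ∀ {v} → v ∈ˡ S′ → ∀ k → src v k ∈ˡ S′ ⊎ (∃[ j ] Rep′ j (src v k))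
     inside′ {v} v∈′ k with inside (S′⊆S v∈′) k
     inside′ {v} v∈′ k | inj₁ s∈ with split s∈
     ... | inj₁ (inj₁ e)        = contradiction (only-g (S′⊆S v∈′) (k , subst (λ u → φ (src v k) ~ φ u) e ~-refl)) (p∉S′ v∈′)
     ... | inj₁ (inj₂ (inj₁ e)) = contradiction (only-h (S′⊆S v∈′) (k , subst (λ u → φ (src v k) ~ φ u) e ~-refl)) (p∉S′ v∈′)
     ... | inj₁ (inj₂ (inj₂ e)) = inj₂ (subst (λ u → ∃[ j ] Rep′ j u) (sym e) p-rep)
     ... | inj₂ s∈′             = inj₁ s∈′
     inside′ {v} v∈′ k | inj₂ (j , r) with x Finₚ.≟ j | j Finₚ.≟ y
     ... | yes refl | _        = ⊥-elim (not-gh v∈′ (only-x (S′⊆S v∈′) (k , rep-φ r)))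
     ... | no _     | yes refl = ⊥-elim (not-gh v∈′ (only-y (S′⊆S v∈′) (k , rep-φ r)))
     ... | no x≢j   | no j≢y   = inj₂ (punchOut x≢j , inj₂ (subst (λ i → i ≢ y × Rep i (src v k)) (sym (Finₚ.punchIn-punchOut x≢j)) (j≢y , r)))
     rep-coord : ∀ {i j v} → Rep i v → Rep j v → i ≡ j
     rep-coord r r′ = coord-injective (~-trans (~-sym (rep-φ r)) (rep-φ r′))
     retired : ∀ {u} → Rep x u ⊎ Rep y u → ¬ u ∈ˡ S′ × (∀ j → ¬ Rep′ j u)
     retired (inj₁ r) = rep∉S r ∘ S′⊆S , λ where
       j (inj₁ (_ , refl)) → rep∉S r p∈S
       j (inj₂ (_ , r′))   → Finₚ.punchInᵢ≢i x j (rep-coord r′ r)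
     retired (inj₂ r) = rep∉S r ∘ S′⊆S , λ where
       j (inj₁ (_ , refl)) → rep∉S r p∈S
       j (inj₂ (n , r′))   → n (rep-coord r′ r)
     inner : ∀ {u} → u ≡ g ⊎ u ≡ h → ¬ u ∈ˡ S′ × (∀ j → ¬ Rep′ j u)
     inner (inj₁ refl) = (λ g∈ → g∉S′ g∈ refl) , λ where
       j (inj₁ (_ , e)) → p≢g (sym e)
       j (inj₂ (_ , r)) → rep∉S r g∈S
     inner (inj₂ refl) = (λ h∈ → h∉S′ h∈ refl) , λ where
       j (inj₁ (_ , e)) → p≢h (sym e)
       j (inj₂ (_ , r)) → rep∉S r h∈S
     either : ∀ {P : Bool → Set} k₀ → P k₀ → P (not k₀) → ∀ k → P k
     either false p q false = p
     either false p q true  = q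
     either true  p q false = q
     either true  p q true  = p
     -- The gates of the new block join the removed ones: they read only `g`, `h` and the two former
     -- representatives, none of which stays in play.
     blocked : ∀ {v} → v ∈ᵇ new-block → ∀ k → ¬ src v k ∈ˡ S′ × (∀ j → ¬ Rep′ j (src v k))
     blocked (inj₁ refl)        = either kg (retired (inj₁ rep-s)) (retired (inj₂ rep-t))
     blocked (inj₂ (inj₁ refl)) = either kh (retired (inj₁ (src-coord h∈S kh hx))) (retired (inj₂ (src-coord h∈S (not kh) hy)))
     blocked (inj₂ (inj₂ refl)) = either kp (inner (inj₁ src-p₁)) (inner (inj₂ src-p₂))
     outside′ : ∀ {v} → Gate v → ¬ v ∈ˡ S′ → ∀ k → ¬ src v k ∈ˡ S′ × (∀ j → ¬ Rep′ j (src v k))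
     outside′ {v} gv v∉ k with any? (v Finₚ.≟_) S
     ... | no v∉S = let ∉S , ¬rep = outside gv v∉S k in ∉S ∘ S′⊆S , λ where
       j (inj₁ (_ , e)) → ∉S (subst (_∈ˡ S) (sym e) p∈S)
       j (inj₂ (_ , r)) → ¬rep _ r
     ... | yes v∈S with split v∈S
     ...   | inj₁ b  = blocked b k
     ...   | inj₂ v∈ = contradiction v∈ v∉
     out-in′ : out ∈ˡ S ⊎ (∃[ j ] Rep j out) → out ∈ˡ S′ ⊎ (∃[ j ] Rep′ j out)
     out-in′ (inj₂ (j , r)) = contradiction (trivial-resp-~ out-φ (literal j (rep-φ r))) parity-nontrivial
     out-in′ (inj₁ o∈) with split o∈
     ... | inj₁ (inj₁ e)        = contradiction (subst (λ u → parity ~ φ u) e out-φ) g≁parity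
     ... | inj₁ (inj₂ (inj₁ e)) = contradiction (subst (λ u → parity ~ φ u) e out-φ) h≁parity
     ... | inj₁ (inj₂ (inj₂ e)) = inj₂ (subst (λ u → ∃[ j ] Rep′ j u) (sym e) p-rep)
     ... | inj₂ o∈′             = inj₁ o∈′

   extend : Decomposition out S′ (λ v → ∃[ j ] Rep′ j v) m → Decomposition out S (λ v → ∃[ j ] Rep j v) (suc m)
   extend D = record
     { block    = blocks
     ; member⁺  = member
     ; member⁻  = λ {v} {i} → member⁻ {v} {i}
     ; disjoint = λ {v} {i} {j} → disjoint {v} {i} {j}
     ; source-s = λ { zero → inj₁ (x , rep-s) ; (suc i) → source (D.source-s i) }
     ; source-t = λ { zero → inj₁ (y , rep-t) ; (suc i) → source (D.source-t i) }
     ; root     = source D.root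
     ; unfed    = D.unfed
     }
     where
     module D = Decomposition D
     blocks : Fin (suc m) → Block
     blocks zero    = new-block
     blocks (suc i) = D.block i
     member : ∀ {v} → v ∈ˡ S → ∃[ i ] v ∈ᵇ blocks i
     member v∈ with split v∈
     ... | inj₁ b  = zero , b
     ... | inj₂ v∈′ = let i , b = D.member⁺ v∈′ in suc i , b
     member⁻ : ∀ {v i} → v ∈ᵇ blocks i → v ∈ˡ S
     member⁻ {i = zero} (inj₁ refl)        = g∈S
     member⁻ {i = zero} (inj₂ (inj₁ refl)) = h∈S
     member⁻ {i = zero} (inj₂ (inj₂ refl)) = p∈S
     member⁻ {i = suc i} b = S′⊆S (D.member⁻ {i = i} b)
     apart : ∀ {v} → v ∈ᵇ new-block → ¬ v ∈ˡ S′
     apart (inj₁ e) v∈        = g∉S′ v∈ e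
     apart (inj₂ (inj₁ e)) v∈ = h∉S′ v∈ e
     apart (inj₂ (inj₂ e)) v∈ = p∉S′ v∈ e
     disjoint : ∀ {v i j} → v ∈ᵇ blocks i → v ∈ᵇ blocks j → i ≡ j
     disjoint {i = zero}  {zero}  b b′ = refl
     disjoint {i = zero}  {suc j} b b′ = contradiction (D.member⁻ {i = j} b′) (apart b)
     disjoint {i = suc i} {zero}  b b′ = contradiction (D.member⁻ {i = i} b) (apart b′)
     disjoint {i = suc i} {suc j} b b′ = cong suc (D.disjoint {i = i} {j} b b′)
     source : ∀ {u} → D.Source u → (∃[ j ] Rep j u) ⊎ (∃[ j ] u ≡ Block.p (blocks j))
     -- The representative introduced by this step is the output of the new block.
     source (inj₁ (j , inj₁ (_ , e))) = inj₂ (zero , e)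
     source (inj₁ (j , inj₂ (_ , r))) = inj₁ (_ , r)
     source (inj₂ (j , e))            = inj₂ (suc j , e)

 decompose : ∀ {out} m {I : Interp (suc m)} {S Rep} → State out I S Rep → Decomposition out S (λ v → ∃[ j ] Rep j v) m
 -- One input is left and no gate: the output node represents that input, and `outside` applies to
 -- every gate of the net.
 decompose zero {S = []} state = record
   { block = λ () ; member⁺ = λ () ; member⁻ = λ { {i = ()} } ; disjoint = λ { {i = ()} }
   ; source-s = λ () ; source-t = λ () ; root = root out-in
   ; unfed = λ gv k e → unfed out-in gv k e
   }
   where
   open State state
   root : ∀ {out} {A B : Set} → out ∈ˡ [] ⊎ A → A ⊎ B
   root (inj₂ r) = inj₁ r
   unfed : _ ∈ˡ [] ⊎ _ → ∀ {v} → Gate v → ∀ k → src v k ≢ _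
   unfed (inj₂ (j , r)) gv k refl = proj₂ (outside gv (λ ()) k) j r
 decompose zero {S = _ ∷ _} state = contradiction (State.tight state) λ ()
 decompose (suc m) {I} {S} {Rep} state =
   let irr = tight-irredundant I S (State.state-support state) (State.tight state)
       g , h , p , x , y , α , X = TightAnalysis.xor-gates I S irr (State.tight state)
   in Step.extend I S Rep state irr X (decompose m (Step.next-state I S Rep state irr X))

-- Evaluation and origins

XOR≡parity : ∀ {n} (x : Vec Bool n) → XOR x ≡ parity x
XOR≡parity [] = refl
XOR≡parity (true ∷ x) = trans (suc-odd (count (Bool._≟ true) x)) (cong not (XOR≡parity x))
  where
  suc-odd : ∀ k → (suc k % 2 ≡ᵇ 1) ≡ not (k % 2 ≡ᵇ 1)
  suc-odd zero          = refl
  suc-odd (suc zero)    = refl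
  suc-odd (suc (suc k)) = suc-odd k
XOR≡parity (false ∷ x) = XOR≡parity x

evalLabel-cong : ∀ {n} {A : Set} (x : Vec Bool n) (l : Label n A) {ρ ρ′ : ∀ {u} → u ∈ˡ operands l → Bool} →
                 (∀ {u} (e : u ∈ˡ operands l) → ρ e ≡ ρ′ e) → evalLabel x l ρ ≡ evalLabel x l ρ′
evalLabel-cong x (var i)   eq = refl
evalLabel-cong x (const b) eq = refl
evalLabel-cong x (u and v) eq = cong₂ _∧_ (eq (here refl)) (eq (there (here refl)))
evalLabel-cong x (u or v)  eq = cong₂ _∨_ (eq (here refl)) (eq (there (here refl)))
evalLabel-cong x (neg u)   eq = cong not (eq (here refl))

module Values {n} (C : Circuit n) where
  open Circuit C

  evalAcc-irrelevant : ∀ x {v} (a b : Acc _⟶_ v) → evalAcc C x v a ≡ evalAcc C x v b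
  evalAcc-irrelevant x {v} (acc rs) (acc rs′) = evalLabel-cong x (label v) λ e → evalAcc-irrelevant x (rs e) (rs′ e)

  value : Vec Bool n → Node → Bool
  value x v = evalAcc C x v (acyclic v)

  value-unfold : ∀ x v → value x v ≡ evalLabel x (label v) (λ {u} _ → value x u)
  value-unfold x v with acyclic v
  ... | acc rs = evalLabel-cong x (label v) λ e → evalAcc-irrelevant x (rs e) (acyclic _)

  value-label : ∀ x {v l} → label v ≡ l → value x v ≡ evalLabel x l (λ {u} _ → value x u)
  value-label x {v} refl = value-unfold x v

  -- A block can thus be evaluated by exhibiting one consistent assignment of values to its nodes.
  value-unique : ∀ x (f : Node → Bool) → (∀ v → f v ≡ evalLabel x (label v) (λ {u} _ → f u)) →
                 ∀ {v} (a : Acc _⟶_ v) → evalAcc C x v a ≡ f v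
  value-unique x f eq {v} (acc rs) = trans (evalLabel-cong x (label v) λ e → value-unique x f eq (rs e)) (sym (eq v))

  -- Only strict growth along edges is wanted. A sum serves as well as a maximum and bounds both
  -- operands at once.
  depthLabel : (l : Label n Node) → (∀ {u} → u ∈ˡ operands l → ℕ) → ℕ
  depthLabel (var _)   ρ = 0
  depthLabel (const _) ρ = 0
  depthLabel (u and v) ρ = suc (ρ (here refl) + ρ (there (here refl)))
  depthLabel (u or v)  ρ = suc (ρ (here refl) + ρ (there (here refl)))
  depthLabel (neg u)   ρ = suc (ρ (here refl))

  depthAcc : ∀ {v} → Acc _⟶_ v → ℕ
  depthAcc {v} (acc rs) = depthLabel (label v) (λ e → depthAcc (rs e))

  depthLabel-cong : ∀ (l : Label n Node) {ρ ρ′ : ∀ {u} → u ∈ˡ operands l → ℕ} →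
                    (∀ {u} (e : u ∈ˡ operands l) → ρ e ≡ ρ′ e) → depthLabel l ρ ≡ depthLabel l ρ′
  depthLabel-cong (var i)   eq = refl
  depthLabel-cong (const b) eq = refl
  depthLabel-cong (u and v) eq = cong₂ (λ a b → suc (a + b)) (eq (here refl)) (eq (there (here refl)))
  depthLabel-cong (u or v)  eq = cong₂ (λ a b → suc (a + b)) (eq (here refl)) (eq (there (here refl)))
  depthLabel-cong (neg u)   eq = cong suc (eq (here refl))

  depthAcc-irrelevant : ∀ {v} (a b : Acc _⟶_ v) → depthAcc a ≡ depthAcc b
  depthAcc-irrelevant {v} (acc rs) (acc rs′) = depthLabel-cong (label v) λ e → depthAcc-irrelevant (rs e) (rs′ e)

  depth : Node → ℕ
  depth v = depthAcc (acyclic v)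

  depthLabel-< : ∀ (l : Label n Node) (ρ : ∀ {u} → u ∈ˡ operands l → ℕ) {u} (e : u ∈ˡ operands l) → ρ e < depthLabel l ρ
  depthLabel-< (u and v) ρ (here refl)         = s≤s (ℕₚ.m≤m+n _ _)
  depthLabel-< (u and v) ρ (there (here refl)) = s≤s (ℕₚ.m≤n+m _ _)
  depthLabel-< (u or v)  ρ (here refl)         = s≤s (ℕₚ.m≤m+n _ _)
  depthLabel-< (u or v)  ρ (there (here refl)) = s≤s (ℕₚ.m≤n+m _ _)
  depthLabel-< (neg u)   ρ (here refl)         = ℕₚ.≤-refl

  depth-< : ∀ {u v} → u ⟶ v → depth u < depth v
  depth-< {u} {v} e with acyclic v
  ... | acc rs = subst (_< depthLabel (label v) (λ e → depthAcc (rs e))) (depthAcc-irrelevant (rs e) (acyclic u))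
                   (depthLabel-< (label v) (λ e → depthAcc (rs e)) e)

  -- The lexicographic order of depth and node number; the number is smaller than `order` and makes
  -- the rank injective.
  rank : Node → ℕ
  rank v = depth v * order + toℕ v

  depth⇒rank : ∀ {u v} → depth u < depth v → rank u < rank v
  depth⇒rank {u} {v} lt = ℕₚ.<-≤-trans (ℕₚ.+-monoʳ-< (depth u * order) (Finₚ.toℕ<n u))
    (ℕₚ.≤-trans (ℕₚ.≤-reflexive (ℕₚ.+-comm (depth u * order) order))
      (ℕₚ.≤-trans (ℕₚ.*-monoˡ-≤ order lt) (ℕₚ.m≤m+n _ _)))

  rank-injective : ∀ {u v} → rank u ≡ rank v → u ≡ v
  rank-injective {u} {v} eq with ℕₚ.<-cmp (depth u) (depth v)
  ... | tri< lt _ _ = contradiction (depth⇒rank lt) (ℕₚ.<-irrefl eq)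
  ... | tri> _ _ gt = contradiction (depth⇒rank gt) (ℕₚ.<-irrefl (sym eq))
  ... | tri≈ _ d _  = Finₚ.toℕ-injective (ℕₚ.+-cancelˡ-≡ (depth v * order) _ _ (subst (λ k → k * order + toℕ u ≡ rank v) d eq))

  -- Origins

  originLabel-cong : ∀ v (l : Label n Node) {ρ ρ′ : ∀ {u} → u ∈ˡ operands l → Node} →
                     (∀ {u} (e : u ∈ˡ operands l) → ρ e ≡ ρ′ e) → originLabel C v l ρ ≡ originLabel C v l ρ′
  originLabel-cong v (var i)   eq = refl
  originLabel-cong v (const b) eq = refl
  originLabel-cong v (_ and _) eq = refl
  originLabel-cong v (_ or _)  eq = refl
  originLabel-cong v (neg u)   eq = eq (here refl)

  originAcc-irrelevant : ∀ {v} (a b : Acc _⟶_ v) → originAcc C v a ≡ originAcc C v b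
  originAcc-irrelevant {v} (acc rs) (acc rs′) = originLabel-cong v (label v) λ e → originAcc-irrelevant (rs e) (rs′ e)

  origin-unfold : ∀ v → origin C v ≡ originLabel C v (label v) (λ {u} _ → origin C u)
  origin-unfold v with acyclic v
  ... | acc rs = originLabel-cong v (label v) λ e → originAcc-irrelevant (rs e) (acyclic _)

  origin-nonneg : ∀ {v} → NonNeg v → origin C v ≡ v
  origin-nonneg {v} nn with label v | origin-unfold v
  ... | var _   | e = e
  ... | const _ | e = e
  ... | _ and _ | e = e
  ... | _ or _  | e = e

  origin-neg : ∀ {u v} → label v ≡ neg u → origin C v ≡ origin C u
  origin-neg {u} {v} eq = trans (origin-unfold v) (cong (λ l → originLabel C v l (λ {u} _ → origin C u)) eq)

  binary⇒nonneg : ∀ {v} → Binary v → NonNeg v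
  binary⇒nonneg {v} b with label v
  ... | _ and _ = tt
  ... | _ or _  = tt

  neg-view : ∀ v → NonNeg v ⊎ (∃[ u ] label v ≡ neg u)
  neg-view v with label v
  ... | var _   = inj₁ tt
  ... | const _ = inj₁ tt
  ... | _ and _ = inj₁ tt
  ... | _ or _  = inj₁ tt
  ... | neg u   = inj₂ (u , refl)

-- The default `d` is returned only at labels that are not binary gates, about which a net claims
-- nothing.
operandOf : ∀ {n} {A : Set} → A → Label n A → Bool → A
operandOf d (var _)   _     = d
operandOf d (const _) _     = d
operandOf d (u and v) false = u
operandOf d (u and v) true  = v
operandOf d (u or v)  false = u
operandOf d (u or v)  true  = v
operandOf d (neg _)   _     = d

isOr : ∀ {n} {A : Set} → Label n A → Bool
isOr (_ or _) = true
isOr _        = false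

-- The net of a normalized circuit

module NormalizedCircuit {n} (C : Circuit n) (norm : Normalized C) where
  open Circuit C
  open Values C public
  open Normalized norm

  -- Without double negations, skipping ¬ gates takes a single step.
  origin-of-neg : ∀ {u v} → label v ≡ neg u → NonNeg u × origin C v ≡ u
  origin-of-neg {u} {v} eq = nn , trans (origin-neg eq) (origin-nonneg nn)
    where
    nn : NonNeg u
    nn with neg-view u
    ... | inj₁ p         = p
    ... | inj₂ (w , eq′) = ⊥-elim (noDoubleNeg (subst (λ l → u ∈ˡ operands l) (sym eq) (here refl))
                             (subst (T ∘ isNeg) (sym eq) tt) (subst (T ∘ isNeg) (sym eq′) tt))

  nonneg-origin : ∀ v → NonNeg (origin C v)
  nonneg-origin v with neg-view v
  ... | inj₁ nn       = subst NonNeg (sym (origin-nonneg nn)) nn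
  ... | inj₂ (u , eq) = let nn , e = origin-of-neg eq in subst NonNeg (sym e) nn

  negated : Node → Bool
  negated v = isNeg (label v)

  nonneg-not-negated : ∀ {v} → NonNeg v → negated v ≡ false
  nonneg-not-negated {v} nn with label v
  ... | var _   = refl
  ... | const _ = refl
  ... | _ and _ = refl
  ... | _ or _  = refl

  value-origin : ∀ x v → value x v ≡ negated v xor value x (origin C v)
  value-origin x v with neg-view v
  ... | inj₁ nn       = sym (cong₂ (λ b u → b xor value x u) (nonneg-not-negated nn) (origin-nonneg nn))
  ... | inj₂ (u , eq) = trans (value-label x eq)
                          (sym (cong₂ (λ b u → b xor value x u) (cong isNeg eq) (proj₂ (origin-of-neg eq))))

  depth-origin : ∀ v → depth (origin C v) ≤ depth v
  depth-origin v with neg-view v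
  ... | inj₁ nn       = ℕₚ.≤-reflexive (cong depth (origin-nonneg nn))
  ... | inj₂ (u , eq) = ℕₚ.≤-trans (ℕₚ.≤-reflexive (cong depth (proj₂ (origin-of-neg eq))))
                          (ℕₚ.<⇒≤ (depth-< (subst (λ l → u ∈ˡ operands l) (sym eq) (here refl))))

  operand : Node → Bool → Node
  operand v = operandOf v (label v)

  operand-edge : ∀ {v} → Binary v → ∀ k → operand v k ⟶ v
  operand-edge {v} b k with label v
  operand-edge b false | u and w = here refl
  operand-edge b true  | u and w = there (here refl)
  operand-edge b false | u or w  = here refl
  operand-edge b true  | u or w  = there (here refl)

  edge-operand : ∀ {u v} → Binary v → u ⟶ v → ∃[ k ] u ≡ operand v k
  edge-operand {u} {v} b e with label v
  edge-operand b (here refl)         | _ and _ = false , refl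
  edge-operand b (there (here refl)) | _ and _ = true , refl
  edge-operand b (here refl)         | _ or _  = false , refl
  edge-operand b (there (here refl)) | _ or _  = true , refl

  -- u ∨ v = ¬ (¬ u ∧ ¬ v), hence the signs of ∨ gates
  net : Net
  net = record
    { N        = order
    ; Gate     = Binary
    ; src      = λ v k → origin C (operand v k)
    ; sgn      = λ v k → isOr (label v) xor negated (operand v k)
    ; osgn     = isOr ∘ label
    ; rank     = rank
    ; rank-inj = rank-injective
    ; src-rank = λ b k → depth⇒rank (ℕₚ.≤-<-trans (depth-origin _) (depth-< (operand-edge b k)))
    }
  open Net net using (src; sgn; osgn) public

  and-gate-label : ∀ x {v} → Binary v → (f : Node → Bool) →
    evalLabel x (label v) (λ {u} _ → f u) ≡ isOr (label v) xor ((isOr (label v) xor f (operand v false)) ∧ (isOr (label v) xor f (operand v true)))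
  and-gate-label x {v} b f with label v
  ... | u and w = refl
  ... | u or w  = ∨-as-∧ (f u) (f w)
    where
    ∨-as-∧ : ∀ a b → a ∨ b ≡ not (not a ∧ not b)
    ∨-as-∧ true  b = refl
    ∨-as-∧ false b = sym (not-involutive b)

  xor-shift : ∀ o s a → o xor (s xor a) ≡ (o xor s) xor a
  xor-shift true  true  a = not-involutive a
  xor-shift true  false a = refl
  xor-shift false s     a = refl

  open NetTheory net using (Interp; module Interp)

  interp : Interp n
  interp = record
    { φ    = λ v x → value x v
    ; φ-eq = λ {v} b x → trans (value-unfold x v) (trans (and-gate-label x b (value x))
        (cong₂ (λ c d → osgn v xor (c ∧ d)) (shifted x v false) (shifted x v true)))
    }
    where
    shifted : ∀ x v k → isOr (label v) xor value x (operand v k) ≡ sgn v k xor value x (src v k)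
    shifted x v k = trans (cong (isOr (label v) xor_) (value-origin x (operand v k))) (xor-shift (isOr (label v)) _ _)

  -- Written exactly as in `size`, so that the bound on the size is the tightness condition itself.
  gates : List Node
  gates = filterᵇ (isBinary ∘ label) (allFin order)

  gates⁺ : ∀ {v} → Binary v → v ∈ˡ gates
  gates⁺ {v} b = ∈-filter⁺ (T? ∘ isBinary ∘ label) (∈-allFin v) b

  gates⁻ : ∀ {v} → v ∈ˡ gates → Binary v
  gates⁻ v∈ = proj₂ (∈-filter⁻ (T? ∘ isBinary ∘ label) {xs = allFin order} v∈)

-- Circuits of size 3 (n - 1)

mapLabel : ∀ {n n′} {A B : Set} → (Fin n → Fin n′) → (A → B) → Label n A → Label n′ B
mapLabel ι f (var i)   = var (ι i)
mapLabel ι f (const b) = const b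
mapLabel ι f (u and v) = f u and f v
mapLabel ι f (u or v)  = f u or f v
mapLabel ι f (neg u)   = neg (f u)

module _ {n n′ : ℕ} {A B : Set} (ι : Fin n → Fin n′) (f : A → B) where

  operands-map⁺ : ∀ (l : Label n A) {u} → u ∈ˡ operands l → f u ∈ˡ operands (mapLabel ι f l)
  operands-map⁺ (_ and _) (here refl)         = here refl
  operands-map⁺ (_ and _) (there (here refl)) = there (here refl)
  operands-map⁺ (_ or _)  (here refl)         = here refl
  operands-map⁺ (_ or _)  (there (here refl)) = there (here refl)
  operands-map⁺ (neg _)   (here refl)         = here refl

  operands-map⁻ : ∀ (l : Label n A) {u} → u ∈ˡ operands (mapLabel ι f l) → ∃[ u′ ] u′ ∈ˡ operands l × u ≡ f u′
  operands-map⁻ (u and v) (here e)         = u , here refl , e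
  operands-map⁻ (u and v) (there (here e)) = v , there (here refl) , e
  operands-map⁻ (u or v)  (here e)         = u , here refl , e
  operands-map⁻ (u or v)  (there (here e)) = v , there (here refl) , e
  operands-map⁻ (neg u)   (here e)         = u , here refl , e

  isBinary-map : ∀ l → isBinary (mapLabel ι f l) ≡ isBinary l
  isBinary-map (var _)   = refl
  isBinary-map (const _) = refl
  isBinary-map (_ and _) = refl
  isBinary-map (_ or _)  = refl
  isBinary-map (neg _)   = refl

  var-map⁻ : ∀ l {j} → mapLabel ι f l ≡ var j → ∃[ i ] l ≡ var i × ι i ≡ j
  var-map⁻ (var i) refl = i , refl , refl

length-filterᵇ-tabulate : ∀ {A B : Set} {p : A → Bool} {q : B → Bool} k {f : Fin k → A} {g : Fin k → B} →
  (∀ i → p (f i) ≡ q (g i)) → length (filterᵇ p (tabulate f)) ≡ length (filterᵇ q (tabulate g))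
length-filterᵇ-tabulate zero eq = refl
length-filterᵇ-tabulate {p = p} {q} (suc k) {f} {g} eq with p (f zero) | q (g zero) | eq zero
... | true  | true  | _ = cong suc (length-filterᵇ-tabulate k (eq ∘ suc))
... | false | false | _ = length-filterᵇ-tabulate k (eq ∘ suc)

-- The nodes 0 to 4 are (y ∨ out) ∧ ¬ (y ∧ out), y ∨ out, ¬ (y ∧ out), y ∧ out and the new variable y.
module AddVariable {n} (C : Circuit n) where
  private module C = Circuit C

  old : C.Node → Fin (5 + C.order)
  old u = suc (suc (suc (suc (suc u))))

  label′ : Fin (5 + C.order) → Label (suc n) (Fin (5 + C.order))
  label′ zero                                = suc zero and suc (suc zero)
  label′ (suc zero)                          = suc (suc (suc (suc zero))) or old C.output
  label′ (suc (suc zero))                    = neg (suc (suc (suc zero)))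
  label′ (suc (suc (suc zero)))              = suc (suc (suc (suc zero))) and old C.output
  label′ (suc (suc (suc (suc zero))))        = var zero
  label′ (suc (suc (suc (suc (suc u)))))     = mapLabel suc old (C.label u)

  acc-old : ∀ {u} → Acc C._⟶_ u → Acc (λ u v → u ∈ˡ operands (label′ v)) (old u)
  acc-old {u} (acc rs) = acc λ e → case operands-map⁻ suc old (C.label u) e of λ where
    (w , e′ , refl) → acc-old (rs e′)

  AccNew : Fin (5 + C.order) → Set
  AccNew = Acc (λ u v → u ∈ˡ operands (label′ v))

  acc-out : AccNew (old C.output)
  acc-out = acc-old (C.acyclic C.output)

  acc₄ : AccNew (suc (suc (suc (suc zero))))
  acc₄ = acc λ ()

  acc₃ : AccNew (suc (suc (suc zero)))
  acc₃ = acc λ { (here refl) → acc₄ ; (there (here refl)) → acc-out }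

  acc₂ : AccNew (suc (suc zero))
  acc₂ = acc λ { (here refl) → acc₃ }

  acc₁ : AccNew (suc zero)
  acc₁ = acc λ { (here refl) → acc₄ ; (there (here refl)) → acc-out }

  acyclic′ : ∀ v → AccNew v
  acyclic′ zero                                = acc λ { (here refl) → acc₁ ; (there (here refl)) → acc₂ }
  acyclic′ (suc zero)                          = acc₁
  acyclic′ (suc (suc zero))                    = acc₂
  acyclic′ (suc (suc (suc zero)))              = acc₃
  acyclic′ (suc (suc (suc (suc zero))))        = acc₄
  acyclic′ (suc (suc (suc (suc (suc u)))))     = acc-old (C.acyclic u)

  circuit : Circuit (suc n)
  circuit = record
    { order          = 5 + C.order
    ; label          = label′
    ; acyclic        = acyclic′
    ; output         = zero
    ; outputIsSink   = isSink
    ; onlySink       = onlySink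
    ; distinctInputs = distinct
    }
    where
    isSink : ∀ v → ¬ zero ∈ˡ operands (label′ v)
    isSink zero (there (here ()))
    isSink zero (there (there ()))
    isSink (suc zero) (there (here ()))
    isSink (suc zero) (there (there ()))
    isSink (suc (suc zero)) (here ())
    isSink (suc (suc zero)) (there ())
    isSink (suc (suc (suc zero))) (there (here ()))
    isSink (suc (suc (suc zero))) (there (there ()))
    isSink (suc (suc (suc (suc (suc u))))) e = case operands-map⁻ suc old (C.label u) e of λ { (_ , _ , ()) }
    onlySink : ∀ u → (∀ v → ¬ u ∈ˡ operands (label′ v)) → u ≡ zero
    onlySink zero                                _ = refl
    onlySink (suc zero)                          s = contradiction (here refl) (s zero)
    onlySink (suc (suc zero))                    s = contradiction (there (here refl)) (s zero)
    onlySink (suc (suc (suc zero)))              s = contradiction (here refl) (s (suc (suc zero)))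
    onlySink (suc (suc (suc (suc zero))))        s = contradiction (here refl) (s (suc zero))
    onlySink (suc (suc (suc (suc (suc u)))))     s = contradiction (there (here (cong old
      (C.onlySink u λ v e → s (old v) (operands-map⁺ suc old (C.label v) e))))) (s (suc zero))
    distinct : ∀ {u v i} → label′ u ≡ var i → label′ v ≡ var i → u ≡ v
    distinct {suc (suc (suc (suc zero)))} {suc (suc (suc (suc zero)))} _ _ = refl
    distinct {suc (suc (suc (suc zero)))} {suc (suc (suc (suc (suc v))))} refl q
      with var-map⁻ suc old (C.label v) q
    ... | _ , _ , ()
    distinct {suc (suc (suc (suc (suc u))))} {suc (suc (suc (suc zero)))} p refl
      with var-map⁻ suc old (C.label u) p
    ... | _ , _ , ()
    distinct {suc (suc (suc (suc (suc u))))} {suc (suc (suc (suc (suc v))))} p q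
      with var-map⁻ suc old (C.label u) p | var-map⁻ suc old (C.label v) q
    ... | i , p′ , refl | .i , q′ , refl = cong old (C.distinctInputs p′ q′)

  open Values circuit using (value; value-label)

  eval-old : ∀ b x {u} (a : Acc C._⟶_ u) a′ → evalAcc circuit (b ∷ x) (old u) a′ ≡ evalAcc C x u a
  eval-old b x {u} (acc rs) (acc rs′) with C.label u
  ... | var _   = refl
  ... | const _ = refl
  ... | _ and _ = cong₂ _∧_ (eval-old b x (rs _) (rs′ _)) (eval-old b x (rs _) (rs′ _))
  ... | _ or _  = cong₂ _∨_ (eval-old b x (rs _) (rs′ _)) (eval-old b x (rs _) (rs′ _))
  ... | neg _   = cong not (eval-old b x (rs _) (rs′ _))

  eval-circuit : ∀ b x → eval circuit (b ∷ x) ≡ b xor eval C x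
  eval-circuit b x = trans
    (cong₂ (λ c d → (b ∨ c) ∧ not (b ∧ d)) (eval-old b x (C.acyclic C.output) (acc-old (C.acyclic C.output)))
                                           (eval-old b x (C.acyclic C.output) (acc-old (C.acyclic C.output))))
    (xor-gate b (eval C x))
    where
    xor-gate : ∀ b c → (b ∨ c) ∧ not (b ∧ c) ≡ b xor c
    xor-gate true  c = refl
    xor-gate false false = refl
    xor-gate false true = refl

  size-circuit : Circuit.size circuit ≡ 3 + C.size
  size-circuit = cong (3 +_) (length-filterᵇ-tabulate C.order λ u → isBinary-map suc old (C.label u))

identity-circuit : Circuit 1
identity-circuit = record
  { order = 1 ; label = λ _ → var zero ; acyclic = λ _ → acc λ () ; output = zero
  ; outputIsSink = λ _ () ; onlySink = λ { zero _ → refl } ; distinctInputs = λ { {zero} {zero} _ _ → refl } }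

negation-circuit : Circuit 1
negation-circuit = record
  { order = 2 ; label = lab ; acyclic = wf ; output = zero
  ; outputIsSink = λ { zero (here ()) ; zero (there ()) ; (suc zero) () }
  ; onlySink = λ { zero _ → refl ; (suc zero) s → contradiction (here refl) (s zero) }
  ; distinctInputs = λ { {suc zero} {suc zero} _ _ → refl } }
  where
  lab : Fin 2 → Label 1 (Fin 2)
  lab zero       = neg (suc zero)
  lab (suc zero) = var zero
  wf : ∀ v → Acc (λ u v → u ∈ˡ operands (lab v)) v
  wf (suc zero) = acc λ ()
  wf zero       = acc λ { (here refl) → wf (suc zero) }

-- The upper bound matching `lower-bound`, with three gates for each further input. A negation is
-- placed at the one-input circuit, where it is free.
xor-circuit : ∀ b m → ∃[ D ] (∀ x → eval D x ≡ b xor parity {suc m} x) × Circuit.size D ≡ 3 * m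
xor-circuit false zero = identity-circuit , (λ { (false ∷ []) → refl ; (true ∷ []) → refl }) , refl
xor-circuit true  zero = negation-circuit , (λ { (false ∷ []) → refl ; (true ∷ []) → refl }) , refl
xor-circuit b (suc m) with xor-circuit b m
... | D , comp , size = circuit , computes , trans size-circuit (trans (cong (3 +_) size) (sym (ℕₚ.*-suc 3 m)))
  where
  open AddVariable D
  swap : ∀ c b p → c xor (b xor p) ≡ b xor (c xor p)
  swap = toWitness {a? = ∀-Bool? λ c → ∀-Bool? λ b → ∀-Bool? λ p → (c xor (b xor p)) Bool.≟ (b xor (c xor p))} _
  computes : ∀ x → eval circuit x ≡ b xor parity x
  computes (c ∷ x) = trans (eval-circuit c x) (trans (cong (c xor_) (comp x)) (swap c b (parity x)))

-- Decomposing an optimal circuit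

module OptimalCircuit {m} (C : Circuit (suc m)) (b : Bool) (comp : ∀ x → eval C x ≡ b xor parity x)
                      (size≤ : Circuit.size C ≤ 3 * m) (norm : Normalized C) where
  open Circuit C
  open NormalizedCircuit C norm public
  open NetTheory net using (module Interp)
  open Decompose net

  -- The exceptional case of `noConstants` is a circuit with constant value, while the parity of at
  -- least one input is not constant.
  no-const : ∀ u c → label u ≢ const c
  no-const with Normalized.noConstants norm
  ... | inj₁ none = none
  ... | inj₂ (c , eq , _) = λ _ _ _ → parity≁ {f = λ _ → c xor b} zero (replicate (suc m) false) refl
    (false , λ x → trans (sym (xor-cancelˡ b (parity x))) (trans (cong (b xor_) (trans (sym (comp x)) (value-label x eq))) (xor-comm b c)))

  origin-var : ∀ {u} → NonNeg u → ¬ Binary u → IsVar (label u)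
  origin-var {u} nn nb with label u in eq
  ... | var i   = i , refl
  ... | const c = contradiction eq (no-const u c)
  ... | _ and _ = contradiction tt nb
  ... | _ or _  = contradiction tt nb

  inside : ∀ u → NonNeg u → u ∈ˡ gates ⊎ IsVar (label u)
  inside u nn with T? (isBinary (label u))
  ... | yes bin = inj₁ (gates⁺ bin)
  ... | no ¬bin = inj₂ (origin-var nn ¬bin)

  initial : State (origin C output) interp gates (λ j v → label v ≡ var j)
  initial = record
    { tight      = size≤
    ; gate       = gates⁻
    ; rep-φ      = λ eq → false , λ x → value-label x eq
    ; rep-unique = distinctInputs
    ; inside     = λ {v} v∈ k → inside _ (nonneg-origin (operand v k))
    -- Vacuous: at the start no gate has been removed.
    ; outside    = λ bin v∉ → contradiction (gates⁺ bin) v∉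
    ; out-in     = inside _ (nonneg-origin output)
    ; out-φ      = b xor negated output , λ x → trans (sym (xor-cancelˡ b (parity x)))
        (trans (cong (b xor_) (trans (sym (comp x)) (value-origin x output))) (xor-shift b (negated output) _))
    }

  decomposition : Decomposition (origin C output) gates (λ v → IsVar (label v)) m
  decomposition = decompose m initial

-- The three-gate sub-circuit of a block

lookup-injective : ∀ {A : Set} {xs : List A} → Unique xs → ∀ i j → List.lookup xs i ≡ List.lookup xs j → i ≡ j
lookup-injective (_ ∷ _)  zero    zero    _ = refl
lookup-injective (x∉ ∷ _) zero    (suc j) e = contradiction e (All.lookup x∉ (∈-lookup j))
lookup-injective (x∉ ∷ _) (suc i) zero    e = contradiction (sym e) (All.lookup x∉ (∈-lookup i))
lookup-injective (_ ∷ u)  (suc i) (suc j) e = cong suc (lookup-injective u i j e)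

module _ {n k : ℕ} {A B : Set} where

  -- Variables do not occur inside a block; const false is a dummy.
  relabel : (l : Label n A) → (∀ {u} → u ∈ˡ operands l → B) → Label k B
  relabel (var _)   ρ = const false
  relabel (const b) ρ = const b
  relabel (_ and _) ρ = ρ (here refl) and ρ (there (here refl))
  relabel (_ or _)  ρ = ρ (here refl) or ρ (there (here refl))
  relabel (neg _)   ρ = neg (ρ (here refl))

  relabel-operand⁻ : ∀ l (ρ : ∀ {u} → u ∈ˡ operands l → B) {d} → d ∈ˡ operands (relabel l ρ) →
                     ∃[ u ] Σ[ e ∈ u ∈ˡ operands l ] d ≡ ρ e
  relabel-operand⁻ (_ and _) ρ (here p)         = _ , here refl , p
  relabel-operand⁻ (_ and _) ρ (there (here p)) = _ , there (here refl) , p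
  relabel-operand⁻ (_ or _)  ρ (here p)         = _ , here refl , p
  relabel-operand⁻ (_ or _)  ρ (there (here p)) = _ , there (here refl) , p
  relabel-operand⁻ (neg _)   ρ (here p)         = _ , here refl , p

  relabel-operand⁺ : ∀ l (ρ : ∀ {u} → u ∈ˡ operands l → B) {u} → (e : u ∈ˡ operands l) → ρ e ∈ˡ operands (relabel l ρ)
  relabel-operand⁺ (_ and _) ρ (here refl)         = here refl
  relabel-operand⁺ (_ and _) ρ (there (here refl)) = there (here refl)
  relabel-operand⁺ (_ or _)  ρ (here refl)         = here refl
  relabel-operand⁺ (_ or _)  ρ (there (here refl)) = there (here refl)
  relabel-operand⁺ (neg _)   ρ (here refl)         = here refl

  relabel-≢var : ∀ l (ρ : ∀ {u} → u ∈ˡ operands l → B) {i} → relabel l ρ ≢ var i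
  relabel-≢var (var _) ρ ()
  relabel-≢var (const _) ρ ()

  relabel-binary : ∀ l (ρ : ∀ {u} → u ∈ˡ operands l → B) → isBinary (relabel l ρ) ≡ isBinary l
  relabel-binary (var _)   ρ = refl
  relabel-binary (const _) ρ = refl
  relabel-binary (_ and _) ρ = refl
  relabel-binary (_ or _)  ρ = refl
  relabel-binary (neg _)   ρ = refl

  module _ (f : B → A) where

    relabel-matches : ∀ l (ρ : ∀ {u} → u ∈ˡ operands l → B) → (∀ {u} (e : u ∈ˡ operands l) → f (ρ e) ≡ u) →
                      ¬ IsVar l → Matches f (relabel l ρ) l
    relabel-matches (var i)   ρ eq nv = contradiction (i , refl) nv
    relabel-matches (const _) ρ eq nv = const
    relabel-matches (u and v) ρ eq nv = subst₂ (λ a b → Matches f (relabel (u and v) ρ) (a and b)) (eq (here refl)) (eq (there (here refl))) (_ and _)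
    relabel-matches (u or v)  ρ eq nv = subst₂ (λ a b → Matches f (relabel (u or v) ρ) (a or b)) (eq (here refl)) (eq (there (here refl))) (_ or _)
    relabel-matches (neg u)   ρ eq nv = subst (λ a → Matches f (relabel (neg u) ρ) (neg a)) (eq (here refl)) (neg _)

    relabel-eval : ∀ x x′ (F : A → Bool) l (ρ : ∀ {u} → u ∈ˡ operands l → B) → (∀ {u} (e : u ∈ˡ operands l) → f (ρ e) ≡ u) →
                   ¬ IsVar l → evalLabel x (relabel l ρ) (λ {d} _ → F (f d)) ≡ evalLabel x′ l (λ {u} _ → F u)
    relabel-eval x x′ F (var i)   ρ eq nv = contradiction (i , refl) nv
    relabel-eval x x′ F (const _) ρ eq nv = refl
    relabel-eval x x′ F (u and v) ρ eq nv = cong₂ (λ a b → F a ∧ F b) (eq (here refl)) (eq (there (here refl)))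
    relabel-eval x x′ F (u or v)  ρ eq nv = cong₂ (λ a b → F a ∨ F b) (eq (here refl)) (eq (there (here refl)))
    relabel-eval x x′ F (neg u)   ρ eq nv = cong (not ∘ F) (eq (here refl))

module BlockCircuit {n} (C : Circuit n) (norm : Normalized C) (B : Decompose.Block (NormalizedCircuit.net C norm)) where
  open Circuit C
  open NormalizedCircuit C norm
  open Decompose net using (_∈ᵇ_; module Block)
  open Block B

  gate-in : ∀ {v} → v ∈ᵇ B → Binary v
  gate-in (inj₁ refl)        = gate-g
  gate-in (inj₂ (inj₁ refl)) = gate-h
  gate-in (inj₂ (inj₂ refl)) = gate-p

  _∈ᵇ?_ : ∀ v → Dec (v ∈ᵇ B)
  _∈ᵇ?_ v = (v Finₚ.≟ g) ⊎-dec ((v Finₚ.≟ h) ⊎-dec (v Finₚ.≟ p))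

  src-< : ∀ {u v} → Binary v → ∀ k → src v k ≡ u → rank u < rank v
  src-< b k refl = Net.src-rank net b k

  -- Only `p` reads `g` or `h`, so `g` reads neither; and `g` cannot read `p`, because `p` reads
  -- `g`.
  source∉ : ∀ {u} k → src g k ≡ u → ¬ u ∈ᵇ B
  source∉ k e (inj₁ refl)        = p≢g (sym (fed-by-inner gate-g k (inj₁ e)))
  source∉ k e (inj₂ (inj₁ refl)) = p≢g (sym (fed-by-inner gate-g k (inj₂ e)))
  source∉ k e (inj₂ (inj₂ refl)) = ℕₚ.<-asym (src-< gate-g k e) (src-< gate-p kp src-pg)

  s∉ : ¬ s ∈ᵇ B
  s∉ = source∉ kg src-gs

  t∉ : ¬ t ∈ᵇ B
  t∉ = source∉ (not kg) src-gt

  s-nonneg : NonNeg s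
  s-nonneg = subst NonNeg src-gs (nonneg-origin (operand g kg))

  t-nonneg : NonNeg t
  t-nonneg = subst NonNeg src-gt (nonneg-origin (operand g (not kg)))

  either : ∀ {P : Bool → Set} k₀ → P k₀ → P (not k₀) → ∀ k → P k
  either false p q false = p
  either false p q true  = q
  either true  p q false = q
  either true  p q true  = p

  src-split : ∀ {v} → v ∈ᵇ B → ∀ k →
              ((v ≡ g ⊎ v ≡ h) × (src v k ≡ s ⊎ src v k ≡ t)) ⊎ (v ≡ p × (src v k ≡ g ⊎ src v k ≡ h))
  src-split (inj₁ refl)        = either kg (inj₁ (inj₁ refl , inj₁ src-gs)) (inj₁ (inj₁ refl , inj₂ src-gt))
  src-split (inj₂ (inj₁ refl)) = either kh (inj₁ (inj₂ refl , inj₁ src-hs)) (inj₁ (inj₂ refl , inj₂ src-ht))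
  src-split (inj₂ (inj₂ refl)) = either kp (inj₂ (refl , inj₁ src-pg)) (inj₂ (refl , inj₂ src-ph))

  src≢p : ∀ {v} → v ∈ᵇ B → ∀ k → src v k ≢ p
  src≢p v∈ k e with src-split v∈ k
  ... | inj₁ (_ , inj₁ e′) = s∉ (inj₂ (inj₂ (trans (sym e′) e)))
  ... | inj₁ (_ , inj₂ e′) = t∉ (inj₂ (inj₂ (trans (sym e′) e)))
  ... | inj₂ (_ , inj₁ e′) = p≢g (trans (sym e) e′)
  ... | inj₂ (_ , inj₂ e′) = p≢h (trans (sym e) e′)

  -- Only the ¬ gates on wires into the block are included. One that negates `p` stays outside, so
  -- that `p` is the sink.
  data Part (v : Node) : Set where
    part-s : v ≡ s → Part v
    part-t : v ≡ t → Part v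
    inner    : v ∈ᵇ B → Part v
    negation : ∀ w k → w ∈ᵇ B → v ≡ operand w k → T (negated v) → Part v

  part? : Decidable Part
  part? v = map′ to from
    ((v Finₚ.≟ s) ⊎-dec ((v Finₚ.≟ t) ⊎-dec ((_∈ᵇ?_ v) ⊎-dec
      Finₚ.any? (λ w → (_∈ᵇ?_ w) ×-dec (((v Finₚ.≟ operand w false) ⊎-dec (v Finₚ.≟ operand w true)) ×-dec T? (negated v))))))
    where
    Cases : Set
    Cases = v ≡ s ⊎ v ≡ t ⊎ v ∈ᵇ B ⊎ (∃[ w ] w ∈ᵇ B × (v ≡ operand w false ⊎ v ≡ operand w true) × T (negated v))
    to : Cases → Part v
    to (inj₁ e)                                           = part-s e
    to (inj₂ (inj₁ e))                                    = part-t e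
    to (inj₂ (inj₂ (inj₁ v∈)))                            = inner v∈
    to (inj₂ (inj₂ (inj₂ (w , w∈ , inj₁ e , ng))))        = negation w false w∈ e ng
    to (inj₂ (inj₂ (inj₂ (w , w∈ , inj₂ e , ng))))        = negation w true w∈ e ng
    from : Part v → Cases
    from (part-s e)               = inj₁ e
    from (part-t e)               = inj₂ (inj₁ e)
    from (inner v∈)                 = inj₂ (inj₂ (inj₁ v∈))
    from (negation w false w∈ e ng) = inj₂ (inj₂ (inj₂ (w , w∈ , inj₁ e , ng)))
    from (negation w true w∈ e ng)  = inj₂ (inj₂ (inj₂ (w , w∈ , inj₂ e , ng)))

  negation-label : ∀ {v w k} → v ≡ operand w k → T (negated v) → label v ≡ neg (src w k)
  negation-label {v} refl ng with neg-view v
  ... | inj₁ nn       = ⊥-elim (subst T (nonneg-not-negated nn) ng)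
  ... | inj₂ (u , eq) = trans eq (cong neg (sym (proj₂ (origin-of-neg eq))))

  src-part : ∀ {w} → w ∈ᵇ B → ∀ k → Part (src w k)
  src-part w∈ k with src-split w∈ k
  ... | inj₁ (_ , inj₁ e) = part-s e
  ... | inj₁ (_ , inj₂ e) = part-t e
  ... | inj₂ (_ , inj₁ e) = inner (inj₁ e)
  ... | inj₂ (_ , inj₂ e) = inner (inj₂ (inj₁ e))

  operand-part : ∀ {w} → w ∈ᵇ B → ∀ k → Part (operand w k)
  operand-part {w} w∈ k with neg-view (operand w k)
  ... | inj₁ nn       = subst Part (origin-nonneg nn) (src-part w∈ k)
  ... | inj₂ (_ , eq) = negation w k w∈ refl (subst (T ∘ isNeg) (sym eq) tt)

  -- The second component says that no wire of the block starts at `p`; it makes `p` a sink of the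
  -- sub-circuit.
  closed : ∀ {u v} → Part v → v ≢ s → v ≢ t → u ⟶ v → Part u × origin C u ≢ p
  closed (part-s e) ≢s ≢t _ = contradiction e ≢s
  closed (part-t e) ≢s ≢t _ = contradiction e ≢t
  closed (inner v∈) ≢s ≢t e with edge-operand (gate-in v∈) e
  ... | k , refl = operand-part v∈ k , src≢p v∈ k
  closed {u} {v} (negation w k w∈ eq ng) ≢s ≢t e with negation-label {w = w} {k} eq ng
  ... | lab with subst (λ l → u ∈ˡ operands l) lab e
  ...   | here refl = src-part w∈ k , λ e′ → src≢p w∈ k (trans (sym (origin-nonneg (nonneg-origin (operand w k)))) e′)

  nodes : List Node
  nodes = filter part? (allFin order)

  embed : Fin (length nodes) → Node
  embed = List.lookup nodes

  embed-injective : ∀ {d e} → embed d ≡ embed e → d ≡ e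
  embed-injective = lookup-injective (filter⁺ part? (allFin⁺ order)) _ _

  embed-part : ∀ d → Part (embed d)
  embed-part d = proj₂ (∈-filter⁻ part? {xs = allFin order} (∈-lookup d))

  index : ∀ {v} → Part v → Fin (length nodes)
  index part = Any.index (∈-filter⁺ part? (∈-allFin _) part)

  embed-index : ∀ {v} (part : Part v) → embed (index part) ≡ v
  embed-index part = sym (lookup-index (∈-filter⁺ part? (∈-allFin _) part))

  labelᴰ : Fin (length nodes) → Label 2 (Fin (length nodes))
  labelᴰ d with embed d Finₚ.≟ s | embed d Finₚ.≟ t
  ... | yes _ | _     = var zero
  ... | no _  | yes _ = var (suc zero)
  ... | no ≢s | no ≢t = relabel (label (embed d)) (λ e → index (proj₁ (closed (embed-part d) ≢s ≢t e)))

  -- Ties the outcome of the two comparisons to the resulting label, so that later proofs can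
  -- abstract over `labelᴰ d` and still know its origin.
  data View (d : Fin (length nodes)) : Label 2 (Fin (length nodes)) → Set where
    is-s  : embed d ≡ s → View d (var zero)
    is-t  : embed d ≡ t → View d (var (suc zero))
    other : (≢s : embed d ≢ s) (≢t : embed d ≢ t) →
            View d (relabel (label (embed d)) (λ e → index (proj₁ (closed (embed-part d) ≢s ≢t e))))

  view : ∀ d → View d (labelᴰ d)
  view d with embed d Finₚ.≟ s | embed d Finₚ.≟ t
  ... | yes e | _     = is-s e
  ... | no _  | yes e = is-t e
  ... | no ≢s | no ≢t = other ≢s ≢t

  label-s : ∀ {d} → embed d ≡ s → labelᴰ d ≡ var zero
  label-s {d} e with labelᴰ d | view d
  ... | _ | is-s _     = refl
  ... | _ | is-t e′    = contradiction (trans (sym e) e′) s≢t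
  ... | _ | other ≢s _ = contradiction e ≢s

  label-t : ∀ {d} → embed d ≡ t → labelᴰ d ≡ var (suc zero)
  label-t {d} e with labelᴰ d | view d
  ... | _ | is-s e′    = contradiction (trans (sym e′) e) s≢t
  ... | _ | is-t _     = refl
  ... | _ | other _ ≢t = contradiction e ≢t

  edge⁻ : ∀ {d e} → d ∈ˡ operands (labelᴰ e) → embed d ⟶ embed e × origin C (embed d) ≢ p
  edge⁻ {d} {e} d∈ with labelᴰ e | view e
  ... | _ | other ≢s ≢t with relabel-operand⁻ (label (embed e)) _ d∈
  ...   | u , u∈ , refl = subst (_⟶ embed e) (sym (embed-index part)) u∈ ,
                          subst (λ u → origin C u ≢ p) (sym (embed-index part)) (proj₂ (closed (embed-part e) ≢s ≢t u∈))
    where part = proj₁ (closed (embed-part e) ≢s ≢t u∈)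

  edge⁺ : ∀ {d e} → embed e ≢ s → embed e ≢ t → embed d ⟶ embed e → d ∈ˡ operands (labelᴰ e)
  edge⁺ {d} {e} e≢s e≢t d⟶e with labelᴰ e | view e
  ... | _ | is-s eq = contradiction eq e≢s
  ... | _ | is-t eq = contradiction eq e≢t
  ... | _ | other ≢s ≢t = subst (_∈ˡ operands (relabel (label (embed e)) ρ))
      (embed-injective (embed-index (proj₁ (closed (embed-part e) ≢s ≢t d⟶e)))) (relabel-operand⁺ (label (embed e)) ρ d⟶e)
    where
    ρ : ∀ {u} → u ∈ˡ operands (label (embed e)) → Fin (length nodes)
    ρ e′ = index (proj₁ (closed (embed-part e) ≢s ≢t e′))

  accᴰ : ∀ {d} → Acc _⟶_ (embed d) → Acc (λ d e → d ∈ˡ operands (labelᴰ e)) d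
  accᴰ (acc rs) = acc λ e → accᴰ (rs (proj₁ (edge⁻ e)))

  inner-≢ : ∀ {v} → v ∈ᵇ B → v ≢ s × v ≢ t
  inner-≢ v∈ = (λ { refl → s∉ v∈ }) , (λ { refl → t∉ v∈ })

  p-part : Part p
  p-part = inner (inj₂ (inj₂ refl))

  operand-has-edge : ∀ {w d} → w ∈ᵇ B → ∀ k → embed d ≡ operand w k → ∃[ e ] d ∈ˡ operands (labelᴰ e)
  operand-has-edge {w} w∈ k eq = index (inner w∈) , edge⁺ (λ e → proj₁ (inner-≢ w∈) (trans (sym i) e)) (λ e → proj₂ (inner-≢ w∈) (trans (sym i) e))
      (subst₂ _⟶_ (sym eq) (sym i) (operand-edge (gate-in w∈) k))
    where i = embed-index (inner w∈)

  -- If the wire passes through a ¬ gate, the edge leads to that gate instead of the binary one.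
  src-has-edge : ∀ {w d} → w ∈ᵇ B → ∀ k → embed d ≡ src w k → ∃[ e ] d ∈ˡ operands (labelᴰ e)
  src-has-edge {w} {d} w∈ k eq with neg-view (operand w k)
  ... | inj₁ nn        = operand-has-edge w∈ k (trans eq (origin-nonneg nn))
  ... | inj₂ (u , lab) = index part , edge⁺ (≢ s-nonneg) (≢ t-nonneg)
        (subst (λ l → embed d ∈ˡ operands l) (sym (trans (cong label (embed-index part)) lab))
          (here (trans eq (proj₂ (origin-of-neg lab)))))
    where
    part : Part (operand w k)
    part = operand-part w∈ k
    ≢ : ∀ {v} → NonNeg v → embed (index part) ≢ v
    ≢ nn refl = subst T (nonneg-not-negated (subst NonNeg (embed-index part) nn)) (subst (T ∘ isNeg) (sym lab) tt)

  D : Circuit 2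
  D = record
    { order          = length nodes
    ; label          = labelᴰ
    ; acyclic        = λ d → accᴰ (acyclic (embed d))
    ; output         = index p-part
    ; outputIsSink   = λ d e → proj₂ (edge⁻ e) (trans (cong (origin C) (embed-index p-part)) (origin-nonneg (binary⇒nonneg gate-p)))
    ; onlySink       = onlySinkᴰ
    ; distinctInputs = distinct
    }
    where
    onlySinkᴰ : ∀ d → (∀ e → ¬ d ∈ˡ operands (labelᴰ e)) → d ≡ index p-part
    onlySinkᴰ d sink with embed-part d
    ... | part-s e = let i , edge = src-has-edge (inj₁ refl) kg (trans e (sym src-gs)) in contradiction edge (sink i)
    ... | part-t e = let i , edge = src-has-edge (inj₁ refl) (not kg) (trans e (sym src-gt)) in contradiction edge (sink i)
    ... | inner (inj₁ e) = let i , edge = src-has-edge (inj₂ (inj₂ refl)) kp (trans e (sym src-pg)) in contradiction edge (sink i)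
    ... | inner (inj₂ (inj₁ e)) = let i , edge = src-has-edge (inj₂ (inj₂ refl)) (not kp) (trans e (sym src-ph)) in contradiction edge (sink i)
    ... | inner (inj₂ (inj₂ e)) = embed-injective (trans e (sym (embed-index p-part)))
    ... | negation w k w∈ e _ = let i , edge = operand-has-edge w∈ k e in contradiction edge (sink i)
    var-source : ∀ {d i} → labelᴰ d ≡ var i → (embed d ≡ s × i ≡ zero) ⊎ (embed d ≡ t × i ≡ suc zero)
    var-source {d} eq with labelᴰ d | view d
    var-source refl | _ | is-s e = inj₁ (e , refl)
    var-source refl | _ | is-t e = inj₂ (e , refl)
    var-source {d} eq | _ | other _ _ = contradiction eq (relabel-≢var (label (embed d)) _)
    distinct : ∀ {d e i} → labelᴰ d ≡ var i → labelᴰ e ≡ var i → d ≡ e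
    distinct p q with var-source p | var-source q
    ... | inj₁ (e , refl) | inj₁ (e′ , _) = embed-injective (trans e (sym e′))
    ... | inj₂ (e , refl) | inj₂ (e′ , _) = embed-injective (trans e (sym e′))
    ... | inj₁ (_ , refl) | inj₂ (_ , ())
    ... | inj₂ (_ , refl) | inj₁ (_ , ())

  private module D = Circuit D

  not-var : ∀ {v} → Part v → v ≢ s → v ≢ t → ¬ IsVar (label v)
  not-var (part-s e) ≢s _ _ = ≢s e
  not-var (part-t e) _ ≢t _ = ≢t e
  not-var (inner v∈) _ _ (i , eq) = subst (T ∘ isBinary) eq (gate-in v∈)
  not-var (negation w k _ e ng) _ _ (i , eq) = subst (T ∘ isNeg) eq ng

  sub : SubCircuit D C
  sub = record { embed = embed ; injective = embed-injective ; matches = matches }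
    where
    matches : ∀ d → Matches embed (labelᴰ d) (label (embed d))
    matches d with labelᴰ d | view d
    ... | _ | is-s _      = var
    ... | _ | is-t _      = var
    ... | _ | other ≢s ≢t = relabel-matches embed (label (embed d)) _ (λ e → embed-index _) (not-var (embed-part d) ≢s ≢t)

  binary⁻ : ∀ {d} → D.Binary d → embed d ∈ᵇ B
  binary⁻ {d} b with labelᴰ d | view d
  ... | _ | other ≢s ≢t with embed-part d | subst T (relabel-binary (label (embed d)) _) b
  ...   | part-s e            | _  = contradiction e ≢s
  ...   | part-t e            | _  = contradiction e ≢t
  ...   | inner v∈              | _  = v∈
  ...   | negation w k _ e ng   | b′ = ⊥-elim (subst T (nonneg-not-negated (binary⇒nonneg b′)) ng)

  binary⁺ : ∀ {d} → embed d ∈ᵇ B → D.Binary d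
  binary⁺ {d} v∈ with labelᴰ d | view d
  ... | _ | is-s e  = contradiction e (proj₁ (inner-≢ v∈))
  ... | _ | is-t e  = contradiction e (proj₂ (inner-≢ v∈))
  ... | _ | other _ _ = subst T (sym (relabel-binary (label (embed d)) _)) (gate-in v∈)

  size-D : D.size ≡ 3
  size-D = ℕₚ.≤-antisym (length-mono-⊆ (filter⁺ (T? ∘ isBinary ∘ labelᴰ) (allFin⁺ _)) below) (length-mono-⊆ unique above)
    where
    g-part : Part g
    g-part = inner (inj₁ refl)
    h-part : Part h
    h-part = inner (inj₂ (inj₁ refl))
    three : List D.Node
    three = index g-part ∷ index h-part ∷ index p-part ∷ []
    apart : ∀ {u v} (p : Part u) (q : Part v) → u ≢ v → index p ≢ index q
    apart p q u≢v e = u≢v (trans (sym (embed-index p)) (trans (cong embed e) (embed-index q)))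
    unique : Unique three
    unique = (apart g-part h-part g≢h ∷ apart g-part p-part (p≢g ∘ sym) ∷ []) ∷ (apart h-part p-part (p≢h ∘ sym) ∷ []) ∷ [] ∷ []
    find-index : ∀ {v d} (p : Part v) → embed d ≡ v → d ≡ index p
    find-index p e = embed-injective (trans e (sym (embed-index p)))
    below : ∀ {d} → d ∈ˡ filterᵇ (isBinary ∘ labelᴰ) (allFin (length nodes)) → d ∈ˡ three
    below {d} d∈ with binary⁻ {d} (proj₂ (∈-filter⁻ (T? ∘ isBinary ∘ labelᴰ) {xs = allFin (length nodes)} d∈))
    ... | inj₁ e        = here (find-index g-part e)
    ... | inj₂ (inj₁ e) = there (here (find-index h-part e))
    ... | inj₂ (inj₂ e) = there (there (here (find-index p-part e)))
    in-filter : ∀ {v} (p : Part v) → v ∈ᵇ B → index p ∈ˡ filterᵇ (isBinary ∘ labelᴰ) (allFin (length nodes))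
    in-filter p v∈ = ∈-filter⁺ (T? ∘ isBinary ∘ labelᴰ) (∈-allFin _) (binary⁺ (subst (_∈ᵇ B) (sym (embed-index p)) v∈))
    above : ∀ {d} → d ∈ˡ three → d ∈ˡ filterᵇ (isBinary ∘ labelᴰ) (allFin (length nodes))
    above (here refl)                 = in-filter g-part (inj₁ refl)
    above (there (here refl))         = in-filter h-part (inj₂ (inj₁ refl))
    above (there (there (here refl))) = in-filter p-part (inj₂ (inj₂ refl))

  module _ (a b : Bool) where

    G H P : Bool
    G = and-gate (osgn g) (sgn g kg) (sgn g (not kg)) a b
    H = and-gate (osgn h) (sgn h kh) (sgn h (not kh)) a b
    P = and-gate (osgn p) (sgn p kp) (sgn p (not kp)) G H

    -- The intended values at the five nodes that are not ¬ gates. The last branch is meant for `p`;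
    -- elsewhere the value is an arbitrary default.
    base : Node → Bool
    base v = if ⌊ v Finₚ.≟ s ⌋ then a else if ⌊ v Finₚ.≟ t ⌋ then b else
             if ⌊ v Finₚ.≟ g ⌋ then G else if ⌊ v Finₚ.≟ h ⌋ then H else P

    base-s : base s ≡ a
    base-s with s Finₚ.≟ s
    ... | yes _ = refl
    ... | no ¬e = contradiction refl ¬e

    base-t : base t ≡ b
    base-t with t Finₚ.≟ s | t Finₚ.≟ t
    ... | yes e | _     = contradiction (sym e) s≢t
    ... | no _  | yes _ = refl
    ... | no _  | no ¬e = contradiction refl ¬e

    base-g : base g ≡ G
    base-g with g Finₚ.≟ s | g Finₚ.≟ t | g Finₚ.≟ g
    ... | yes e | _     | _     = contradiction e (proj₁ (inner-≢ (inj₁ refl)))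
    ... | no _  | yes e | _     = contradiction e (proj₂ (inner-≢ (inj₁ refl)))
    ... | no _  | no _  | yes _ = refl
    ... | no _  | no _  | no ¬e = contradiction refl ¬e

    base-h : base h ≡ H
    base-h with h Finₚ.≟ s | h Finₚ.≟ t | h Finₚ.≟ g | h Finₚ.≟ h
    ... | yes e | _     | _     | _     = contradiction e (proj₁ (inner-≢ (inj₂ (inj₁ refl))))
    ... | no _  | yes e | _     | _     = contradiction e (proj₂ (inner-≢ (inj₂ (inj₁ refl))))
    ... | no _  | no _  | yes e | _     = contradiction (sym e) g≢h
    ... | no _  | no _  | no _  | yes _ = refl
    ... | no _  | no _  | no _  | no ¬e = contradiction refl ¬e

    base-p : base p ≡ P
    base-p with p Finₚ.≟ s | p Finₚ.≟ t | p Finₚ.≟ g | p Finₚ.≟ h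
    ... | yes e | _     | _     | _     = contradiction e (proj₁ (inner-≢ (inj₂ (inj₂ refl))))
    ... | no _  | yes e | _     | _     = contradiction e (proj₂ (inner-≢ (inj₂ (inj₂ refl))))
    ... | no _  | no _  | yes e | _     = contradiction e p≢g
    ... | no _  | no _  | no _  | yes e = contradiction e p≢h
    ... | no _  | no _  | no _  | no _  = refl

    val : Node → Bool
    val v = negated v xor base (origin C v)

    val-nonneg : ∀ {v} → NonNeg v → val v ≡ base v
    val-nonneg nn = cong₂ (λ c u → c xor base u) (nonneg-not-negated nn) (origin-nonneg nn)

    val-gate : ∀ x {v} → Binary v → ∀ k {c d} → base (src v k) ≡ c → base (src v (not k)) ≡ d →
               evalLabel x (label v) (λ {u} _ → val u) ≡ and-gate (osgn v) (sgn v k) (sgn v (not k)) c d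
    val-gate x {v} bin k refl refl = trans (and-gate-label x bin val) (trans
      (cong₂ (λ c d → osgn v xor (c ∧ d)) (xor-shift (isOr (label v)) _ _) (xor-shift (isOr (label v)) _ _)) (reorder k))
      where
      reorder : ∀ k → and-gate (osgn v) (sgn v false) (sgn v true) (base (src v false)) (base (src v true)) ≡
                    and-gate (osgn v) (sgn v k) (sgn v (not k)) (base (src v k)) (base (src v (not k)))
      reorder false = refl
      reorder true  = cong (osgn v xor_) (∧-comm (sgn v false xor base (src v false)) _)

    val-part : ∀ x {v} → Part v → v ≢ s → v ≢ t → val v ≡ evalLabel x (label v) (λ {u} _ → val u)
    val-part x (part-s e) ≢s _ = contradiction e ≢s
    val-part x (part-t e) _ ≢t = contradiction e ≢t
    val-part x (inner (inj₁ refl)) _ _ = trans (trans (val-nonneg (binary⇒nonneg gate-g)) base-g)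
      (sym (val-gate x gate-g kg (trans (cong base src-gs) base-s) (trans (cong base src-gt) base-t)))
    val-part x (inner (inj₂ (inj₁ refl))) _ _ = trans (trans (val-nonneg (binary⇒nonneg gate-h)) base-h)
      (sym (val-gate x gate-h kh (trans (cong base src-hs) base-s) (trans (cong base src-ht) base-t)))
    val-part x (inner (inj₂ (inj₂ refl))) _ _ = trans (trans (val-nonneg (binary⇒nonneg gate-p)) base-p)
      (sym (val-gate x gate-p kp (trans (cong base src-pg) base-g) (trans (cong base src-ph) base-h)))
    val-part x {v} (negation w k _ e ng) _ _ = trans
      (cong₂ (λ c u → c xor base u) (cong isNeg lab) (proj₂ (origin-of-neg lab)))
      (trans (cong not (sym (val-nonneg (proj₁ (origin-of-neg lab))))) (cong (λ l → evalLabel x l (λ {u} _ → val u)) (sym lab)))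
      where lab = negation-label {w = w} {k} e ng

    eval-D : eval D (a ∷ b ∷ []) ≡ τ xor (a xor b)
    eval-D = trans (Values.value-unique D (a ∷ b ∷ []) (val ∘ embed) respects (D.acyclic D.output))
      (trans (cong val (embed-index p-part)) (trans (val-nonneg (binary⇒nonneg gate-p)) (trans base-p (computes-xor a b))))
      where
      respects : ∀ d → val (embed d) ≡ evalLabel (a ∷ b ∷ []) (labelᴰ d) (λ {e} _ → val (embed e))
      respects d with labelᴰ d | view d
      ... | _ | is-s e = trans (cong val e) (trans (val-nonneg s-nonneg) base-s)
      ... | _ | is-t e = trans (cong val e) (trans (val-nonneg t-nonneg) base-t)
      ... | _ | other ≢s ≢t = trans (val-part x (embed-part d) ≢s ≢t)
        (sym (relabel-eval embed (a ∷ b ∷ []) x val (label (embed d)) _ (λ e → embed-index _) (not-var (embed-part d) ≢s ≢t)))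
        -- Any input of the ambient circuit will do: past the two sources no node of the block is
        -- labelled by a variable.
        where x = replicate n false

  computes-D : Computes D XOR ⊎ Computes D ¬XOR
  computes-D with τ in eq
  ... | false = inj₁ λ { (a ∷ b ∷ []) → trans (eval-D a b) (trans (cong (_xor (a xor b)) eq) (two a b)) }
    where
    two : ∀ a b → a xor b ≡ XOR (a ∷ b ∷ [])
    two a b = trans (cong (a xor_) (sym (xor-identityʳ b))) (sym (XOR≡parity (a ∷ b ∷ [])))
  ... | true  = inj₂ λ { (a ∷ b ∷ []) → trans (eval-D a b) (trans (cong (_xor (a xor b)) eq) (cong not (two a b))) }
    where
    two : ∀ a b → a xor b ≡ XOR (a ∷ b ∷ [])
    two a b = trans (cong (a xor_) (sym (xor-identityʳ b))) (sym (XOR≡parity (a ∷ b ∷ [])))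

-- Partition, labelling and tree obtained from a decomposition

module Tree {m} (C : Circuit (suc m)) (norm : Normalized C)
            (decomposition : Decompose.Decomposition (NormalizedCircuit.net C norm) (origin C (Circuit.output C))
                               (NormalizedCircuit.gates C norm) (IsVar ∘ Circuit.label C) m) where
  open Circuit C
  open NormalizedCircuit C norm
  open Decompose net using (_∈ᵇ_; Block; module Block; module Decomposition)
  open Decomposition decomposition using (source-s; source-t; root; unfed; member⁺; member⁻; disjoint) renaming (block to blk)
  module B i = Block (blk i)
  module BC i = BlockCircuit C norm (blk i)

  block : Fin m → Subset order
  block i = ⁅ B.g i ⁆ ∪ (⁅ B.h i ⁆ ∪ ⁅ B.p i ⁆)

  block⁻ : ∀ {i v} → v ∈ block i → v ∈ᵇ blk i
  block⁻ {i} v∈ with x∈p∪q⁻ ⁅ B.g i ⁆ _ v∈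
  ... | inj₁ v∈g = inj₁ (x∈⁅y⁆⇒x≡y _ v∈g)
  ... | inj₂ v∈′ with x∈p∪q⁻ ⁅ B.h i ⁆ _ v∈′
  ...   | inj₁ v∈h = inj₂ (inj₁ (x∈⁅y⁆⇒x≡y _ v∈h))
  ...   | inj₂ v∈p = inj₂ (inj₂ (x∈⁅y⁆⇒x≡y _ v∈p))

  block⁺ : ∀ {i v} → v ∈ᵇ blk i → v ∈ block i
  block⁺ (inj₁ refl)        = x∈p∪q⁺ (inj₁ (x∈⁅x⁆ _))
  block⁺ (inj₂ (inj₁ refl)) = x∈p∪q⁺ (inj₂ (x∈p∪q⁺ (inj₁ (x∈⁅x⁆ _))))
  block⁺ (inj₂ (inj₂ refl)) = x∈p∪q⁺ (inj₂ (x∈p∪q⁺ (inj₂ (x∈⁅x⁆ _))))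

  disjoint′ : ∀ {i j v} → v ∈ block i → v ∈ block j → i ≡ j
  disjoint′ {i} {j} v∈ v∈′ = disjoint {i = i} {j} (block⁻ {i} v∈) (block⁻ {j} v∈′)

  binary : ∀ {i v} → v ∈ block i → Binary v
  binary {i} v∈ = gates⁻ (member⁻ {i = i} (block⁻ {i} v∈))

  covers : ∀ {v} → Binary v → ∃[ i ] v ∈ block i
  covers b = let i , v∈ = member⁺ (gates⁺ b) in i , block⁺ {i} v∈

  isPartition : IsPartition C block
  isPartition = record { binary = λ i → binary {i} ; covers = covers ; disjoint = λ {i} {j} → disjoint′ {i} {j} }

  headIn? : ∀ i w → Dec (HeadIn C (block i) w)
  headIn? i (into {v = v} _ _) = map-dec (v ∈? block i)
    where
    map-dec : Dec (v ∈ block i) → Dec (∃[ v′ ] just v ≡ just v′ × v′ ∈ block i)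
    map-dec (yes v∈) = yes (v , refl , v∈)
    map-dec (no v∉)  = no λ { (_ , refl , v∈) → v∉ v∈ }
  headIn? i outward = no λ ()

  hasRole? : ∀ i t w → Dec (HasRole C (block i) t w)
  hasRole? i in′  w = ¬? (tail C w ∈? block i) ×-dec headIn? i w
  hasRole? i out  w = (tail C w ∈? block i) ×-dec ¬? (headIn? i w)
  hasRole? i core w = (tail C w ∈? block i) ×-dec headIn? i w

  -- Roles are decidable, so the labelling can be read off from its own description.
  lab : MultiLabelling C m
  lab w (i , t) = isYes (hasRole? i t w)

  describes : Describes C lab block
  describes w i t = mk⇔ (toWitness {a? = hasRole? i t w}) (fromWitness {a? = hasRole? i t w})

  role : ∀ {w i t} → T (lab w (i , t)) → HasRole C (block i) t w
  role {w} {i} {t} = toWitness {a? = hasRole? i t w}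

  -- Wires

  wire-source : ∀ {u v} → Binary v → u ⟶ v → ∃[ k ] src v k ≡ origin C u
  wire-source b e with edge-operand b e
  ... | k , refl = k , refl

  entering : ∀ {i u v} → v ∈ block i → (b : Binary v) → u ⟶ v →
             origin C u ∈ block i ⊎ ((v ≡ B.g i ⊎ v ≡ B.h i) × (origin C u ≡ B.s i ⊎ origin C u ≡ B.t i))
  entering {i} v∈ b e with wire-source b e
  ... | k , eq with BC.src-split i (block⁻ {i} v∈) k
  ...   | inj₁ (first , inj₁ q)  = inj₂ (first , inj₁ (trans (sym eq) q))
  ...   | inj₁ (first , inj₂ q)  = inj₂ (first , inj₂ (trans (sym eq) q))
  ...   | inj₂ (_ , inj₁ q)      = inj₁ (block⁺ {i} (inj₁ (trans (sym eq) q)))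
  ...   | inj₂ (_ , inj₂ q)      = inj₁ (block⁺ {i} (inj₂ (inj₁ (trans (sym eq) q))))

  inner-stays : ∀ {i u v} → Binary v → u ⟶ v → origin C u ≡ B.g i ⊎ origin C u ≡ B.h i → v ∈ block i
  inner-stays {i} b e q with wire-source b e
  ... | k , eq = block⁺ {i} (inj₂ (inj₂ (B.fed-by-inner i b k (Sum.map (trans eq) (trans eq) q))))

  out-not-inner : ∀ {i} → ¬ (origin C output ≡ B.g i ⊎ origin C output ≡ B.h i)
  out-not-inner {i} (inj₁ e) = unfed (B.gate-p i) (B.kp i) (trans (B.src-pg i) (sym e))
  out-not-inner {i} (inj₂ e) = unfed (B.gate-p i) (not (B.kp i)) (trans (B.src-ph i) (sym e))

  -- The gates `g` and `h` feed only `p`, and neither carries the output of the circuit because that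
  -- node feeds no gate.
  leaving : ∀ {i} w → tail C w ∈ block i → ¬ HeadIn C (block i) w → tail C w ≡ B.p i
  leaving {i} w t∈ h∉ with block⁻ {i} t∈
  leaving {i} (into b e) t∈ h∉ | inj₁ q        = contradiction (_ , refl , inner-stays {i} b e (inj₁ q)) h∉
  leaving {i} (into b e) t∈ h∉ | inj₂ (inj₁ q) = contradiction (_ , refl , inner-stays {i} b e (inj₂ q)) h∉
  leaving {i} outward t∈ h∉    | inj₁ q        = contradiction (inj₁ q) (out-not-inner {i})
  leaving {i} outward t∈ h∉    | inj₂ (inj₁ q) = contradiction (inj₂ q) (out-not-inner {i})
  leaving {i} w t∈ h∉          | inj₂ (inj₂ q) = q

  isXORBlock : ∀ i → IsXORBlock C (block i) (λ t w → T (lab w (i , t)))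
  isXORBlock i = record
    { D          = D
    ; threeGates = size-D
    ; computes   = computes-D
    ; sub        = sub
    ; gates      = λ v → mk⇔
        (λ v∈ → let part = inner (block⁻ {i} v∈) in index part ,
          binary⁺ (subst (_∈ᵇ blk i) (sym (embed-index part)) (block⁻ {i} v∈)) , embed-index part)
        (λ { (d , b , refl) → block⁺ {i} (binary⁻ {d} b) })
    ; sources    = sources
    ; outGate    = binary⁺ (subst (_∈ᵇ blk i) (sym (embed-index p-part)) (inj₂ (inj₂ refl)))
    ; inWires    = λ w l → in-wires w (role {w} {i} {in′} l)
    ; outWires   = λ w l → let t∈ , h∉ = role {w} {i} {out} l in trans (leaving {i} w t∈ h∉) (sym (embed-index p-part))
    }
    where
    open BC i
    sources : ∀ d → IsVar (labelᴰ d) → NonNeg (embed d)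
    sources d (j , eq) with labelᴰ d | view d
    ... | _ | is-s e    = subst NonNeg (sym e) s-nonneg
    ... | _ | is-t e    = subst NonNeg (sym e) t-nonneg
    ... | _ | other _ _ = contradiction eq (relabel-≢var (label (embed d)) _)
    in-wires : ∀ w → HasRole C (block i) in′ w → ∃[ d ] IsVar (labelᴰ d) × tail C w ≡ embed d
    in-wires (into b e) (t∉ , _ , refl , v∈) with entering {i} v∈ b e
    ... | inj₁ t∈           = contradiction t∈ t∉
    ... | inj₂ (_ , inj₁ q) = index (part-s refl) , (zero , label-s (embed-index _)) , trans q (sym (embed-index _))
    ... | inj₂ (_ , inj₂ q) = index (part-t refl) , (suc zero , label-t (embed-index _)) , trans q (sym (embed-index _))

  source-node : ∀ {i u} → u ≡ B.s i ⊎ u ≡ B.t i → IsVar (label u) ⊎ (∃[ j ] u ≡ B.p j)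
  source-node {i} (inj₁ refl) = source-s i
  source-node {i} (inj₂ refl) = source-t i

  inputsAreOutputs : InputsAreOutputs C lab
  inputsAreOutputs i w l with role {w} {i} {in′} l
  inputsAreOutputs i (into {u} {v} b e) l | t∉ , _ , refl , v∈ with entering {i} v∈ b e
  ... | inj₁ t∈ = contradiction t∈ t∉
  ... | inj₂ (_ , q) with source-node {i} q
  ...   | inj₁ isvar    = inj₂ isvar
  ...   | inj₂ (j , q′) = inj₁ (j , j≢i , fromWitness {a? = hasRole? j out (into b e)} (t∈j , λ { (_ , refl , v∈j) → j≢i (disjoint′ {j} {i} v∈j v∈) }))
    where
    t∈j : origin C u ∈ block j
    t∈j = block⁺ {j} (inj₂ (inj₂ q′))
    j≢i : j ≢ i
    j≢i refl = t∉ t∈j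

  -- The contracted tree

  Core : Wire C → Set
  Core = CoreWire C lab

  open Digraph (contract C Core)

  core⁺ : ∀ {i u v} (b : Binary v) (e : u ⟶ v) → origin C u ∈ block i → v ∈ block i → Core (into b e)
  core⁺ {i} b e t∈ v∈ = i , fromWitness {a? = hasRole? i core (into b e)} (t∈ , _ , refl , v∈)

  core? : ∀ w → Dec (Core w)
  core? w = Finₚ.any? λ i → T? (lab w (i , core))

  -- An explicit form of `_≈_`, shown equivalent to it below; arguments about contracted vertices
  -- become arguments about blocks.
  SameBlock : Node → Node → Set
  SameBlock u v = u ≡ v ⊎ (∃[ i ] u ∈ block i × v ∈ block i)

  sameBlock-trans : ∀ {u v w} → SameBlock u v → SameBlock v w → SameBlock u w
  sameBlock-trans (inj₁ refl) q = q
  sameBlock-trans p (inj₁ refl) = p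
  sameBlock-trans (inj₂ (i , u∈ , v∈)) (inj₂ (j , v∈′ , w∈)) with disjoint′ {i} {j} v∈ v∈′
  ... | refl = inj₂ (i , u∈ , w∈)

  sameBlock-sym : ∀ {u v} → SameBlock u v → SameBlock v u
  sameBlock-sym (inj₁ e)             = inj₁ (sym e)
  sameBlock-sym (inj₂ (i , u∈ , v∈)) = inj₂ (i , v∈ , u∈)

  CoreJoins : Vertex → Vertex → Set
  CoreJoins x y = ∃[ w ] Core w × tail C w ≡ proj₁ x × head C w ≡ just (proj₁ y)

  ≈⇒sameBlock : ∀ {x y} → x ≈ y → SameBlock (proj₁ x) (proj₁ y)
  ≈⇒sameBlock = EqClosure.fold {S = λ x y → SameBlock (proj₁ x) (proj₁ y)} {R = CoreJoins}
    (record { refl = inj₁ refl ; sym = sameBlock-sym ; trans = sameBlock-trans }) (λ {x} {y} → joined {x} {y})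
    where
    joined : ∀ {x y} → CoreJoins x y → SameBlock (proj₁ x) (proj₁ y)
    joined (w , (i , l) , refl , hd) with role {w} {i} {core} l
    ... | t∈ , v , hd′ , v∈ = inj₂ (i , t∈ , subst (_∈ block i) (just-injective (trans (sym hd′) hd)) v∈)

  ≈-refl : ∀ {x} → x ≈ x
  ≈-refl = EqClosure.reflexive CoreJoins

  ≈-sym : ∀ {x y} → x ≈ y → y ≈ x
  ≈-sym = EqClosure.symmetric CoreJoins

  ≈-trans : ∀ {x y z} → x ≈ y → y ≈ z → x ≈ z
  ≈-trans = EqClosure.transitive CoreJoins

  vertex-≡ : ∀ {x y : Vertex} → proj₁ x ≡ proj₁ y → x ≡ y
  vertex-≡ {u , nn} {.u , nn′} refl = cong (u ,_) (T-irrelevant nn nn′)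

  ≡⇒≈ : ∀ {x y} → proj₁ x ≡ proj₁ y → x ≈ y
  ≡⇒≈ {x} eq = subst (x ≈_) (vertex-≡ eq) ≈-refl

  -- The gate `p` is the hub of its block: core wires join `g` and `h` to it.
  to-output : ∀ {i} {x y : Vertex} → proj₁ x ∈ block i → proj₁ y ≡ B.p i → x ≈ y
  to-output {i} {x} {y} x∈ refl with block⁻ {i} x∈
  ... | inj₁ eq = EqClosure.return (into (B.gate-p i) (operand-edge (B.gate-p i) (B.kp i)) ,
        core⁺ {i} (B.gate-p i) (operand-edge (B.gate-p i) (B.kp i)) (subst (_∈ block i) (sym (B.src-pg i)) (block⁺ {i} (inj₁ refl))) (block⁺ {i} (inj₂ (inj₂ refl))) ,
        trans (B.src-pg i) (sym eq) , refl)
  ... | inj₂ (inj₁ eq) = EqClosure.return (into (B.gate-p i) (operand-edge (B.gate-p i) (not (B.kp i))) ,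
        core⁺ {i} (B.gate-p i) (operand-edge (B.gate-p i) (not (B.kp i))) (subst (_∈ block i) (sym (B.src-ph i)) (block⁺ {i} (inj₂ (inj₁ refl)))) (block⁺ {i} (inj₂ (inj₂ refl))) ,
        trans (B.src-ph i) (sym eq) , refl)
  ... | inj₂ (inj₂ eq) = ≡⇒≈ eq

  sameBlock⇒≈ : ∀ {x y} → SameBlock (proj₁ x) (proj₁ y) → x ≈ y
  sameBlock⇒≈ (inj₁ eq) = ≡⇒≈ eq
  sameBlock⇒≈ (inj₂ (i , x∈ , y∈)) =
    let z = B.p i , binary⇒nonneg (B.gate-p i) in
    ≈-trans (to-output {i} {y = z} x∈ refl) (≈-sym (to-output {i} {y = z} y∈ refl))

  vertex : Node → Vertex
  vertex u = origin C u , nonneg-origin u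

  -- If the output node lies in a block, it is the gate `p` of that block, and a wire leaving the
  -- block starts there. In every case the wire would start at the output node, which feeds no gate.
  rootIsSink : ∀ v → ¬ (vertex output ⇒ v)
  rootIsSink v (into b e , ¬core , x′ , y′ , x′≈ , _ , tl , hd) with ≈⇒sameBlock x′≈ | wire-source b e
  ... | inj₁ eq | k , q = unfed b k (trans q (trans tl eq))
  ... | inj₂ (i , x′∈ , r∈) | k , q with block⁻ {i} r∈
  ...   | inj₁ r        = out-not-inner {i} (inj₁ r)
  ...   | inj₂ (inj₁ r) = out-not-inner {i} (inj₂ r)
  ...   | inj₂ (inj₂ r) = unfed b k (trans q (trans (leaving {i} (into b e) t∈ λ { (_ , refl , v∈) → ¬core (core⁺ {i} b e t∈ v∈) }) (sym r)))
    where t∈ = subst (_∈ block i) (sym tl) x′∈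
  rootIsSink v (outward , _ , _ , _ , _ , _ , _ , ())

  same-tail : ∀ {u u′ v v′} (b : Binary v) (e : u ⟶ v) (b′ : Binary v′) (e′ : u′ ⟶ v′) →
              ¬ Core (into b e) → ¬ Core (into b′ e′) → SameBlock (origin C u) (origin C u′) → origin C u ≡ origin C u′
  same-tail b e b′ e′ ¬c ¬c′ (inj₁ eq) = eq
  same-tail b e b′ e′ ¬c ¬c′ (inj₂ (i , t∈ , t∈′)) = trans
    (leaving {i} (into b e) t∈ λ { (_ , refl , v∈) → ¬c (core⁺ {i} b e t∈ v∈) })
    (sym (leaving {i} (into b′ e′) t∈′ λ { (_ , refl , v∈) → ¬c′ (core⁺ {i} b′ e′ t∈′ v∈) }))

  -- Two edges leaving a contracted vertex start at the same node by `same-tail`. That node is a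
  -- source of the block the first edge enters, and all readers of such a source lie in that block.
  uniqueParent : ∀ {v x y} → v ⇒ x → v ⇒ y → x ≈ y
  uniqueParent (outward , _ , _ , _ , _ , _ , _ , ()) _
  uniqueParent (into _ _ , _) (outward , _ , _ , _ , _ , _ , _ , ())
  uniqueParent (into {u} {w} b e , ¬c , a , z , a≈ , z≈ , refl , hd) (into {u′} {w′} b′ e′ , ¬c′ , a′ , z′ , a′≈ , z′≈ , refl , hd′) =
    ≈-trans (≈-sym z≈) (≈-trans (sameBlock⇒≈ (subst₂ SameBlock (just-injective hd) (just-injective hd′) same)) z′≈)
    where
    tails : origin C u ≡ origin C u′
    tails = same-tail b e b′ e′ ¬c ¬c′ (≈⇒sameBlock (≈-trans a≈ (≈-sym a′≈)))
    same : SameBlock w w′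
    same with covers b
    ... | i , w∈ with entering {i} w∈ b e
    ...   | inj₁ t∈ = contradiction (core⁺ {i} b e t∈ w∈) ¬c
    ...   | inj₂ (_ , q) with wire-source b′ e′
    ...     | k , eq = inj₂ (i , w∈ , block⁺ {i} (first (B.fed-by-source i b′ k (Sum.map (trans (trans eq (sym tails))) (trans (trans eq (sym tails))) q))))
      where
      first : w′ ≡ B.g i ⊎ w′ ≡ B.h i → w′ ∈ᵇ blk i
      first (inj₁ r) = inj₁ r
      first (inj₂ r) = inj₂ (inj₁ r)

  Step : Vertex → Vertex → Set
  Step x y = x ≈ y ⊎ x ⇒ y

  -- Follows a path of the circuit: a step into a ¬ gate keeps the vertex, a core wire stays within
  -- its class, and any other wire is an edge of the tree.
  reaches : ∀ {u} → Star _⟶_ u output → Star Step (vertex u) (vertex output)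
  reaches ε = ε
  reaches {u} (_◅_ {j = w} e path) with neg-view w
  ... | inj₂ (u′ , lab-w) = subst (λ x → Star Step x (vertex output)) (vertex-≡ eq) (reaches path)
    where
    eq : origin C w ≡ origin C u
    eq with subst (λ l → u ∈ˡ operands l) lab-w e
    ... | here refl = origin-neg lab-w
  ... | inj₁ nn = step ◅ reaches path
    where
    edge-binary : u ⟶ w → NonNeg w → Binary w
    edge-binary e nn with label w
    edge-binary () nn | var _
    edge-binary () nn | const _
    edge-binary e nn  | _ and _ = tt
    edge-binary e nn  | _ or _  = tt
    b = edge-binary e nn
    step : Step (vertex u) (vertex w)
    step with core? (into b e)
    ... | yes c = inj₁ (EqClosure.return (into b e , c , refl , cong just (sym (origin-nonneg nn))))
    ... | no ¬c = inj₂ (into b e , ¬c , vertex u , vertex w , ≈-refl , ≈-refl , refl , cong just (sym (origin-nonneg nn)))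

  reachesRoot : ∀ v → Star Step v (vertex output)
  reachesRoot (v , nn) = subst (λ x → Star Step x (vertex output)) (vertex-≡ (origin-nonneg nn)) (reaches (Normalized.reachesOutput norm v))

  children : ∀ v → (∀ u → ¬ (u ⇒ v)) ⊎
             (∃[ l ] ∃[ r ] ¬ (l ≈ r) × l ⇒ v × r ⇒ v × (∀ u → u ⇒ v → u ≈ l ⊎ u ≈ r))
  children (v , nn) with T? (isBinary (label v))
  ... | no ¬b = inj₁ no-child
    where
    no-child : ∀ u → ¬ (u ⇒ (v , nn))
    no-child u (outward , _ , _ , _ , _ , _ , _ , ())
    no-child u (into b e , _ , x′ , y′ , _ , y≈ , _ , refl) with ≈⇒sameBlock y≈
    ... | inj₁ refl          = ¬b b
    ... | inj₂ (i , _ , v∈) = ¬b (binary {i} v∈)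
  ... | yes b with covers b
  -- The children are the two sources of the block, both read by its gate `g`.
  ...   | i , v∈ = inj₂ (s , t , s≉t , s⇒v , t⇒v , only)
    where
    open BC i using (s∉; t∉; s-nonneg; t-nonneg)
    s t g : Vertex
    s = B.s i , s-nonneg
    t = B.t i , t-nonneg
    g = B.g i , binary⇒nonneg (B.gate-g i)
    g∈ : B.g i ∈ block i
    g∈ = block⁺ {i} (inj₁ refl)
    is-output : ∀ {j u} → u ≡ B.s i ⊎ u ≡ B.t i → u ∈ block j → u ≡ B.p j
    is-output {j} {u} q u∈ with source-node {i} q
    ... | inj₁ (_ , eq) = ⊥-elim (subst (T ∘ isBinary) eq (binary {j} u∈))
    ... | inj₂ (j′ , refl) = cong B.p (disjoint′ {j′} {j} (block⁺ {j′} (inj₂ (inj₂ refl))) u∈)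
    s≉t : ¬ (s ≈ t)
    s≉t s≈t with ≈⇒sameBlock s≈t
    ... | inj₁ eq              = B.s≢t i eq
    -- A source lying in a block is the output of that block, so two sources in one block would
    -- coincide.
    ... | inj₂ (j , s∈ , t∈) = B.s≢t i (trans (is-output {j} (inj₁ refl) s∈) (sym (is-output {j} (inj₂ refl) t∈)))
    feeds : ∀ k (x : Vertex) → src (B.g i) k ≡ proj₁ x → ¬ proj₁ x ∈ᵇ blk i → x ⇒ (v , nn)
    feeds k x eq x∉ = into (B.gate-g i) (operand-edge (B.gate-g i) k) , ¬core , x , g , ≈-refl ,
                      sameBlock⇒≈ (inj₂ (i , g∈ , v∈)) , eq , refl
      where
      ¬core : ¬ Core (into (B.gate-g i) (operand-edge (B.gate-g i) k))
      ¬core (j , l) with role {into (B.gate-g i) (operand-edge (B.gate-g i) k)} {j} {core} l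
      ... | t∈ , _ , refl , g∈j with disjoint′ {i} {j} g∈ g∈j
      ...   | refl = x∉ (block⁻ {i} (subst (_∈ block i) eq t∈))
    s⇒v : s ⇒ (v , nn)
    s⇒v = feeds (B.kg i) s (B.src-gs i) s∉
    t⇒v : t ⇒ (v , nn)
    t⇒v = feeds (not (B.kg i)) t (B.src-gt i) t∉
    only : ∀ u → u ⇒ (v , nn) → u ≈ s ⊎ u ≈ t
    only u (outward , _ , _ , _ , _ , _ , _ , ())
    only u (into b′ e , ¬c , x′ , y′ , x≈ , y≈ , refl , refl) = from (entering {i} y∈ b′ e)
      where
      y∈ : proj₁ y′ ∈ block i
      y∈ with ≈⇒sameBlock y≈
      ... | inj₁ eq = subst (_∈ block i) (sym eq) v∈
      ... | inj₂ (j , y∈j , v∈j) with disjoint′ {j} {i} v∈j v∈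
      ...   | refl = y∈j
      from : proj₁ x′ ∈ block i ⊎ (_ × (proj₁ x′ ≡ B.s i ⊎ proj₁ x′ ≡ B.t i)) → u ≈ s ⊎ u ≈ t
      from (inj₁ t∈)           = contradiction (core⁺ {i} b′ e t∈ y∈) ¬c
      from (inj₂ (_ , inj₁ q)) = inj₁ (≈-trans (≈-sym x≈) (≡⇒≈ q))
      from (inj₂ (_ , inj₂ q)) = inj₂ (≈-trans (≈-sym x≈) (≡⇒≈ q))

  isBinaryTree : IsBinaryTree (contract C Core)
  isBinaryTree = record
    { root = vertex output ; rootIsSink = rootIsSink ; uniqueParent = uniqueParent
    ; reachesRoot = reachesRoot ; children = children }

-- The sign `b` treats `XOR` and `¬XOR` at once. Minimality enters as the size bound, obtained by
-- comparison with `xor-circuit`.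
structure : ∀ {m} (C : Circuit (suc m)) b → (∀ x → eval C x ≡ b xor parity x) → Circuit.size C ≤ 3 * m → Normalized C →
    Σ[ block ∈ (Fin m → Subset (Circuit.order C)) ]
    Σ[ lab ∈ MultiLabelling C m ]
    IsPartition C block ×
    Describes C lab block ×
    (∀ i → IsXORBlock C (block i) (λ t w → T (lab w (i , t)))) ×
    InputsAreOutputs C lab ×
    IsBinaryTree (contract C (CoreWire C lab))
structure C b comp size≤ norm = block , lab , isPartition , describes , isXORBlock , inputsAreOutputs , isBinaryTree
  where open Tree C norm (OptimalCircuit.decomposition C b comp size≤ norm)

mainTheorem2 : (n : ℕ) → n ≥ 1 → (C : Circuit n) →
    Optimal C XOR ⊎ Optimal C ¬XOR →
    Σ[ block ∈ (Fin (n ∸ 1) → Subset (Circuit.order C)) ]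
    Σ[ lab ∈ MultiLabelling C (n ∸ 1) ]
    IsPartition C block ×
    Describes C lab block ×
    (∀ i → IsXORBlock C (block i) (λ t w → T (lab w (i , t)))) ×
    InputsAreOutputs C lab ×
    IsBinaryTree (contract C (CoreWire C lab))
mainTheorem2 (suc m) _ C (inj₁ (comp , (_ , minimal) , norm)) =
  let D , compᴰ , sizeᴰ = xor-circuit false m in
  structure C false (λ x → trans (comp x) (XOR≡parity x))
    (ℕₚ.≤-trans (minimal D λ x → trans (compᴰ x) (sym (XOR≡parity x))) (ℕₚ.≤-reflexive sizeᴰ)) norm
mainTheorem2 (suc m) _ C (inj₂ (comp , (_ , minimal) , norm)) =
  let D , compᴰ , sizeᴰ = xor-circuit true m in
  structure C true (λ x → trans (comp x) (cong not (XOR≡parity x)))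
    (ℕₚ.≤-trans (minimal D λ x → trans (compᴰ x) (cong not (sym (XOR≡parity x)))) (ℕₚ.≤-reflexive sizeᴰ)) norm
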